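{- Let $k\ge 1$, $n\ge 2$, $\mathbf C=(c_0,\dots,c_k)\in\{0,1\}^{k+1}$, and $\gamma$ Euler's constant. Put $\lambda=c_0(n-1)+c_1k(\log(n-1)+\gamma)+\frac{\pi^2}{6}\sum_{\beta=2}^kc_\beta\binom{k}{\beta}$ and $\lambda'=c'_0(n-1)+c'_1k(\log(n-1)+\gamma)+\frac{\pi^2}{6}\sum_{\beta=2}^kc'_\beta\binom{k}{\beta}$. Then: (i) for $0\le m\le n$, $O_{\mathbf C}(n,m)\le O_{\mathbf C'\max}(n,n-m)$; (ii) $\dfrac{\sum_{m=0}^nO_{\mathbf C\max}(n,m)}{\sum_{m=0}^nO_{\mathbf C}(n,m)}\le\exp(\lambda)$; (iii) $\dfrac{\sum_{m=0}^nO_{\mathbf C'\max}(n,m)}{\sum_{m=0}^nO_{\mathbf C}(n,m)}\le\exp(\lambda')$; (iv) for $k=1$, $\mathbf C=(0,1)$, with $s_u(n,m)$ the unsigned Stirling numbers of the first kind and $s_{u\max}(n,m)=\frac{(n-1)!}{(m-1)!}\left(\sum_{i=1}^{n-1}\frac1i\right)^{m-1}$ for $1\le m\le n$ (and $0$ for $m=0$), $$\frac{\sum_{m=0}^ns_{u\max}(n,m)}{\sum_{m=0}^ns_u(n,m)}\le\frac{n-1}{n}\exp\Big(\sum_{j=2}^n\frac1{j-1}-\log(n-1)\Big)\le\exp(\gamma)\le 1.7811.$$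
   Context: Fix integers $k\ge 1$, $n\ge 2$ and $\mathbf C=(c_0,\dots,c_k)\in\{0,1\}^{k+1}$; put $\mathbf C'=(1,\dots,1)-\mathbf C=(c'_0,\dots,c'_k)$. Consider $k$-tuples $(\pi_1,\dots,\pi_k)$ of permutations of $\{1,\dots,n\}$. A position $\alpha$ is a record of a permutation $\pi$ if $\pi(\alpha)<\pi(\alpha')$ for every $\alpha'<\alpha$ (position $1$ is always a record). For a tuple, let $l_\alpha$ be the number of $\beta\in\{1,\dots,k\}$ for which $\alpha$ is a record of $\pi_\beta$. The $\mathbf C$ sequential optimization set is $S=\{\alpha:c_{l_\alpha}=1\}$, with weight $|S|$; $O_{\mathbf C}(n,m)$ is the number of $k$-tuples of weight $m$ (for integer $m$), and $O_{\mathbf C'}$ is the same with $\mathbf C'$. For $j\ge2$ and $X\in\mathbb R^{k+1}$, $F_j(X)=\sum_{\beta=0}^k\binom{k}{\beta}\frac{x_\beta}{(j-1)^\beta}$. Let $\mathbf H_n\mathbf X^T=\sum_{\beta=0}^k x_\beta\binom{k}{\beta}\sum_{j=1}^{n-1}j^{ -\beta}$. For $1\le m\le n$, $O_{\mathbf C\max}(n,m+c_k-1)=\frac{(n-1)!^k}{(m-1)!}(\mathbf H_n\mathbf C^T)^{m-1}\prod_{i=1}^{n-m}F_{i+1}(\mathbf C')$ and $O_{\mathbf C'\max}(n,m+c'_k-1)=\frac{(n-1)!^k}{(m-1)!}(\mathbf H_n\mathbf C'^T)^{m-1}\prod_{i=1}^{n-m}F_{i+1}(\mathbf C)$; at integer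 arguments outside these ranges $O_{\mathbf C\max}$ and $O_{\mathbf C'\max}$ are taken to be $0$. Empty products equal $1$; $\log$ is the natural logarithm. -}

module Defs where

open import Data.Nat.Base as ℕ using (ℕ; zero; suc; _∸_; _!; z≤n; s≤s)
open import Data.Nat.Properties as ℕ using (_!≢0)
open import Data.Integer.Base as ℤ using (+_)
import Data.Integer.Properties as ℤ
open import Data.Rational.Base as ℚ
open import Data.Rational.Properties as ℚ
import Data.Rational.Unnormalised.Base as ℚᵘ
import Data.Rational.Unnormalised.Properties as ℚᵘ
open import Data.Rational.Solver using (module +-*-Solver)
open import Data.Nat.Combinatorics using () renaming (_C_ to _choose_)
open import Data.Bool.Base using (if_then_else_)
open import Data.Fin.Base as Fin using (Fin; zero; suc; toℕ; fromℕ<; opposite)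
open import Data.Fin.Properties as Fin using (all?; toℕ-fromℕ; toℕ-fromℕ<)
open import Data.List.Base as List using (List; []; _∷_; length; filter; cartesianProductWith)
open import Data.List.Membership.Propositional using (_∈_)
open import Data.List.Membership.Propositional.Properties
  using (∈-filter⁺; ∈-cartesianProductWith⁺; ∈-allFin; ∈-length)
open import Data.List.Relation.Unary.Any using (here)
open import Data.Vec.Base as Vec using (Vec; []; _∷_; lookup; last)
open import Data.Vec.Properties as Vec using (count≤n)
open import Function.Definitions using (Injective)
open import Relation.Nullary.Decidable using (Dec; does; map′; _→-dec_; _×-dec_)
open import Data.Product using (∃; _×_; _,_; proj₁; proj₂)
open import Data.Sum.Base using (inj₁; inj₂)
open import Relation.Binary.PropositionalEquality
  using (_≡_; refl; sym; trans; cong; cong₂; subst; subst₂)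
open import Algebra.Definitions.RawSemiring ℚ.+-*-rawSemiring public
  using (_^_; product)
open import Algebra.Properties.Monoid.Sum ℚ.+-0-monoid public
  using (sum-syntax; sum⁺-syntax)

open +-*-Solver using (solve; _:=_; _:+_; _:*_; _:-_; :-_; con)

∏-syntax : ∀ n → (Fin n → ℚ) → ℚ
∏-syntax _ = product

syntax ∏-syntax n (λ i → x) = ∏[ i < n ] x

fromℕ : ℕ → ℚ
fromℕ n = + n / 1

rec : ℕ → ℚ
rec n = + 1 / suc n

toℚᵘ-/ : ∀ i d → toℚᵘ (i / suc d) ℚᵘ.≃ ℚᵘ.mkℚᵘ i d
toℚᵘ-/ i d = ℚ.toℚᵘ-fromℚᵘ (ℚᵘ.mkℚᵘ i d)

/-≤ : ∀ i j a b → i ℤ.* (+ suc b) ℤ.≤ j ℤ.* (+ suc a) → i / suc a ≤ j / suc b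
/-≤ i j a b le = ℚ.toℚᵘ-cancel-≤
  (ℚᵘ.≤-respˡ-≃ (ℚᵘ.≃-sym (toℚᵘ-/ i a)) (ℚᵘ.≤-respʳ-≃ (ℚᵘ.≃-sym (toℚᵘ-/ j b)) (ℚᵘ.*≤* le)))

/-≡ : ∀ i j a b → i ℤ.* (+ suc b) ≡ j ℤ.* (+ suc a) → i / suc a ≡ j / suc b
/-≡ i j a b e = ℚ.toℚᵘ-injective
  (ℚᵘ.≃-trans (toℚᵘ-/ i a) (ℚᵘ.≃-trans (ℚᵘ.*≡* e) (ℚᵘ.≃-sym (toℚᵘ-/ j b))))

/-* : ∀ i j a b → (i / suc a) * (j / suc b) ≡ (i ℤ.* j) / (suc a ℕ.* suc b)
/-* i j a b = ℚ.toℚᵘ-injective (ℚᵘ.≃-trans (ℚ.toℚᵘ-homo-* (i / suc a) (j / suc b))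
  (ℚᵘ.≃-trans (ℚᵘ.*-cong (toℚᵘ-/ i a) (toℚᵘ-/ j b)) (ℚᵘ.≃-sym (toℚᵘ-/ (i ℤ.* j) (b ℕ.+ a ℕ.* suc b)))))

rec-* : ∀ a b → rec a * rec b ≡ + 1 / (suc a ℕ.* suc b)
rec-* a b = /-* (+ 1) (+ 1) a b

rec-anti : ∀ {a b} → a ℕ.≤ b → rec b ≤ rec a
rec-anti {a} {b} le = /-≤ (+ 1) (+ 1) b a
  (subst₂ ℤ._≤_ (sym (ℤ.*-identityˡ (+ suc a))) (sym (ℤ.*-identityˡ (+ suc b))) (ℤ.+≤+ (s≤s le)))

fromℕ-mono : ∀ {a b} → a ℕ.≤ b → fromℕ a ≤ fromℕ b
fromℕ-mono {a} {b} le = /-≤ (+ a) (+ b) 0 0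
  (subst₂ ℤ._≤_ (sym (ℤ.*-identityʳ (+ a))) (sym (ℤ.*-identityʳ (+ b))) (ℤ.+≤+ le))

fromℕ-suc : ∀ n → fromℕ (suc n) ≡ 1ℚ + fromℕ n
fromℕ-suc n = ℚ.toℚᵘ-injective (ℚᵘ.≃-trans (toℚᵘ-/ (+ suc n) 0)
  (ℚᵘ.≃-sym (ℚᵘ.≃-trans (ℚ.toℚᵘ-homo-+ 1ℚ (fromℕ n))
    (ℚᵘ.≃-trans (ℚᵘ.+-cong {x = toℚᵘ 1ℚ} {y = toℚᵘ 1ℚ} ℚᵘ.≃-refl (toℚᵘ-/ (+ n) 0))
      (ℚᵘ.*≡* (cong (ℤ._* + 1) (cong (λ z → + 1 ℤ.+ z) (ℤ.*-identityʳ (+ n)))))))))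

fromℕ-rec : ∀ n → fromℕ (suc n) * rec n ≡ 1ℚ
fromℕ-rec n = trans (/-* (+ suc n) (+ 1) 0 n)
  (trans (/-≡ (+ suc n ℤ.* + 1) (+ 1) (n ℕ.+ 0) 0 (trans (ℤ.*-identityʳ _) (trans (ℤ.*-identityʳ (+ suc n))
    (sym (trans (ℤ.*-identityˡ (+ suc (n ℕ.+ 0))) (cong (λ z → + suc z) (ℕ.+-identityʳ n))))))) refl)

fromℕ≥0 : ∀ n → 0ℚ ≤ fromℕ n
fromℕ≥0 n = fromℕ-mono {0} {n} z≤n

rec>0 : ∀ n → 0ℚ < rec n
rec>0 n = ℚ.positive⁻¹ (rec n) {{ℚ.normalize-pos 1 (suc n)}}

rec≥0 : ∀ n → 0ℚ ≤ rec n
rec≥0 n = ℚ.<⇒≤ (rec>0 n)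

*-monoˡ : ∀ {r p q} → 0ℚ ≤ r → p ≤ q → r * p ≤ r * q
*-monoˡ {r} 0≤r = ℚ.*-monoˡ-≤-nonNeg r {{ℚ.nonNegative 0≤r}}

*-monoʳ : ∀ {r p q} → 0ℚ ≤ r → p ≤ q → p * r ≤ q * r
*-monoʳ {r} 0≤r = ℚ.*-monoʳ-≤-nonNeg r {{ℚ.nonNegative 0≤r}}

≤-eq : ∀ {p q p′ q′} → p ≡ p′ → q ≡ q′ → p′ ≤ q′ → p ≤ q
≤-eq refl refl le = le

*≥0 : ∀ {p q} → 0ℚ ≤ p → 0ℚ ≤ q → 0ℚ ≤ p * q
*≥0 {p} 0≤p 0≤q = ≤-eq (sym (ℚ.*-zeroʳ p)) refl (*-monoˡ 0≤p 0≤q)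

-- to prove p ≤ q, exhibit q as p plus something non-negative
+-slack : ∀ {p q} s → 0ℚ ≤ s → q ≡ p + s → p ≤ q
+-slack {p} s 0≤s refl = ≤-eq (sym (ℚ.+-identityʳ p)) refl (ℚ.+-monoʳ-≤ p 0≤s)

≤⇒0≤- : ∀ {p q} → p ≤ q → 0ℚ ≤ q - p
≤⇒0≤- {p} le = ≤-eq (sym (ℚ.+-inverseʳ p)) refl (ℚ.+-monoˡ-≤ (- p) le)

p≤∣p∣ : ∀ p → p ≤ ∣ p ∣
p≤∣p∣ p with ℚ.≤-total 0ℚ p
... | inj₁ 0≤p = ℚ.≤-reflexive (sym (ℚ.0≤p⇒∣p∣≡p 0≤p))
... | inj₂ p≤0 = ℚ.≤-trans p≤0 (ℚ.0≤∣p∣ p)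

∣∣-lub : ∀ p {c} → p ≤ c → - p ≤ c → ∣ p ∣ ≤ c
∣∣-lub p a b with ℚ.∣p∣≡p∨∣p∣≡-p p
... | inj₁ e = subst (_≤ _) (sym e) a
... | inj₂ e = subst (_≤ _) (sym e) b

*-bound : ∀ x y {b d} → ∣ x ∣ ≤ b → ∣ y ∣ ≤ d → ∣ x * y ∣ ≤ b * d
*-bound x y {b} {d} p q = subst (_≤ b * d) (sym (ℚ.∣p*q∣≡∣p∣*∣q∣ x y))
  (ℚ.≤-trans (*-monoˡ (ℚ.0≤∣p∣ x) q) (*-monoʳ (ℚ.≤-trans (ℚ.0≤∣p∣ y) q) p))

above : ∀ q → ∃ λ N → q ≤ fromℕ N
above q@(mkℚ (+ n) d c) = n , ≤-eq (sym (ℚ.↥p/↧p≡p q)) refl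
  (/-≤ (+ n) (+ n) d 0 (ℤ.*-monoˡ-≤-nonNeg (+ n) {+ 1} {+ suc d} (ℤ.+≤+ (s≤s z≤n))))
above q@(mkℚ (ℤ.-[1+ n ]) d c) = 0 , ℚ.nonPositive⁻¹ q

below : ∀ {ε} → 0ℚ < ε → ∃ λ K → rec K ≤ ε
below {ε@(mkℚ (+ zero) d c)} 0<ε with () ← ℚ.positive 0<ε
below {ε@(mkℚ (+ suc n) d c)} 0<ε = d , ≤-eq refl (sym (ℚ.↥p/↧p≡p ε))
  (/-≤ (+ 1) (+ suc n) d d (ℤ.*-monoʳ-≤-nonNeg (+ suc d) {+ 1} {+ suc n} (ℤ.+≤+ (s≤s z≤n))))
below {ε@(mkℚ (ℤ.-[1+ n ]) d c)} 0<ε with () ← ℚ.positive 0<ε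

shrink : ∀ c {ε} → 0ℚ < ε → ∃ λ δ → 0ℚ < δ × fromℕ c * δ ≤ ε
shrink c {ε} 0<ε = ε * rec c
  , ℚ.positive⁻¹ _ {{ℚ.pos*pos⇒pos ε {{ℚ.positive 0<ε}} (rec c) {{ℚ.positive (rec>0 c)}}}}
  , ≤-eq refl
      (trans (sym (ℚ.*-identityˡ ε)) (trans (cong (_* ε) (sym (fromℕ-rec c)))
        (solve 3 (λ f r e → f :* r :* e := f :* (e :* r)) refl (fromℕ (suc c)) (rec c) ε)))
      (*-monoʳ (*≥0 (ℚ.<⇒≤ 0<ε) (rec≥0 c)) (fromℕ-mono (ℕ.n≤1+n c)))

-- m and n play symmetric roles, so this bounds the absolute value.
IsCauchy : (ℕ → ℚ) → Set
IsCauchy s = ∀ ε → 0ℚ < ε → ∃ λ N → ∀ {m n} → N ℕ.≤ m → N ℕ.≤ n → s m - s n ≤ ε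

record ℝ : Set where
  constructor mkℝ
  field
    seq    : ℕ → ℚ
    cauchy : IsCauchy seq

open ℝ public

infix 4 _≤ᴿ_

_≤ᴿ_ : ℝ → ℝ → Set
x ≤ᴿ y = ∀ ε → 0ℚ < ε → ∃ λ N → ∀ {n} → N ℕ.≤ n → seq x n - seq y n ≤ ε

fromℚ : ℚ → ℝ
fromℚ q = mkℝ (λ _ → q) λ ε 0<ε → 0 , λ _ _ → ≤-eq (ℚ.+-inverseʳ q) refl (ℚ.<⇒≤ 0<ε)

2* : ∀ δ → δ + δ ≡ fromℕ 2 * δ
2* = solve 1 (λ δ → δ :+ δ := con (fromℕ 2) :* δ) refl

+-cauchy : ∀ s t → IsCauchy s → IsCauchy t → IsCauchy (λ n → s n + t n)
+-cauchy s t cs ct ε 0<ε =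
  let δ , 0<δ , 2δ≤ε = shrink 2 0<ε
      M , p = cs δ 0<δ
      N , q = ct δ 0<δ
  in M ℕ.⊔ N , λ {m} {n} hm hn → ℚ.≤-trans
       (≤-eq (solve 4 (λ a b c d → (a :+ b) :- (c :+ d) := (a :- c) :+ (b :- d)) refl (s m) (t m) (s n) (t n))
             (sym (2* δ))
             (ℚ.+-mono-≤ (p (ℕ.m⊔n≤o⇒m≤o M N hm) (ℕ.m⊔n≤o⇒m≤o M N hn))
                         (q (ℕ.m⊔n≤o⇒n≤o M N hm) (ℕ.m⊔n≤o⇒n≤o M N hn))))
       2δ≤ε

neg-cauchy : ∀ s → IsCauchy s → IsCauchy (λ n → - s n)
neg-cauchy s cs ε 0<ε = let N , p = cs ε 0<ε in
  N , λ {m} {n} hm hn → ≤-eq (solve 2 (λ a b → (:- a) :- (:- b) := b :- a) refl (s m) (s n)) refl (p hn hm)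

bounded : ∀ s → IsCauchy s → ∃ λ B → ∃ λ N → ∀ {n} → N ℕ.≤ n → ∣ s n ∣ ≤ fromℕ B
bounded s cs =
  let N , p = cs 1ℚ (rec>0 0)
      B , q = above (1ℚ + ∣ s N ∣)
  in B , N , λ {n} hn → ℚ.≤-trans
       (≤-eq (cong ∣_∣ (solve 2 (λ a b → a := (a :- b) :+ b) refl (s n) (s N))) refl
         (ℚ.≤-trans (ℚ.∣p+q∣≤∣p∣+∣q∣ (s n - s N) (s N))
           (ℚ.+-monoˡ-≤ ∣ s N ∣ (∣∣-lub (s n - s N) (p hn ℕ.≤-refl)
             (≤-eq (solve 2 (λ a b → :- (a :- b) := b :- a) refl (s n) (s N)) refl (p ℕ.≤-refl hn))))))
       q

*-cauchy : ∀ s t → IsCauchy s → IsCauchy t → IsCauchy (λ n → s n * t n)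
*-cauchy s t cs ct ε 0<ε =
  let δ , 0<δ , 2δ≤ε = shrink 2 0<ε
      A , M₀ , p₀ = bounded s cs
      B , N₀ , q₀ = bounded t ct
      a , 0<a , Aa≤δ = shrink A 0<δ
      b , 0<b , Bb≤δ = shrink B 0<δ
      M , p = cs b 0<b
      N , q = ct a 0<a
      M₁ = M₀ ℕ.⊔ M
      N₁ = N₀ ℕ.⊔ N
      inM₀ : ∀ {k} → M₁ ℕ.⊔ N₁ ℕ.≤ k → M₀ ℕ.≤ k
      inM₀ h = ℕ.m⊔n≤o⇒m≤o M₀ M (ℕ.m⊔n≤o⇒m≤o M₁ N₁ h)
      inM : ∀ {k} → M₁ ℕ.⊔ N₁ ℕ.≤ k → M ℕ.≤ k
      inM h = ℕ.m⊔n≤o⇒n≤o M₀ M (ℕ.m⊔n≤o⇒m≤o M₁ N₁ h)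
      inN₀ : ∀ {k} → M₁ ℕ.⊔ N₁ ℕ.≤ k → N₀ ℕ.≤ k
      inN₀ h = ℕ.m⊔n≤o⇒m≤o N₀ N (ℕ.m⊔n≤o⇒n≤o M₁ N₁ h)
      inN : ∀ {k} → M₁ ℕ.⊔ N₁ ℕ.≤ k → N ℕ.≤ k
      inN h = ℕ.m⊔n≤o⇒n≤o N₀ N (ℕ.m⊔n≤o⇒n≤o M₁ N₁ h)
      dist : ∀ x y {c} → x - y ≤ c → y - x ≤ c → ∣ x - y ∣ ≤ c
      dist x y h h′ = ∣∣-lub (x - y) h (≤-eq (solve 2 (λ x y → :- (x :- y) := y :- x) refl x y) refl h′)
  in M₁ ℕ.⊔ N₁ , λ {m} {n} hm hn → ℚ.≤-trans
       (≤-eq (solve 4 (λ x y z w → x :* y :- z :* w := x :* (y :- w) :+ w :* (x :- z)) refl (s m) (t m) (s n) (t n))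
             (sym (2* δ))
             (ℚ.+-mono-≤
               (ℚ.≤-trans (p≤∣p∣ _) (ℚ.≤-trans
                 (*-bound (s m) (t m - t n) (p₀ (inM₀ hm)) (dist (t m) (t n) (q (inN hm) (inN hn)) (q (inN hn) (inN hm)))) Aa≤δ))
               (ℚ.≤-trans (p≤∣p∣ _) (ℚ.≤-trans
                 (*-bound (t n) (s m - s n) (q₀ (inN₀ hn)) (dist (s m) (s n) (p (inM hm) (inM hn)) (p (inM hn) (inM hm)))) Bb≤δ))))
       2δ≤ε

infixl 6 _+ᴿ_ _-ᴿ_
infixl 7 _*ᴿ_
infix  8 -ᴿ_
infixr 8 _^ᴿ_

_+ᴿ_ : ℝ → ℝ → ℝ
x +ᴿ y = mkℝ (λ n → seq x n + seq y n) (+-cauchy (seq x) (seq y) (cauchy x) (cauchy y))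

_*ᴿ_ : ℝ → ℝ → ℝ
x *ᴿ y = mkℝ (λ n → seq x n * seq y n) (*-cauchy (seq x) (seq y) (cauchy x) (cauchy y))

-ᴿ_ : ℝ → ℝ
-ᴿ x = mkℝ (λ n → - seq x n) (neg-cauchy (seq x) (cauchy x))

_-ᴿ_ : ℝ → ℝ → ℝ
x -ᴿ y = x +ᴿ (-ᴿ y)

_^ᴿ_ : ℝ → ℕ → ℝ
x ^ᴿ zero  = fromℚ 1ℚ
x ^ᴿ suc n = x *ᴿ x ^ᴿ n

IsCauchyᴿ : (ℕ → ℝ) → Set
IsCauchyᴿ a = ∀ ε → 0ℚ < ε → ∃ λ N → ∀ {m n} → N ℕ.≤ m → N ℕ.≤ n → a m -ᴿ a n ≤ᴿ fromℚ ε

-- The limit of a Cauchy sequence of reals: its k-th approximant is a rational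
-- within 1/(k+1) of a k.
lim : (a : ℕ → ℝ) → IsCauchyᴿ a → ℝ
lim a ca = mkℝ (λ k → seq (a k) (idx k)) λ ε 0<ε →
    let δ , 0<δ , 4δ≤ε = shrink 4 0<ε
        K , r = below 0<δ
        N , p = ca δ 0<δ
    in K ℕ.⊔ N , λ {m} {n} hm hn →
      let I , q = p (ℕ.m⊔n≤o⇒n≤o K N hm) (ℕ.m⊔n≤o⇒n≤o K N hn) δ 0<δ
          i = I ℕ.⊔ (idx m ℕ.⊔ idx n)
          hI : I ℕ.≤ i
          hI = ℕ.m≤m⊔n I (idx m ℕ.⊔ idx n)
          hi : idx m ℕ.⊔ idx n ℕ.≤ i
          hi = ℕ.m≤n⊔m I (idx m ℕ.⊔ idx n)
          A = proj₂ (modulus m) ℕ.≤-refl (ℕ.m⊔n≤o⇒m≤o (idx m) (idx n) hi)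
          B = proj₂ (modulus n) (ℕ.m⊔n≤o⇒n≤o (idx m) (idx n) hi) ℕ.≤-refl
      in ℚ.≤-trans
           (≤-eq (solve 5 (λ a b c d δ → a :- d := (((a :- b) :+ (((b :- c) :- δ) :+ δ)) :+ (c :- d))) refl
                   (seq (a m) (idx m)) (seq (a m) i) (seq (a n) i) (seq (a n) (idx n)) δ)
                 (solve 1 (λ δ → con (fromℕ 4) :* δ := (δ :+ (δ :+ δ)) :+ δ) refl δ)
                 (ℚ.+-mono-≤ (ℚ.+-mono-≤
                   (ℚ.≤-trans A (ℚ.≤-trans (rec-anti (ℕ.m⊔n≤o⇒m≤o K N hm)) r))
                   (ℚ.+-monoˡ-≤ δ (q hI)))
                   (ℚ.≤-trans B (ℚ.≤-trans (rec-anti (ℕ.m⊔n≤o⇒m≤o K N hn)) r))))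
           4δ≤ε
  where
  modulus : ∀ k → ∃ λ N → ∀ {m n} → N ℕ.≤ m → N ℕ.≤ n → seq (a k) m - seq (a k) n ≤ rec k
  modulus k = cauchy (a k) (rec k) (rec>0 k)
  idx : ℕ → ℕ
  idx k = proj₁ (modulus k)

near : ∀ (s : ℕ → ℚ) {N d} → (∀ j → s (N ℕ.+ j) - s N ≤ d) → (∀ j → s N - s (N ℕ.+ j) ≤ d) →
       ∀ {m n} → N ℕ.≤ m → N ℕ.≤ n → s m - s n ≤ d + d
near s {N} {d} p q {m} {n} hm hn =
  ≤-eq (solve 3 (λ a b c → a :- c := (a :- b) :+ (b :- c)) refl (s m) (s N) (s n)) refl
    (ℚ.+-mono-≤ (subst (λ z → s z - s N ≤ d) (ℕ.m+[n∸m]≡n hm) (p (m ∸ N)))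
                (subst (λ z → s N - s z ≤ d) (ℕ.m+[n∸m]≡n hn) (q (n ∸ N))))

telescope : ∀ (s u : ℕ → ℚ) {N} → (∀ {i} → N ℕ.≤ i → s (suc i) - s i ≤ u i - u (suc i)) →
            (∀ i → 0ℚ ≤ u i) → ∀ j → s (N ℕ.+ j) - s N ≤ u N
telescope s u {N} inc u≥0 j = ℚ.≤-trans (go j)
    (+-slack (u (N ℕ.+ j)) (u≥0 (N ℕ.+ j)) (solve 2 (λ a b → a := (a :- b) :+ b) refl (u N) (u (N ℕ.+ j))))
  where
  go : ∀ j → s (N ℕ.+ j) - s N ≤ u N - u (N ℕ.+ j)
  go zero rewrite ℕ.+-identityʳ N = ℚ.≤-reflexive (trans (ℚ.+-inverseʳ (s N)) (sym (ℚ.+-inverseʳ (u N))))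
  go (suc j) rewrite ℕ.+-suc N j =
    ≤-eq (solve 3 (λ a b c → a :- c := (a :- b) :+ (b :- c)) refl (s (suc (N ℕ.+ j))) (s (N ℕ.+ j)) (s N))
         (solve 3 (λ a b c → c :- a := (b :- a) :+ (c :- b)) refl (u (suc (N ℕ.+ j))) (u (N ℕ.+ j)) (u N))
         (ℚ.+-mono-≤ (inc (ℕ.m≤m+n N j)) (go j))

telescope± : ∀ (s u : ℕ → ℚ) {N} → (∀ i → 0ℚ ≤ u i) →
             (∀ {i} → N ℕ.≤ i → s (suc i) - s i ≤ u i - u (suc i)) →
             (∀ {i} → N ℕ.≤ i → s i - s (suc i) ≤ u i - u (suc i)) →
             ∀ {m n} → N ℕ.≤ m → N ℕ.≤ n → s m - s n ≤ u N + u N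
telescope± s u {N} u≥0 inc dec = near s (telescope s u inc u≥0)
  λ j → ≤-eq (flip′ (s N) (s (N ℕ.+ j))) refl
    (telescope (λ i → - s i) u (λ {i} h → ≤-eq (sym (flip′ (s i) (s (suc i)))) refl (dec h)) u≥0 j)
  where
  flip′ : ∀ a b → a - b ≡ (- b) - (- a)
  flip′ = solve 2 (λ a b → a :- b := (:- b) :- (:- a)) refl

-- a sequence within 2/(N+1) of itself from N on is Cauchy
rec-cauchy : ∀ s → (∀ N {m n} → N ℕ.≤ m → N ℕ.≤ n → s m - s n ≤ rec N + rec N) → IsCauchy s
rec-cauchy s p ε 0<ε =
  let δ , 0<δ , 2δ≤ε = shrink 2 0<ε
      K , r = below 0<δ
  in K , λ hm hn → ℚ.≤-trans (p K hm hn) (ℚ.≤-trans (≤-eq refl (sym (2* δ)) (ℚ.+-mono-≤ r r)) 2δ≤ε)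

seriesᴿ : (ℕ → ℝ) → ℕ → ℝ
seriesᴿ a zero    = fromℚ 0ℚ
seriesᴿ a (suc N) = seriesᴿ a N +ᴿ a N

expTerm : ℝ → ℕ → ℝ
expTerm x i = x ^ᴿ i *ᴿ fromℚ ((+ 1 / i !) {{i !≢0}})

rec! : ℕ → ℚ
rec! i = (+ 1 / i !) {{i !≢0}}

rec!-suc : ∀ i → rec! (suc i) ≡ rec i * rec! i
rec!-suc i = go (i !) {{i !≢0}} {{suc i !≢0}}
  where
  go : ∀ f .{{_ : ℕ.NonZero f}} .{{_ : ℕ.NonZero (suc i ℕ.* f)}} → + 1 / (suc i ℕ.* f) ≡ rec i * (+ 1 / f)
  go (suc f) = sym (rec-* i f)

rec!≥0 : ∀ i → 0ℚ ≤ rec! i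
rec!≥0 i = ℚ.nonNegative⁻¹ (rec! i) {{ℚ.normalize-nonNeg 1 (i !) {{i !≢0}}}}

^≥0 : ∀ {p} → 0ℚ ≤ p → ∀ i → 0ℚ ≤ p ^ i
^≥0 0≤p zero    = ℚ.<⇒≤ (rec>0 0)
^≥0 0≤p (suc i) = *≥0 0≤p (^≥0 0≤p i)

-- |xⁱ/i!| ≤ b i for |x| ≤ B, and b halves at each step from C ≥ 2B on.
module Majorant (B : ℚ) (0≤B : 0ℚ ≤ B) (C : ℕ) (2B≤C : B + B ≤ fromℕ C) where
  b u : ℕ → ℚ
  b i = B ^ i * rec! i
  u i = b i + b i

  b≥0 : ∀ i → 0ℚ ≤ b i
  b≥0 i = *≥0 (^≥0 0≤B i) (rec!≥0 i)

  u≥0 : ∀ i → 0ℚ ≤ u i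
  u≥0 i = ℚ.+-mono-≤ (b≥0 i) (b≥0 i)

  halve : ∀ {i} → C ℕ.≤ i → u (suc i) ≤ b i
  halve {i} h = ≤-eq
    (trans (cong (λ z → B * B ^ i * z + B * B ^ i * z) (rec!-suc i))
      (solve 4 (λ B p r f → B :* p :* (r :* f) :+ B :* p :* (r :* f) := (B :+ B) :* r :* (p :* f)) refl
        B (B ^ i) (rec i) (rec! i)))
    (trans (sym (ℚ.*-identityˡ (b i))) (cong (_* b i) (sym (fromℕ-rec i))))
    (*-monoʳ (b≥0 i) (*-monoʳ (rec≥0 i)
      (ℚ.≤-trans 2B≤C (fromℕ-mono (ℕ.≤-trans h (ℕ.n≤1+n i))))))

  gap : ∀ {i} → C ℕ.≤ i → b i ≤ u i - u (suc i)
  gap {i} h = +-slack (b i - u (suc i)) (≤⇒0≤- (halve h))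
    (solve 2 (λ b v → (b :+ b) :- v := b :+ (b :- v)) refl (b i) (u (suc i)))

  decay : ∀ j → fromℕ (suc j) * b (j ℕ.+ C) ≤ b C
  decay zero    = ℚ.≤-reflexive (ℚ.*-identityˡ (b C))
  decay (suc j) = ℚ.≤-trans
    (ℚ.≤-trans (step (b (suc j ℕ.+ C)) (b≥0 (suc j ℕ.+ C)))
      (*-monoˡ (fromℕ≥0 (suc j)) (halve (ℕ.m≤n+m C j))))
    (decay j)
    where
    step : ∀ t → 0ℚ ≤ t → fromℕ (suc (suc j)) * t ≤ fromℕ (suc j) * (t + t)
    step t 0≤t = +-slack (fromℕ j * t) (*≥0 (fromℕ≥0 j) 0≤t)
      (trans (cong (_* (t + t)) (fromℕ-suc j))
        (trans (solve 2 (λ f t → (con 1ℚ :+ f) :* (t :+ t) := (con 1ℚ :+ (con 1ℚ :+ f)) :* t :+ f :* t) refl (fromℕ j) t)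
          (cong (λ z → z * t + fromℕ j * t)
            (sym (trans (fromℕ-suc (suc j)) (cong (λ z → 1ℚ + z) (fromℕ-suc j)))))))

  b-decay : ∀ j → b (j ℕ.+ C) ≤ b C * rec j
  b-decay j = ≤-eq
    (trans (sym (ℚ.*-identityˡ (b (j ℕ.+ C)))) (trans (cong (_* b (j ℕ.+ C)) (sym (fromℕ-rec j)))
      (solve 3 (λ f r b → f :* r :* b := f :* b :* r) refl (fromℕ (suc j)) (rec j) (b (j ℕ.+ C)))))
    refl
    (*-monoʳ (rec≥0 j) (decay j))

  tail : ∀ ε → 0ℚ < ε → ∃ λ N → C ℕ.≤ N × u N + u N ≤ ε
  tail ε 0<ε =
    let δ , 0<δ , 4δ≤ε = shrink 4 0<ε
        D , bC≤D = above (b C)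
        η , 0<η , Dη≤δ = shrink D 0<δ
        j , r≤η = below 0<η
        b≤δ : b (j ℕ.+ C) ≤ δ
        b≤δ = ℚ.≤-trans (b-decay j) (ℚ.≤-trans (*-monoʳ (rec≥0 j) bC≤D)
                (ℚ.≤-trans (*-monoˡ (fromℕ≥0 D) r≤η) Dη≤δ))
    in j ℕ.+ C , ℕ.m≤n+m C j , ℚ.≤-trans
         (≤-eq refl (solve 1 (λ d → con (fromℕ 4) :* d := (d :+ d) :+ (d :+ d)) refl δ)
           (ℚ.+-mono-≤ (ℚ.+-mono-≤ b≤δ b≤δ) (ℚ.+-mono-≤ b≤δ b≤δ)))
         4δ≤ε

  -- for every index k of the approximating sequence of x with |x k| ≤ B
  module _ (x : ℝ) (k : ℕ) (x≤B : ∣ seq x k ∣ ≤ B) where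
    private
      S t : ℕ → ℚ
      S i = seq (seriesᴿ (expTerm x) i) k
      t i = seq (expTerm x i) k

    pow : ∀ i → ∣ seq (x ^ᴿ i) k ∣ ≤ B ^ i
    pow zero    = ℚ.≤-refl
    pow (suc i) = *-bound (seq x k) (seq (x ^ᴿ i) k) x≤B (pow i)

    term : ∀ i → ∣ t i ∣ ≤ b i
    term i = *-bound (seq (x ^ᴿ i) k) (rec! i) (pow i) (ℚ.≤-reflexive (ℚ.0≤p⇒∣p∣≡p (rec!≥0 i)))

    dist : ∀ {N} → C ℕ.≤ N → ∀ {m n} → N ℕ.≤ m → N ℕ.≤ n → S m - S n ≤ u N + u N
    dist C≤N = telescope± S u u≥0
      (λ {i} h → ≤-eq (solve 2 (λ s t → (s :+ t) :- s := t) refl (S i) (t i)) refl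
        (ℚ.≤-trans (p≤∣p∣ (t i)) (ℚ.≤-trans (term i) (gap (ℕ.≤-trans C≤N h)))))
      (λ {i} h → ≤-eq (solve 2 (λ s t → s :- (s :+ t) := :- t) refl (S i) (t i)) refl
        (ℚ.≤-trans (p≤∣p∣ (- t i)) (≤-eq (ℚ.∣-p∣≡∣p∣ (t i)) refl
          (ℚ.≤-trans (term i) (gap (ℕ.≤-trans C≤N h))))))

exp-cauchy : ∀ x → IsCauchyᴿ (seriesᴿ (expTerm x))
exp-cauchy x ε 0<ε =
  let B , K , x≤B = bounded (seq x) (cauchy x)
      C , 2B≤C = above (fromℕ B + fromℕ B)
      open Majorant (fromℕ B) (fromℕ≥0 B) C 2B≤C
      N , C≤N , small = tail ε 0<ε
  in N , λ {m} {n} hm hn ε′ 0<ε′ → K , λ {k} hk →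
       ℚ.≤-trans (ℚ.≤-trans
         (ℚ.+-monoˡ-≤ (- ε) (ℚ.≤-trans (dist x k (x≤B hk) C≤N hm hn) small))
         (ℚ.≤-reflexive (ℚ.+-inverseʳ ε))) (ℚ.<⇒≤ 0<ε′)

exp : ℝ → ℝ
exp x = lim (seriesᴿ (expTerm x)) (exp-cauchy x)

harmonic : ℕ → ℚ
harmonic N = ∑[ i < N ] (+ 1 / suc (toℕ i))

-- Right Riemann sum of ∫₁ⁿ dt/t with mesh h = 1/(M+1), whose i-th summand is
-- h/(1+(i+1)h) = 1/(M+1+i+1).
logApprox : ℕ → ℕ → ℚ
logApprox n M = ∑[ i < (n ∸ 1) ℕ.* suc M ] (+ 1 / suc (suc M ℕ.+ toℕ i))

-- 1 - 1/3 + 1/5 - …, N terms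
leibniz : ℕ → ℚ
leibniz N = ∑[ i < N ] ((- 1ℚ) ^ toℕ i * (+ 1 / suc (2 ℕ.* toℕ i)))

∑-≤ : ∀ n (f g : Fin n → ℚ) → (∀ i → f i ≤ g i) → ∑[ i < n ] f i ≤ ∑[ i < n ] g i
∑-≤ zero    f g h = ℚ.≤-refl
∑-≤ (suc n) f g h = ℚ.+-mono-≤ (h zero) (∑-≤ n _ _ λ i → h (suc i))

∑-const : ∀ n c → ∑[ i < n ] c ≡ fromℕ n * c
∑-const zero    c = sym (ℚ.*-zeroˡ c)
∑-const (suc n) c = trans (cong (λ z → c + z) (∑-const n c)) (trans
  (solve 2 (λ f c → c :+ f :* c := (con 1ℚ :+ f) :* c) refl (fromℕ n) c)
  (cong (_* c) (sym (fromℕ-suc n))))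

∑-append : ∀ (f : ℕ → ℚ) a b →
           ∑[ i < a ℕ.+ b ] f (toℕ i) ≡ ∑[ i < a ] f (toℕ i) + ∑[ i < b ] f (a ℕ.+ toℕ i)
∑-append f zero    b = sym (ℚ.+-identityˡ _)
∑-append f (suc a) b = trans (cong (λ z → f 0 + z) (∑-append (λ i → f (suc i)) a b))
  (sym (ℚ.+-assoc (f 0) _ _))

blockSum : ℕ → ℕ → ℚ
blockSum a L = ∑[ i < L ] rec (a ℕ.+ toℕ i)

harmonic-block : ∀ a L → blockSum a L ≡ harmonic (a ℕ.+ L) - harmonic a
harmonic-block a L = sym (trans (cong (_- harmonic a) (∑-append rec a L))
  (solve 2 (λ h b → (h :+ b) :- h := b) refl (harmonic a) (blockSum a L)))

toℕ< : ∀ {n} (i : Fin n) → toℕ i ℕ.< n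
toℕ< zero    = s≤s z≤n
toℕ< (suc i) = s≤s (toℕ< i)

-- 1/(p+2) ≤ Σ_{i<q+1} 1/((p+1)(q+1)+i+1) ≤ 1/(p+1)
fill : ∀ p q → fromℕ (suc q) * (+ 1 / (suc p ℕ.* suc q)) ≡ rec p
fill p q = trans (cong (fromℕ (suc q) *_) (sym (rec-* p q)))
  (trans (solve 3 (λ f p q → f :* (p :* q) := f :* q :* p) refl (fromℕ (suc q)) (rec p) (rec q))
    (trans (cong (_* rec p) (fromℕ-rec q)) (ℚ.*-identityˡ (rec p))))

block-≤ : ∀ p q → blockSum (suc p ℕ.* suc q) (suc q) ≤ rec p
block-≤ p q = ≤-eq refl (trans (sym (fill p q)) (sym (∑-const (suc q) _)))
  (∑-≤ (suc q) _ _ λ i → rec-anti (ℕ.≤-trans (ℕ.n≤1+n _) (ℕ.m≤m+n (suc p ℕ.* suc q) (toℕ i))))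

block-≥ : ∀ p q → rec (suc p) ≤ blockSum (suc p ℕ.* suc q) (suc q)
block-≥ p q = ≤-eq (trans (sym (fill (suc p) q)) (sym (∑-const (suc q) _))) refl
  (∑-≤ (suc q) _ _ λ i → rec-anti (ℕ.s≤s⁻¹ (ℕ.≤-trans
    (ℕ.≤-reflexive (sym (ℕ.+-suc (suc p ℕ.* suc q) (toℕ i))))
    (ℕ.≤-trans (ℕ.+-monoʳ-≤ (suc p ℕ.* suc q) (toℕ< i))
      (ℕ.≤-reflexive (ℕ.+-comm (suc p ℕ.* suc q) (suc q)))))))

logApprox-harmonic : ∀ n M → logApprox (suc n) M ≡ harmonic (suc n ℕ.* suc M) - harmonic (suc M)
logApprox-harmonic n M = harmonic-block (suc M) (n ℕ.* suc M)

-- passing from mesh 1/(M+1) to 1/(M+2)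
logApprox-step : ∀ n M → logApprox (suc n) (suc M) - logApprox (suc n) M
                         ≡ blockSum (suc M ℕ.* suc n) (suc n) - rec (suc M)
logApprox-step n M = trans
  (cong₂ _-_
    (trans (logApprox-harmonic n (suc M))
      (cong₂ (λ k l → harmonic k - l)
        (trans (ℕ.*-comm (suc n) (suc (suc M))) (ℕ.+-comm (suc n) (suc M ℕ.* suc n)))
        (trans (cong harmonic (ℕ.+-comm 1 (suc M))) (trans (∑-append rec (suc M) 1)
          (cong (λ z → harmonic (suc M) + z) (trans (ℚ.+-identityʳ _) (cong rec (ℕ.+-identityʳ (suc M)))))))))
    (trans (logApprox-harmonic n M) (cong (λ k → harmonic k - harmonic (suc M)) (ℕ.*-comm (suc n) (suc M)))))
  (trans
    (solve 4 (λ x y z w → (x :- (y :+ z)) :- (w :- y) := (x :- w) :- z) refl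
      (harmonic (suc M ℕ.* suc n ℕ.+ suc n)) (harmonic (suc M)) (rec (suc M)) (harmonic (suc M ℕ.* suc n)))
    (cong (_- rec (suc M)) (sym (harmonic-block (suc M ℕ.* suc n) (suc n)))))

log-cauchy : ∀ n → IsCauchy (logApprox n)
log-cauchy zero ε 0<ε = 0 , λ _ _ → ℚ.<⇒≤ 0<ε
log-cauchy (suc n) = rec-cauchy (logApprox (suc n)) λ N → telescope± (logApprox (suc n)) rec rec≥0
  (λ {i} _ → ≤-eq (logApprox-step n i) refl (ℚ.+-monoˡ-≤ (- rec (suc i)) (block-≤ i n)))
  (λ {i} _ → ≤-eq
    (trans (solve 2 (λ x y → x :- y := :- (y :- x)) refl (logApprox (suc n) i) (logApprox (suc n) (suc i)))
           (cong -_ (logApprox-step n i)))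
    refl
    (ℚ.≤-trans
      (≤-eq (solve 2 (λ x y → :- (x :- y) := y :- x) refl (blockSum (suc i ℕ.* suc n) (suc n)) (rec (suc i)))
            (sym (ℚ.+-inverseʳ (rec (suc i))))
            (ℚ.+-monoʳ-≤ (rec (suc i)) (ℚ.neg-antimono-≤ (block-≥ i n))))
      (≤⇒0≤- (rec-anti (ℕ.n≤1+n i)))))

-- The natural logarithm of a positive integer; the value at 0 is meaningless.
log : ℕ → ℝ
log n = mkℝ (logApprox n) (log-cauchy n)

-- The N-th entry is H_{N+1} - log (N+1).
γ-approx : ℕ → ℝ
γ-approx N = fromℚ (harmonic (suc N)) -ᴿ log (suc N)

γ-step : ∀ N M → seq (γ-approx (suc N)) M - seq (γ-approx N) M
                 ≡ rec (suc N) - blockSum (suc N ℕ.* suc M) (suc M)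
γ-step N M = trans
  (cong₂ _-_
    (cong₂ _-_
      (trans (cong harmonic (ℕ.+-comm 1 (suc N))) (trans (∑-append rec (suc N) 1)
        (cong (λ z → harmonic (suc N) + z) (trans (ℚ.+-identityʳ _) (cong rec (ℕ.+-identityʳ (suc N)))))))
      (trans (logApprox-harmonic (suc N) M)
        (cong (λ k → harmonic k - harmonic (suc M)) (ℕ.+-comm (suc M) (suc N ℕ.* suc M)))))
    (cong (λ z → harmonic (suc N) - z) (logApprox-harmonic N M)))
  (trans
    (solve 5 (λ h r x m y → ((h :+ r) :- (x :- m)) :- (h :- (y :- m)) := r :- (x :- y)) refl
      (harmonic (suc N)) (rec (suc N)) (harmonic (suc N ℕ.* suc M ℕ.+ suc M)) (harmonic (suc M))
      (harmonic (suc N ℕ.* suc M)))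
    (cong (λ z → rec (suc N) - z) (sym (harmonic-block (suc N ℕ.* suc M) (suc M)))))

γ-cauchy : IsCauchyᴿ γ-approx
γ-cauchy ε 0<ε =
  let δ , 0<δ , 2δ≤ε = shrink 2 0<ε
      K , r = below 0<δ
  in K , λ {m} {n} hm hn ε′ 0<ε′ → 0 , λ {k} _ →
    ℚ.≤-trans (ℚ.≤-trans
      (ℚ.+-monoˡ-≤ (- ε) (ℚ.≤-trans
        (telescope± (λ N → seq (γ-approx N) k) rec rec≥0
          (λ {i} _ → ≤-eq (γ-step i k) refl (ℚ.≤-trans
            (≤-eq refl (sym (ℚ.+-inverseʳ (rec (suc i))))
              (ℚ.+-monoʳ-≤ (rec (suc i)) (ℚ.neg-antimono-≤ (block-≥ i k))))
            (≤⇒0≤- (rec-anti (ℕ.n≤1+n i)))))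
          (λ {i} _ → ≤-eq
            (trans (solve 2 (λ x y → x :- y := :- (y :- x)) refl (seq (γ-approx i) k) (seq (γ-approx (suc i)) k))
              (trans (cong -_ (γ-step i k))
                (solve 2 (λ x y → :- (x :- y) := y :- x) refl (rec (suc i)) (blockSum (suc i ℕ.* suc k) (suc k)))))
            refl
            (ℚ.+-monoˡ-≤ (- rec (suc i)) (block-≤ i k)))
          hm hn)
        (ℚ.≤-trans (≤-eq refl (sym (2* δ)) (ℚ.+-mono-≤ r r)) 2δ≤ε)))
      (ℚ.≤-reflexive (ℚ.+-inverseʳ ε))) (ℚ.<⇒≤ 0<ε′)

γ : ℝ
γ = lim γ-approx γ-cauchy

alternating : (ℕ → ℚ) → ℕ → ℚ
alternating f N = ∑[ i < N ] ((- 1ℚ) ^ toℕ i * f (toℕ i))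

∑-neg : ∀ n (g : Fin n → ℚ) → - (∑[ i < n ] g i) ≡ ∑[ i < n ] (- g i)
∑-neg zero    g = refl
∑-neg (suc n) g = trans (ℚ.neg-distrib-+ (g zero) _) (cong (λ z → - g zero + z) (∑-neg n _))

∑-cong : ∀ n {f g : Fin n → ℚ} → (∀ i → f i ≡ g i) → ∑[ i < n ] f i ≡ ∑[ i < n ] g i
∑-cong zero    h = refl
∑-cong (suc n) h = cong₂ _+_ (h zero) (∑-cong n λ i → h (suc i))

alternating-suc : ∀ f n → alternating f (suc n) ≡ f 0 - alternating (λ i → f (suc i)) n
alternating-suc f n = cong₂ _+_ (ℚ.*-identityˡ (f 0)) (sym (trans
  (∑-neg n λ i → (- 1ℚ) ^ toℕ i * f (suc (toℕ i)))
  (∑-cong n λ i → solve 2 (λ p x → :- (p :* x) := (con (- 1ℚ) :* p) :* x) refl ((- 1ℚ) ^ toℕ i) (f (suc (toℕ i))))))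

record Decreasing (f : ℕ → ℚ) : Set where
  constructor decreasing
  field
    nonneg : ∀ i → 0ℚ ≤ f i
    anti   : ∀ i → f (suc i) ≤ f i

open Decreasing

shift : ∀ {f} → Decreasing f → Decreasing (λ i → f (suc i))
shift d = decreasing (λ i → nonneg d (suc i)) (λ i → anti d (suc i))

alternating-range : ∀ f → Decreasing f → ∀ n → 0ℚ ≤ alternating f n × alternating f n ≤ f 0
alternating-range f d zero    = ℚ.≤-refl , nonneg d 0
alternating-range f d (suc n) with alternating-range (λ i → f (suc i)) (shift d) n
... | lo , hi =
    ≤-eq refl (alternating-suc f n) (≤⇒0≤- (ℚ.≤-trans hi (anti d 0)))
  , ≤-eq (alternating-suc f n) refl (+-slack (alternating (λ i → f (suc i)) n) lo
      (solve 2 (λ a b → a := (a :- b) :+ b) refl (f 0) (alternating (λ i → f (suc i)) n)))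

alternating-near : ∀ f → Decreasing f → ∀ N j →
  alternating f (N ℕ.+ j) - alternating f N ≤ f N × alternating f N - alternating f (N ℕ.+ j) ≤ f N
alternating-near f d zero j with alternating-range f d j
... | lo , hi =
    ≤-eq (solve 1 (λ a → a :- con 0ℚ := a) refl (alternating f j)) refl hi
  , ℚ.≤-trans (≤-eq (solve 1 (λ a → con 0ℚ :- a := :- a) refl (alternating f j)) refl (ℚ.neg-antimono-≤ lo)) (nonneg d 0)
alternating-near f d (suc N) j with alternating-near (λ i → f (suc i)) (shift d) N j
... | p , q =
    ≤-eq (trans (cong₂ _-_ (alternating-suc f (N ℕ.+ j)) (alternating-suc f N)) (swap x y)) refl q
  , ≤-eq (trans (cong₂ _-_ (alternating-suc f N) (alternating-suc f (N ℕ.+ j))) (swap y x)) refl p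
  where
  x = alternating (λ i → f (suc i)) (N ℕ.+ j)
  y = alternating (λ i → f (suc i)) N
  swap : ∀ x y → (f 0 - x) - (f 0 - y) ≡ y - x
  swap x y = solve 3 (λ f x y → (f :- x) :- (f :- y) := y :- x) refl (f 0) x y

leibniz-cauchy : IsCauchy leibniz
leibniz-cauchy = rec-cauchy leibniz λ N hm hn → ℚ.≤-trans
  (near leibniz (λ j → proj₁ (alternating-near f d N j)) (λ j → proj₂ (alternating-near f d N j)) hm hn)
  (ℚ.+-mono-≤ (rec-anti (ℕ.m≤m+n N (N ℕ.+ 0))) (rec-anti (ℕ.m≤m+n N (N ℕ.+ 0))))
  where
  f : ℕ → ℚ
  f i = rec (2 ℕ.* i)
  d : Decreasing f
  d = decreasing (λ i → rec≥0 (2 ℕ.* i)) (λ i → rec-anti (ℕ.*-monoʳ-≤ 2 (ℕ.n≤1+n i)))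

-- 4 arctan 1
π : ℝ
π = fromℚ (fromℕ 4) *ᴿ mkℝ leibniz leibniz-cauchy

-- Permutations of {1,…,n} are written on Fin n = {0,…,n-1}, in one-line
-- notation; an injective self-map of a finite set is a permutation.
IsPermutation : ∀ {n} → Vec (Fin n) n → Set
IsPermutation π = Injective _≡_ _≡_ (lookup π)

isPermutation? : ∀ {n} (π : Vec (Fin n) n) → Dec (IsPermutation π)
isPermutation? π = map′ (λ inj {i} {j} → inj i j) (λ inj i j → inj)
  (all? λ i → all? λ j → (lookup π i Fin.≟ lookup π j) →-dec (i Fin.≟ j))

vectors : ∀ {A : Set} n → List A → List (Vec A n)
vectors zero    xs = [] ∷ []
vectors (suc n) xs = cartesianProductWith _∷_ xs (vectors n xs)

permutations : ∀ n → List (Vec (Fin n) n)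
permutations n = filter isPermutation? (vectors n (List.allFin n))

tuples : ∀ k n → List (Vec (Vec (Fin n) n) k)
tuples k n = vectors k (permutations n)

IsRecord : ∀ {n} → Fin n → Vec (Fin n) n → Set
IsRecord α π = ∀ α′ → α′ Fin.< α → lookup π α Fin.< lookup π α′

isRecord? : ∀ {n} (α : Fin n) (π : Vec (Fin n) n) → Dec (IsRecord α π)
isRecord? α π = all? λ α′ → (α′ Fin.<? α) →-dec (lookup π α Fin.<? lookup π α′)

recordCount : ∀ {k n} → Vec (Vec (Fin n) n) k → Fin n → Fin (suc k)
recordCount πs α = fromℕ< (s≤s (count≤n (isRecord? α) πs))

Code : ℕ → Set
Code k = Vec (Fin 2) (suc k)

infix 9 _′

_′ : ∀ {k} → Code k → Code k
C ′ = Vec.map opposite C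

val : ∀ {k} → Code k → Fin (suc k) → ℚ
val C β = fromℕ (toℕ (lookup C β))

InOptimizationSet : ∀ {k n} → Code k → Vec (Vec (Fin n) n) k → Fin n → Set
InOptimizationSet C πs α = lookup C (recordCount πs α) ≡ suc zero

inOptimizationSet? : ∀ {k n} (C : Code k) (πs : Vec (Vec (Fin n) n) k) (α : Fin n) →
                     Dec (InOptimizationSet C πs α)
inOptimizationSet? C πs α = lookup C (recordCount πs α) Fin.≟ suc zero

weight : ∀ {k n} → Code k → Vec (Vec (Fin n) n) k → ℕ
weight {n = n} C πs = Vec.count (inOptimizationSet? C πs) (Vec.allFin n)

O : ∀ {k} → Code k → ℕ → ℕ → ℕ
O {k} C n m = length (filter (λ πs → weight C πs ℕ.≟ m) (tuples k n))

-- Only rational vectors X occur, namely codes.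
F : ∀ {k} (j : ℕ) .{{_ : ℕ.NonZero (j ∸ 1)}} → (Fin (suc k) → ℚ) → ℚ
F {k} j X = ∑[ β ≤ k ] (fromℕ (k choose toℕ β) * X β * (+ 1 / (j ∸ 1)) ^ toℕ β)

𝐇 : ∀ {k} → ℕ → (Fin (suc k) → ℚ) → ℚ
𝐇 {k} n X = ∑[ β ≤ k ] (X β * fromℕ (k choose toℕ β) * ∑[ i < n ∸ 1 ] ((+ 1 / suc (toℕ i)) ^ toℕ β))

-- The argument is t = m + c_k - 1, so that m = t + 1 - c_k; no truncation
-- occurs, because c_k ≤ 1.
Omax : ∀ {k} → Code k → ℕ → ℕ → ℚ
Omax {k} C n t =
  if does ((1 ℕ.≤? m) ×-dec (m ℕ.≤? n))
  then (+ (((n ∸ 1) !) ℕ.^ k) / (m ∸ 1) !) {{(m ∸ 1) !≢0}}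
         * 𝐇 n (val C) ^ (m ∸ 1)
         * ∏[ i < n ∸ m ] F (2 ℕ.+ toℕ i) (val (C ′))
  else 0ℚ
  where
  m : ℕ
  m = suc t ∸ toℕ (last C)

-- λ, with λ′ the same quantity for C ′; matching on c₀ ∷ c₁ ∷ cs needs k ≥ 1.
Λ : ∀ {k} → 1 ℕ.≤ k → Code k → ℕ → ℝ
Λ {k@(suc k₁)} (s≤s _) (c₀ ∷ c₁ ∷ cs) n =
  fromℚ (fromℕ (toℕ c₀ ℕ.* (n ∸ 1)))
  +ᴿ fromℚ (fromℕ (toℕ c₁ ℕ.* k)) *ᴿ (log (n ∸ 1) +ᴿ γ)
  +ᴿ fromℚ (+ 1 / 6) *ᴿ π ^ᴿ 2
       *ᴿ fromℚ (∑[ i < k₁ ] (fromℕ (toℕ (lookup cs i)) * fromℕ (k choose (2 ℕ.+ toℕ i))))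

-- Unsigned, of the first kind.
stirling : ℕ → ℕ → ℕ
stirling zero    zero    = 1
stirling zero    (suc m) = 0
stirling (suc n) zero    = 0
stirling (suc n) (suc m) = n ℕ.* stirling n (suc m) ℕ.+ stirling n m

-- The closed formula is meant for m ≤ n only.
stirlingMax : ℕ → ℕ → ℚ
stirlingMax n zero    = 0ℚ
stirlingMax n (suc m) = (+ ((n ∸ 1) !) / m !) {{m !≢0}} * harmonic (n ∸ 1) ^ m

∑-nonZero : ∀ {n} (f : Fin n → ℕ) i → 1 ℕ.≤ f i → ℚ.NonZero (∑[ m < n ] fromℕ (f m))
∑-nonZero f i h = ℚ.>-nonZero (∑>0 f i h)
  where
  ∑>0 : ∀ {n} (f : Fin n → ℕ) i → 1 ℕ.≤ f i → 0ℚ < ∑[ m < n ] fromℕ (f m)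
  ∑≥0 : ∀ {n} (f : Fin n → ℕ) → 0ℚ ≤ ∑[ m < n ] fromℕ (f m)
  ∑≥0 {zero}  f = ℚ.≤-refl
  ∑≥0 {suc n} f = ℚ.+-mono-≤ (fromℕ≥0 (f zero)) (∑≥0 λ i → f (suc i))
  ∑>0 f zero h = ℚ.+-mono-<-≤ (ℚ.<-≤-trans (rec>0 0) (fromℕ-mono h)) (∑≥0 λ i → f (suc i))
  ∑>0 f (suc i) h = ℚ.+-mono-≤-< (fromℕ≥0 (f zero)) (∑>0 (λ i → f (suc i)) i h)

∈-vectors : ∀ {A : Set} {n} (xs : List A) (v : Vec A n) → (∀ i → lookup v i ∈ xs) → v ∈ vectors n xs
∈-vectors xs []      h = here refl
∈-vectors xs (x ∷ v) h = ∈-cartesianProductWith⁺ _∷_ (h zero) (∈-vectors xs v λ i → h (suc i))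

identity∈ : ∀ k n → Vec.replicate k (Vec.allFin n) ∈ tuples k n
identity∈ k n = ∈-vectors (permutations n) _ λ i →
  subst (_∈ permutations n) (sym (Vec.lookup-replicate i (Vec.allFin n)))
    (∈-filter⁺ isPermutation? (∈-vectors (List.allFin n) _ λ i → ∈-allFin _)
      λ {i} {j} e → trans (sym (Vec.lookup-allFin i)) (trans e (Vec.lookup-allFin j)))

O-total-nonZero : ∀ {k} (C : Code k) n → ℚ.NonZero (∑[ m ≤ n ] fromℕ (O C n (toℕ m)))
O-total-nonZero {k} C n = ∑-nonZero (λ m → O C n (toℕ m)) m₀
  (subst (λ m → 1 ℕ.≤ O C n m) (sym (toℕ-fromℕ< w<))
    (∈-length (∈-filter⁺ (λ πs → weight C πs ℕ.≟ w) (identity∈ k n) refl)))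
  where
  w = weight C (Vec.replicate k (Vec.allFin n))
  w< : w ℕ.< suc n
  w< = s≤s (count≤n (inOptimizationSet? C (Vec.replicate k (Vec.allFin n))) (Vec.allFin n))
  m₀ = fromℕ< w<

stirling-total-nonZero : ∀ n → ℚ.NonZero (∑[ m ≤ n ] fromℕ (stirling n (toℕ m)))
stirling-total-nonZero n = ∑-nonZero (λ m → stirling n (toℕ m)) (Fin.fromℕ n)
  (subst (λ m → 1 ℕ.≤ stirling n m) (sym (toℕ-fromℕ n)) (diagonal n))
  where
  diagonal : ∀ n → 1 ℕ.≤ stirling n n
  diagonal zero    = s≤s z≤n
  diagonal (suc n) = ℕ.≤-trans (diagonal n) (ℕ.m≤n+m _ (n ℕ.* stirling n (suc n)))

{-# OPTIONS --safe #-}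

-- Removing the last values of the k permutations shows that Σ_m O(n,m) x^m is
-- the product over j ≤ n of (number of hits) x + (number of misses), with
-- factors (j-1)^k (F_j(C) x + F_j(C′)). As F_j(C′) decreases in j, its
-- coefficients are at most h^s/s! times a product of the first F_j(C′), where
-- h = H_n(C) = Σ F_j(C); this is O ≤ O_max, and (i) follows by complementing C.
--
-- Since ∏_{j ≤ r+1} F_j(C′) ≤ (r+1)^k, the ratio in (ii) is at most exp h. If
-- c₁ = 0, then h ≤ λ by Σ 1/i² ≤ π²/6. If c₁ = 1, then h may exceed λ, because
-- H_{n-1} > log(n-1) + γ; but all terms except the first carry the smaller
-- factor (n-1)^k, and exp γ ≥ exp(H_p)/(p + 4/7) for p = n - 1 ≥ 2 makes up for
-- the rest (for n = 2 the ratio is 1).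
--
-- Logarithms and γ enter only through the Riemann sums that approximate them:
-- exp of 1/(a+1) + … + 1/(a+L) lies between (a+L+1)/(a+1) and (a+L)/a. The bound
-- for Σ 1/i² comes from squaring the Leibniz series: the off-diagonal terms are
-- O(log m / m). Finally exp(H_q)/(q + 1/2) decreases to exp γ, and q = 64 is
-- enough for 1.7811.

module Submission where

open import Data.Bool.Base using (Bool; true; false; if_then_else_)
open import Data.Fin.Base as Fin using (Fin; zero; suc; toℕ; inject₁; punchIn; punchOut; opposite)
open import Data.Fin.Properties as Fin using (toℕ-fromℕ<)
open import Data.Fin.Relation.Unary.Top using (view; ‵fromℕ; ‵inject₁)
import Data.Integer.Base as ℤ
import Data.Integer.Properties as ℤ
open import Data.List.Base as List using (List; []; _∷_; _++_; length; filter; cartesianProductWith)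
open import Data.List.Membership.Propositional using (_∈_)
open import Data.List.Membership.Propositional.Properties
  using (∈-filter⁺; ∈-filter⁻; ∈-cartesianProductWith⁺; ∈-cartesianProductWith⁻; ∈-allFin)
open import Data.List.Membership.Propositional.Properties.WithK using (unique∧set⇒bag)
open import Data.List.Relation.Binary.BagAndSetEquality using (∼bag⇒↭)
open import Data.List.Relation.Binary.Permutation.Propositional as ↭ using (_↭_)
open import Data.List.Relation.Unary.All using ([])
open import Data.List.Relation.Unary.AllPairs using ([]; _∷_)
open import Data.List.Relation.Unary.Any using (here; there)
open import Data.List.Relation.Unary.Unique.Propositional using (Unique)
open import Data.List.Relation.Unary.Unique.Propositional.Properties as Unique using ()
open import Data.Nat.Base as ℕ using (ℕ; zero; suc; _∸_; _!; z≤n; s≤s; s≤s⁻¹)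
open import Data.Nat.Combinatorics
  using (nCk+nC[k+1]≡[n+1]C[k+1]; k>n⇒nCk≡0; nC1≡n) renaming (_C_ to _choose_)
open import Data.Nat.Properties as ℕ using (_!≢0)
open import Data.Product using (∃; ∃₂; _×_; _,_; proj₁; proj₂)
open import Data.Rational.Base
open import Data.Rational.Properties as ℚ using ()
open import Data.Rational.Solver using (module +-*-Solver)
open import Data.Sum.Base using (_⊎_; inj₁; inj₂)
open import Data.Unit.Base using (tt)
open import Data.Vec.Base as Vec using (Vec; []; _∷_; _∷ʳ_; lookup; initLast; zipWith; last)
open import Data.Vec.Properties as Vec using ()
open import Function.Base using (_∘_; id)
open import Function.Bundles using (_⇔_; mk⇔)
open import Relation.Binary.PropositionalEquality
  using (_≡_; _≢_; refl; sym; trans; cong; cong₂; subst; subst₂; module ≡-Reasoning)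
open import Relation.Nullary using (does; contradiction)
open import Relation.Nullary.Decidable using (does-⇔; dec-true; dec-false; _×-dec_; toWitness)
open import Relation.Unary using (Decidable)
open import Algebra.Properties.Monoid.Sum ℕ.+-0-monoid as ℕ∑ using ()
open +-*-Solver using (solve; _:=_; _:+_; _:*_; _:-_; :-_; con)
open import Defs

-- A real is a Cauchy sequence of rationals, and the k-th entry of `exp x` is the Taylor polynomial
-- of length k at some entry of x. Each real inequality therefore becomes one between Taylor
-- polynomials `E N` at rational points, where the length on the larger side may grow. The
-- functional equation of exp survives only as two inequalities, E N (x + y) ≤ E N x · E N y and E M
-- x · E N y ≤ E (M + N) (x + y), both for non-negative arguments. Subtraction in an exponent is
-- thus out of reach: H_p - log p and the approximants of γ are always used as some y ≥ 0 with y +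
-- log p = H_p, and their non-negativity has to be proved first. Since the lengths are not bounded
-- in advance, errors are kept as factors 1 - δ that do not depend on them; this is what the
-- relation `⊑` records, and such errors multiply along with the exponentials.

-- Finite sums, natural numbers as rationals, monotonicity

∑-snoc : ∀ (f : ℕ → ℚ) n → ∑[ i < suc n ] f (toℕ i) ≡ ∑[ i < n ] f (toℕ i) + f n
∑-snoc f zero    = ℚ.+-comm (f 0) 0ℚ
∑-snoc f (suc n) = trans (cong (f 0 +_) (∑-snoc (λ i → f (suc i)) n)) (sym (ℚ.+-assoc (f 0) _ _))

∑-+ : ∀ n (f g : Fin n → ℚ) → ∑[ i < n ] (f i + g i) ≡ ∑[ i < n ] f i + ∑[ i < n ] g i
∑-+ zero    f g = refl
∑-+ (suc n) f g = trans (cong (f zero + g zero +_) (∑-+ n (λ i → f (suc i)) (λ i → g (suc i))))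
  (solve 4 (λ a b c d → (a :+ b) :+ (c :+ d) := (a :+ c) :+ (b :+ d)) refl (f zero) (g zero) _ _)

∑-*ˡ : ∀ n c (f : Fin n → ℚ) → ∑[ i < n ] (c * f i) ≡ c * ∑[ i < n ] f i
∑-*ˡ zero    c f = sym (ℚ.*-zeroʳ c)
∑-*ˡ (suc n) c f = trans (cong (c * f zero +_) (∑-*ˡ n c (λ i → f (suc i)))) (sym (ℚ.*-distribˡ-+ c _ _))

∑≥0 : ∀ n (f : Fin n → ℚ) → (∀ i → 0ℚ ≤ f i) → 0ℚ ≤ ∑[ i < n ] f i
∑≥0 zero    f h = ℚ.≤-refl
∑≥0 (suc n) f h = ℚ.+-mono-≤ (h zero) (∑≥0 n (λ i → f (suc i)) λ i → h (suc i))

fromℕ-+ : ∀ a b → fromℕ (a ℕ.+ b) ≡ fromℕ a + fromℕ b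
fromℕ-+ zero    b = sym (ℚ.+-identityˡ (fromℕ b))
fromℕ-+ (suc a) b = trans (fromℕ-suc (a ℕ.+ b)) (trans (cong (1ℚ +_) (fromℕ-+ a b))
  (trans (sym (ℚ.+-assoc 1ℚ (fromℕ a) (fromℕ b))) (cong (_+ fromℕ b) (sym (fromℕ-suc a)))))

fromℕ-* : ∀ a b → fromℕ (a ℕ.* b) ≡ fromℕ a * fromℕ b
fromℕ-* zero    b = sym (ℚ.*-zeroˡ (fromℕ b))
fromℕ-* (suc a) b = trans (fromℕ-+ b (a ℕ.* b)) (trans (cong (fromℕ b +_) (fromℕ-* a b))
  (trans (solve 2 (λ x y → y :+ x :* y := (con 1ℚ :+ x) :* y) refl (fromℕ a) (fromℕ b))
    (cong (_* fromℕ b) (sym (fromℕ-suc a)))))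

fromℕ-^ : ∀ a k → fromℕ (a ℕ.^ k) ≡ fromℕ a ^ k
fromℕ-^ a zero    = refl
fromℕ-^ a (suc k) = trans (fromℕ-* a (a ℕ.^ k)) (cong (fromℕ a *_) (fromℕ-^ a k))

/≡*rec : ∀ a n → (ℤ.+ a) / suc n ≡ fromℕ a * rec n
/≡*rec a n = sym (trans (/-* (ℤ.+ a) (ℤ.+ 1) 0 n) (/-≡ (ℤ.+ a ℤ.* ℤ.+ 1) (ℤ.+ a) (n ℕ.+ 0) n
  (cong₂ ℤ._*_ (ℤ.*-identityʳ (ℤ.+ a)) (cong (λ z → ℤ.+ suc z) (sym (ℕ.+-identityʳ n))))))

1^≡1 : ∀ k → 1ℚ ^ k ≡ 1ℚ
1^≡1 zero    = refl
1^≡1 (suc k) = trans (ℚ.*-identityˡ (1ℚ ^ k)) (1^≡1 k)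

0≤1 : 0ℚ ≤ 1ℚ
0≤1 = fromℕ≥0 1

+≥0 : ∀ {p q} → 0ℚ ≤ p → 0ℚ ≤ q → 0ℚ ≤ p + q
+≥0 = ℚ.+-mono-≤

*-mono : ∀ {p q r s} → 0ℚ ≤ r → 0ℚ ≤ q → p ≤ q → r ≤ s → p * r ≤ q * s
*-mono 0≤r 0≤q p≤q r≤s = ℚ.≤-trans (*-monoʳ 0≤r p≤q) (*-monoˡ 0≤q r≤s)

^-mono : ∀ {p q} → 0ℚ ≤ p → p ≤ q → ∀ n → p ^ n ≤ q ^ n
^-mono 0≤p p≤q zero    = ℚ.≤-refl
^-mono 0≤p p≤q (suc n) = *-mono (^≥0 0≤p n) (ℚ.≤-trans 0≤p p≤q) p≤q (^-mono 0≤p p≤q n)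

1≤^ : ∀ {p} → 1ℚ ≤ p → ∀ n → 1ℚ ≤ p ^ n
1≤^ 1≤p zero    = ℚ.≤-refl
1≤^ 1≤p (suc n) = *-mono 0≤1 (ℚ.≤-trans 0≤1 1≤p) 1≤p (1≤^ 1≤p n)

*-^ : ∀ p q n → (p * q) ^ n ≡ p ^ n * q ^ n
*-^ p q zero    = refl
*-^ p q (suc n) = trans (cong (p * q *_) (*-^ p q n))
  (solve 4 (λ p q x y → (p :* q) :* (x :* y) := (p :* x) :* (q :* y)) refl p q (p ^ n) (q ^ n))

*-cancelˡ : ∀ {r p q} → 0ℚ < r → r * p ≤ r * q → p ≤ q
*-cancelˡ {r} 0<r = ℚ.*-cancelˡ-≤-pos r {{positive 0<r}}

fromℕ>0 : ∀ n → 0ℚ < fromℕ (suc n)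
fromℕ>0 n = ℚ.<-≤-trans (rec>0 0) (fromℕ-mono {1} {suc n} (s≤s z≤n))

-- Taylor polynomials of exp

t : ℕ → ℚ → ℚ
t i x = x ^ i * rec! i

-- `N` counts terms, so `E N` has degree below `N` and `E 0` vanishes. With this convention lengths
-- simply add when Taylor polynomials are multiplied.
E : ℕ → ℚ → ℚ
E zero    x = 0ℚ
E (suc N) x = E N x + t N x

t≥0 : ∀ {x} → 0ℚ ≤ x → ∀ i → 0ℚ ≤ t i x
t≥0 0≤x i = *≥0 (^≥0 0≤x i) (rec!≥0 i)

t-suc : ∀ i x → fromℕ (suc i) * t (suc i) x ≡ x * t i x
t-suc i x = begin
  fromℕ (suc i) * (x * x ^ i * rec! (suc i))    ≡⟨ cong (λ z → fromℕ (suc i) * (x * x ^ i * z)) (rec!-suc i) ⟩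
  fromℕ (suc i) * (x * x ^ i * (rec i * rec! i)) ≡⟨ solve 5 (λ n x p r f → n :* (x :* p :* (r :* f)) := (n :* r) :* (x :* (p :* f))) refl (fromℕ (suc i)) x (x ^ i) (rec i) (rec! i) ⟩
  fromℕ (suc i) * rec i * (x * t i x)            ≡⟨ cong (_* (x * t i x)) (fromℕ-rec i) ⟩
  1ℚ * (x * t i x)                               ≡⟨ ℚ.*-identityˡ _ ⟩
  x * t i x                                      ∎
  where open ≡-Reasoning

t-suc′ : ∀ i x → t (suc i) x ≡ x * t i x * rec i
t-suc′ i x = begin
  t (suc i) x                           ≡⟨ ℚ.*-identityˡ _ ⟨
  1ℚ * t (suc i) x                      ≡⟨ cong (_* t (suc i) x) (fromℕ-rec i) ⟨
  fromℕ (suc i) * rec i * t (suc i) x   ≡⟨ solve 3 (λ n r t → n :* r :* t := n :* t :* r) refl (fromℕ (suc i)) (rec i) (t (suc i) x) ⟩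
  fromℕ (suc i) * t (suc i) x * rec i   ≡⟨ cong (_* rec i) (t-suc i x) ⟩
  x * t i x * rec i                     ∎
  where open ≡-Reasoning

E-∑ : ∀ N x → E N x ≡ ∑[ i < N ] t (toℕ i) x
E-∑ zero    x = refl
E-∑ (suc N) x = trans (cong (_+ t N x) (E-∑ N x)) (sym (∑-snoc (λ i → t i x) N))

E≥0 : ∀ {x} → 0ℚ ≤ x → ∀ N → 0ℚ ≤ E N x
E≥0 0≤x zero    = ℚ.≤-refl
E≥0 0≤x (suc N) = +≥0 (E≥0 0≤x N) (t≥0 0≤x N)

E-monoᴺ+ : ∀ {x} → 0ℚ ≤ x → ∀ M j → E M x ≤ E (j ℕ.+ M) x
E-monoᴺ+ 0≤x M zero    = ℚ.≤-refl
E-monoᴺ+ 0≤x M (suc j) = ℚ.≤-trans (E-monoᴺ+ 0≤x M j) (+-slack _ (t≥0 0≤x (j ℕ.+ M)) refl)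

E-monoᴺ : ∀ {x M N} → 0ℚ ≤ x → M ℕ.≤ N → E M x ≤ E N x
E-monoᴺ {x} {M} {N} 0≤x M≤N = subst (λ z → E M x ≤ E z x) (ℕ.m∸n+n≡m M≤N) (E-monoᴺ+ 0≤x M (N ∸ M))

E-mono : ∀ {x y} → 0ℚ ≤ x → x ≤ y → ∀ N → E N x ≤ E N y
E-mono 0≤x x≤y zero    = ℚ.≤-refl
E-mono 0≤x x≤y (suc N) = ℚ.+-mono-≤ (E-mono 0≤x x≤y N) (*-monoʳ (rec!≥0 N) (^-mono 0≤x x≤y N))

E2 : ∀ x → E 2 x ≡ 1ℚ + x
E2 x = solve 1 (λ x → (con 0ℚ :+ con 1ℚ :* con 1ℚ) :+ x :* con 1ℚ :* con 1ℚ := con 1ℚ :+ x) refl x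

E3 : ∀ x → E 3 x ≡ 1ℚ + x + x * x * ½
E3 x = solve 1 (λ x → ((con 0ℚ :+ con 1ℚ :* con 1ℚ) :+ x :* con 1ℚ :* con 1ℚ) :+ x :* (x :* con 1ℚ) :* con ½ := con 1ℚ :+ x :+ x :* x :* con ½) refl x

1≤E : ∀ {x} → 0ℚ ≤ x → ∀ N → 1ℚ ≤ E (suc N) x
1≤E {x} 0≤x N = E-monoᴺ {x} {1} {suc N} 0≤x (s≤s z≤n)

-- The N-th homogeneous part of exp x · exp y.
conv : ℕ → ℚ → ℚ → ℚ
conv N x y = ∑[ i < suc N ] (t (toℕ i) x * t (N ∸ toℕ i) y)

∑-congℕ : ∀ n {f g : ℕ → ℚ} → (∀ {i} → i ℕ.< n → f i ≡ g i) → ∑[ i < n ] f (toℕ i) ≡ ∑[ i < n ] g (toℕ i)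
∑-congℕ n h = ∑-cong n λ i → h (toℕ< i)

∑-monoℕ : ∀ n {f g : ℕ → ℚ} → (∀ {i} → i ℕ.< n → f i ≤ g i) → ∑[ i < n ] f (toℕ i) ≤ ∑[ i < n ] g (toℕ i)
∑-monoℕ n h = ∑-≤ n _ _ λ i → h (toℕ< i)

-- On the i-th summand the factor N + 1 is split as i + (N + 1 - i), and `t-suc` lowers one of the
-- two exponents in each part. The result is the recursion that determines `t N (x + y)`, so the
-- binomial theorem follows without binomial coefficients.
conv-suc : ∀ N x y → fromℕ (suc N) * conv (suc N) x y ≡ (x + y) * conv N x y
conv-suc N x y = begin
  n * conv (suc N) x y
    ≡⟨ ∑-*ˡ (suc (suc N)) n (λ i → T (toℕ i)) ⟨
  ∑[ i < suc (suc N) ] (n * T (toℕ i))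
    ≡⟨ ∑-congℕ (suc (suc N)) {λ i → n * T i} {λ i → fromℕ i * T i + fromℕ (suc N ∸ i) * T i} (λ {i} h → split (s≤s⁻¹ h)) ⟩
  ∑[ i < suc (suc N) ] (fromℕ (toℕ i) * T (toℕ i) + fromℕ (suc N ∸ toℕ i) * T (toℕ i))
    ≡⟨ ∑-+ (suc (suc N)) (λ i → fromℕ (toℕ i) * T (toℕ i)) (λ i → fromℕ (suc N ∸ toℕ i) * T (toℕ i)) ⟩
  ∑[ i < suc (suc N) ] (fromℕ (toℕ i) * T (toℕ i)) + ∑[ i < suc (suc N) ] (fromℕ (suc N ∸ toℕ i) * T (toℕ i))
    ≡⟨ cong₂ _+_ left right ⟩
  x * conv N x y + y * conv N x y
    ≡⟨ ℚ.*-distribʳ-+ (conv N x y) x y ⟨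
  (x + y) * conv N x y ∎
  where
  open ≡-Reasoning
  n = fromℕ (suc N)
  T : ℕ → ℚ
  T i = t i x * t (suc N ∸ i) y
  split : ∀ {i} → i ℕ.≤ suc N → n * T i ≡ fromℕ i * T i + fromℕ (suc N ∸ i) * T i
  split {i} h = trans (cong (_* T i) (trans (cong fromℕ (sym (ℕ.m+[n∸m]≡n h))) (fromℕ-+ i (suc N ∸ i))))
    (ℚ.*-distribʳ-+ (T i) (fromℕ i) (fromℕ (suc N ∸ i)))
  U : ℕ → ℚ
  U i = t i x * t (N ∸ i) y
  left : ∑[ i < suc (suc N) ] (fromℕ (toℕ i) * T (toℕ i)) ≡ x * conv N x y
  left = trans (cong (_+ ∑[ i < suc N ] (fromℕ (suc (toℕ i)) * T (suc (toℕ i)))) (ℚ.*-zeroˡ (T 0)))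
    (trans (ℚ.+-identityˡ _) (trans
      (∑-cong (suc N) λ i → trans (sym (ℚ.*-assoc (fromℕ (suc (toℕ i))) _ _))
        (trans (cong (_* t (N ∸ toℕ i) y) (t-suc (toℕ i) x)) (ℚ.*-assoc x _ _)))
      (∑-*ˡ (suc N) x (λ i → U (toℕ i)))))
  right : ∑[ i < suc (suc N) ] (fromℕ (suc N ∸ toℕ i) * T (toℕ i)) ≡ y * conv N x y
  right = trans (∑-snoc (λ i → fromℕ (suc N ∸ i) * T i) (suc N))
    (trans (cong₂ _+_
      (trans (∑-congℕ (suc N) {λ i → fromℕ (suc N ∸ i) * T i} {λ i → y * U i} (λ {i} h → step (s≤s⁻¹ h)))
        (∑-*ˡ (suc N) y (λ i → U (toℕ i))))
      (trans (cong (λ z → fromℕ z * T (suc N)) (ℕ.n∸n≡0 (suc N))) (ℚ.*-zeroˡ (T (suc N)))))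
      (ℚ.+-identityʳ _))
    where
    step : ∀ {i} → i ℕ.≤ N → fromℕ (suc N ∸ i) * T i ≡ y * U i
    step {i} h rewrite ℕ.+-∸-assoc 1 h = trans
      (solve 3 (λ a b c → a :* (b :* c) := b :* (a :* c)) refl (fromℕ (suc (N ∸ i))) (t i x) (t (suc (N ∸ i)) y))
      (trans (cong (t i x *_) (t-suc (N ∸ i) y))
        (solve 3 (λ a b c → a :* (b :* c) := b :* (a :* c)) refl (t i x) y (t (N ∸ i) y)))

fromℕ-cancelˡ : ∀ n {p q} → fromℕ (suc n) * p ≡ fromℕ (suc n) * q → p ≡ q
fromℕ-cancelˡ n {p} {q} e = trans (unscale p) (trans (cong (rec n *_) e) (sym (unscale q)))
  where
  unscale : ∀ p → p ≡ rec n * (fromℕ (suc n) * p)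
  unscale p = sym (trans (solve 3 (λ r n p → r :* (n :* p) := (n :* r) :* p) refl (rec n) (fromℕ (suc n)) p)
    (trans (cong (_* p) (fromℕ-rec n)) (ℚ.*-identityˡ p)))

conv-t : ∀ N x y → conv N x y ≡ t N (x + y)
conv-t zero    x y = refl
conv-t (suc N) x y = fromℕ-cancelˡ N (trans (conv-suc N x y)
  (trans (cong ((x + y) *_) (conv-t N x y)) (sym (t-suc N (x + y)))))

-- The sum runs over the triangle of pairs with i + j < N. This triangle lies in the square of side
-- N, which gives `E-+-≤`; the triangle of side M + N contains the M by N rectangle, which gives
-- `E-+-≥`.
E-triangle : ∀ N x y → E N (x + y) ≡ ∑[ i < N ] (t (toℕ i) x * E (N ∸ toℕ i) y)
E-triangle zero    x y = refl
E-triangle (suc N) x y = sym (begin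
  ∑[ i < suc N ] (t (toℕ i) x * E (suc N ∸ toℕ i) y)
    ≡⟨ ∑-congℕ (suc N) {λ i → t i x * E (suc N ∸ i) y} {λ i → t i x * E (N ∸ i) y + t i x * t (N ∸ i) y} (λ {i} h → step (s≤s⁻¹ h)) ⟩
  ∑[ i < suc N ] (t (toℕ i) x * E (N ∸ toℕ i) y + t (toℕ i) x * t (N ∸ toℕ i) y)
    ≡⟨ ∑-+ (suc N) (λ i → t (toℕ i) x * E (N ∸ toℕ i) y) (λ i → t (toℕ i) x * t (N ∸ toℕ i) y) ⟩
  ∑[ i < suc N ] (t (toℕ i) x * E (N ∸ toℕ i) y) + conv N x y
    ≡⟨ cong (_+ conv N x y) (trans (∑-snoc (λ i → t i x * E (N ∸ i) y) N)
         (trans (cong (λ z → ∑[ i < N ] (t (toℕ i) x * E (N ∸ toℕ i) y) + t N x * E z y) (ℕ.n∸n≡0 N))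
           (trans (cong (∑[ i < N ] (t (toℕ i) x * E (N ∸ toℕ i) y) +_) (ℚ.*-zeroʳ (t N x))) (ℚ.+-identityʳ (∑[ i < N ] (t (toℕ i) x * E (N ∸ toℕ i) y)))))) ⟩
  ∑[ i < N ] (t (toℕ i) x * E (N ∸ toℕ i) y) + conv N x y
    ≡⟨ cong₂ _+_ (sym (E-triangle N x y)) (conv-t N x y) ⟩
  E N (x + y) + t N (x + y) ∎)
  where
  open ≡-Reasoning
  step : ∀ {i} → i ℕ.≤ N → t i x * E (suc N ∸ i) y ≡ t i x * E (N ∸ i) y + t i x * t (N ∸ i) y
  step {i} h rewrite ℕ.+-∸-assoc 1 h = ℚ.*-distribˡ-+ (t i x) _ _

E-+-≤ : ∀ N {x y} → 0ℚ ≤ x → 0ℚ ≤ y → E N (x + y) ≤ E N x * E N y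
E-+-≤ N {x} {y} 0≤x 0≤y = begin
  E N (x + y)                                      ≡⟨ E-triangle N x y ⟩
  ∑[ i < N ] (t (toℕ i) x * E (N ∸ toℕ i) y)       ≤⟨ ∑-≤ N _ _ (λ i → *-monoˡ (t≥0 0≤x (toℕ i)) (E-monoᴺ 0≤y (ℕ.m∸n≤m N (toℕ i)))) ⟩
  ∑[ i < N ] (t (toℕ i) x * E N y)                 ≡⟨ ∑-cong N (λ i → ℚ.*-comm (t (toℕ i) x) (E N y)) ⟩
  ∑[ i < N ] (E N y * t (toℕ i) x)                 ≡⟨ ∑-*ˡ N (E N y) (λ i → t (toℕ i) x) ⟩
  E N y * ∑[ i < N ] t (toℕ i) x                   ≡⟨ trans (cong (E N y *_) (sym (E-∑ N x))) (ℚ.*-comm (E N y) (E N x)) ⟩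
  E N x * E N y                                    ∎
  where open ℚ.≤-Reasoning

E-+-≥ : ∀ M N {x y} → 0ℚ ≤ x → 0ℚ ≤ y → E M x * E N y ≤ E (M ℕ.+ N) (x + y)
E-+-≥ M N {x} {y} 0≤x 0≤y = begin
  E M x * E N y                                    ≡⟨ trans (ℚ.*-comm (E M x) (E N y)) (cong (E N y *_) (E-∑ M x)) ⟩
  E N y * ∑[ i < M ] t (toℕ i) x                   ≡⟨ ∑-*ˡ M (E N y) (λ i → t (toℕ i) x) ⟨
  ∑[ i < M ] (E N y * t (toℕ i) x)                 ≡⟨ ∑-cong M (λ i → ℚ.*-comm (E N y) (t (toℕ i) x)) ⟩
  ∑[ i < M ] (t (toℕ i) x * E N y)                 ≤⟨ ∑-monoℕ M {λ i → t i x * E N y} {s} (λ {i} h → *-monoˡ (t≥0 0≤x i) (E-monoᴺ 0≤y (le h))) ⟩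
  ∑[ i < M ] s (toℕ i)                             ≤⟨ +-slack _ (∑≥0 N (λ i → s (M ℕ.+ toℕ i)) (λ i → *≥0 (t≥0 0≤x (M ℕ.+ toℕ i)) (E≥0 0≤y (M ℕ.+ N ∸ (M ℕ.+ toℕ i))))) (∑-append s M N) ⟩
  ∑[ i < M ℕ.+ N ] s (toℕ i)                       ≡⟨ E-triangle (M ℕ.+ N) x y ⟨
  E (M ℕ.+ N) (x + y)                              ∎
  where
  open ℚ.≤-Reasoning
  s : ℕ → ℚ
  s i = t i x * E (M ℕ.+ N ∸ i) y
  le : ∀ {i} → i ℕ.< M → N ℕ.≤ M ℕ.+ N ∸ i
  le {i} h = ℕ.≤-trans (ℕ.≤-reflexive (sym (ℕ.m+n∸m≡n M N))) (ℕ.∸-monoʳ-≤ (M ℕ.+ N) (ℕ.<⇒≤ h))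

E-×-≤ : ∀ N k {x} → 0ℚ ≤ x → E N (fromℕ k * x) ≤ E (suc N) x ^ k
E-×-≤ zero    k       0≤x = ^≥0 (E≥0 0≤x 1) k
E-×-≤ (suc N) zero    {x} 0≤x = ≤-eq (trans (cong (E (suc N)) (ℚ.*-zeroˡ x)) (E-0 N)) refl ℚ.≤-refl
  where
  E-0 : ∀ N → E (suc N) 0ℚ ≡ 1ℚ
  E-0 zero    = refl
  E-0 (suc N) = trans (cong₂ _+_ (E-0 N)
    (trans (cong (_* rec! (suc N)) (ℚ.*-zeroˡ (0ℚ ^ N))) (ℚ.*-zeroˡ (rec! (suc N))))) refl
E-×-≤ (suc N) (suc k) {x} 0≤x = ≤-eq
  (cong (E (suc N)) (trans (cong (_* x) (fromℕ-suc k)) (solve 2 (λ k x → (con 1ℚ :+ k) :* x := x :+ k :* x) refl (fromℕ k) x)))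
  refl
  (ℚ.≤-trans (E-+-≤ (suc N) 0≤x (*≥0 (fromℕ≥0 k) 0≤x))
    (*-mono (E≥0 (*≥0 (fromℕ≥0 k) 0≤x) (suc N)) (E≥0 0≤x (suc (suc N)))
      (E-monoᴺ 0≤x (ℕ.n≤1+n (suc N))) (E-×-≤ (suc N) k 0≤x)))

-- E N x ≤ 1/(1 - x) and E N x ≤ (2 + x)/(2 - x), cleared of denominators; the
-- extra term on the left makes the induction work.
E-upper₁ : ∀ {x} → 0ℚ ≤ x → ∀ N → (1ℚ - x) * E (suc N) x + x * t N x ≤ 1ℚ
E-upper₁ {x} 0≤x zero = ℚ.≤-reflexive (solve 1 (λ x → (con 1ℚ :- x) :* (con 0ℚ :+ con 1ℚ) :+ x :* con 1ℚ := con 1ℚ) refl x)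
E-upper₁ {x} 0≤x (suc N) = ℚ.≤-trans
  (≤-eq
    (solve 3 (λ x e t → (con 1ℚ :- x) :* (e :+ t) :+ x :* t := (con 1ℚ :- x) :* e :+ t) refl x (E (suc N) x) (t (suc N) x))
    refl
    (ℚ.+-monoʳ-≤ ((1ℚ - x) * E (suc N) x)
      (≤-eq (t-suc′ N x) (sym (ℚ.*-identityʳ (x * t N x))) (*-monoˡ (*≥0 0≤x (t≥0 0≤x N)) (rec-anti {0} {N} z≤n)))))
  (E-upper₁ 0≤x N)

E-upper₂ : ∀ {x} → 0ℚ ≤ x → ∀ N → (fromℕ 2 - x) * E (suc (suc N)) x + x * t (suc N) x ≤ fromℕ 2 + x
E-upper₂ {x} 0≤x zero = ℚ.≤-reflexive
  (trans (cong (λ z → (fromℕ 2 - x) * z + x * t 1 x) (E2 x))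
    (solve 1 (λ x → (con (fromℕ 2) :- x) :* (con 1ℚ :+ x) :+ x :* (x :* con 1ℚ :* con 1ℚ) := con (fromℕ 2) :+ x) refl x))
E-upper₂ {x} 0≤x (suc N) = ℚ.≤-trans
  (≤-eq
    (solve 3 (λ x e t → (con (fromℕ 2) :- x) :* (e :+ t) :+ x :* t := (con (fromℕ 2) :- x) :* e :+ con (fromℕ 2) :* t) refl x (E (suc (suc N)) x) (t (suc (suc N)) x))
    refl
    (ℚ.+-monoʳ-≤ ((fromℕ 2 - x) * E (suc (suc N)) x)
      (≤-eq (trans (cong (fromℕ 2 *_) (t-suc′ (suc N) x)) (solve 3 (λ a b c → a :* (b :* c) := b :* (a :* c)) refl (fromℕ 2) (x * t (suc N) x) (rec (suc N))))
            (sym (ℚ.*-identityʳ (x * t (suc N) x)))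
            (*-monoˡ (*≥0 0≤x (t≥0 0≤x (suc N))) (*-monoˡ (fromℕ≥0 2) (rec-anti {1} {suc N} (s≤s z≤n)))))))
  (E-upper₂ 0≤x N)

E-≤₁ : ∀ {x} → 0ℚ ≤ x → ∀ N → (1ℚ - x) * E N x ≤ 1ℚ
E-≤₁ {x} 0≤x zero    = ≤-eq (ℚ.*-zeroʳ (1ℚ - x)) refl 0≤1
E-≤₁ {x} 0≤x (suc N) = ℚ.≤-trans (+-slack (x * t N x) (*≥0 0≤x (t≥0 0≤x N)) refl) (E-upper₁ 0≤x N)

E-≤₂ : ∀ {x} → 0ℚ ≤ x → ∀ N → (fromℕ 2 - x) * E (suc (suc N)) x ≤ fromℕ 2 + x
E-≤₂ {x} 0≤x N = ℚ.≤-trans (+-slack (x * t (suc N) x) (*≥0 0≤x (t≥0 0≤x (suc N))) refl) (E-upper₂ 0≤x N)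

-- The factor comes from E N δ ≤ 1/(1 - δ), for every N at once. This stands in for the continuity
-- of exp whenever one entry of a sequence is exchanged for another.
E-perturb : ∀ N {x δ} → 0ℚ ≤ x → 0ℚ ≤ δ → δ ≤ 1ℚ → (1ℚ - δ) * E N (x + δ) ≤ E N x
E-perturb N {x} {δ} 0≤x 0≤δ δ≤1 = begin
  (1ℚ - δ) * E N (x + δ)         ≤⟨ *-monoˡ (≤⇒0≤- δ≤1) (E-+-≤ N 0≤x 0≤δ) ⟩
  (1ℚ - δ) * (E N x * E N δ)     ≡⟨ solve 3 (λ a b c → a :* (b :* c) := b :* (a :* c)) refl (1ℚ - δ) (E N x) (E N δ) ⟩
  E N x * ((1ℚ - δ) * E N δ)     ≤⟨ *-monoˡ (E≥0 0≤x N) (E-≤₁ 0≤δ N) ⟩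
  E N x * 1ℚ                     ≡⟨ ℚ.*-identityʳ (E N x) ⟩
  E N x                          ∎
  where open ℚ.≤-Reasoning

-- Exponentials of blocks of the harmonic series

blockSum≥0 : ∀ a L → 0ℚ ≤ blockSum a L
blockSum≥0 a L = ∑≥0 L (λ i → rec (a ℕ.+ toℕ i)) (λ i → rec≥0 (a ℕ.+ toℕ i))

blockSum-suc : ∀ a L → blockSum a (suc L) ≡ blockSum a L + rec (a ℕ.+ L)
blockSum-suc a L = ∑-snoc (λ i → rec (a ℕ.+ i)) L

-- E-≤₁ at x = 1/(b + 1), where (b + 1) (1 - x) = b.
E-rec-≤ : ∀ b N → fromℕ b * E N (rec b) ≤ fromℕ (suc b)
E-rec-≤ b N = ≤-eq
  (trans (cong (_* E N (rec b)) lem) (ℚ.*-assoc (fromℕ (suc b)) (1ℚ - rec b) (E N (rec b))))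
  (sym (ℚ.*-identityʳ (fromℕ (suc b))))
  (*-monoˡ (fromℕ≥0 (suc b)) (E-≤₁ (rec≥0 b) N))
  where
  lem : fromℕ b ≡ fromℕ (suc b) * (1ℚ - rec b)
  lem = sym (trans (solve 2 (λ n r → n :* (con 1ℚ :- r) := n :- n :* r) refl (fromℕ (suc b)) (rec b))
    (trans (cong₂ _-_ (fromℕ-suc b) (fromℕ-rec b)) (solve 1 (λ b → (con 1ℚ :+ b) :- con 1ℚ := b) refl (fromℕ b))))

E-rec-≥ : ∀ b → fromℕ (suc (suc b)) ≡ fromℕ (suc b) * E 2 (rec b)
E-rec-≥ b = sym (trans (cong (fromℕ (suc b) *_) (E2 (rec b)))
  (trans (solve 2 (λ n r → n :* (con 1ℚ :+ r) := n :* r :+ n) refl (fromℕ (suc b)) (rec b))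
    (trans (cong (_+ fromℕ (suc b)) (fromℕ-rec b)) (sym (fromℕ-suc (suc b))))))

-- Each summand 1/(b + 1) contributes a factor of at most (b + 1)/b, and these telescope from a to a
-- + L.
E-block-≤ : ∀ a L N → fromℕ a * E N (blockSum a L) ≤ fromℕ (a ℕ.+ L)
E-block-≤ a zero N = ℚ.≤-trans (*-monoˡ (fromℕ≥0 a) (E0≤1 N))
  (ℚ.≤-reflexive (trans (ℚ.*-identityʳ (fromℕ a)) (cong fromℕ (sym (ℕ.+-identityʳ a)))))
  where
  E0≤1 : ∀ N → E N 0ℚ ≤ 1ℚ
  E0≤1 N = ≤-eq (sym (ℚ.*-identityˡ (E N 0ℚ))) refl (E-≤₁ ℚ.≤-refl N)
E-block-≤ a (suc L) N = begin
  fromℕ a * E N (blockSum a (suc L))                       ≡⟨ cong (λ z → fromℕ a * E N z) (blockSum-suc a L) ⟩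
  fromℕ a * E N (blockSum a L + rec (a ℕ.+ L))             ≤⟨ *-monoˡ (fromℕ≥0 a) (E-+-≤ N (blockSum≥0 a L) (rec≥0 (a ℕ.+ L))) ⟩
  fromℕ a * (E N (blockSum a L) * E N (rec (a ℕ.+ L)))     ≡⟨ ℚ.*-assoc (fromℕ a) _ _ ⟨
  fromℕ a * E N (blockSum a L) * E N (rec (a ℕ.+ L))       ≤⟨ *-monoʳ (E≥0 (rec≥0 (a ℕ.+ L)) N) (E-block-≤ a L N) ⟩
  fromℕ (a ℕ.+ L) * E N (rec (a ℕ.+ L))                    ≤⟨ E-rec-≤ (a ℕ.+ L) N ⟩
  fromℕ (suc (a ℕ.+ L))                                    ≡⟨ cong fromℕ (sym (ℕ.+-suc a L)) ⟩
  fromℕ (a ℕ.+ suc L)                                      ∎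
  where open ℚ.≤-Reasoning

-- The factors 1 + 1/(b + 1) = (b + 2)/(b + 1) telescope. Each of them is a Taylor polynomial of
-- length 2, whence the length 2L + 1 of the product.
E-block-≥ : ∀ a L → fromℕ (suc (a ℕ.+ L)) ≤ fromℕ (suc a) * E (L ℕ.* 2 ℕ.+ 1) (blockSum a L)
E-block-≥ a zero = ℚ.≤-reflexive (trans (cong (λ z → fromℕ (suc z)) (ℕ.+-identityʳ a)) (sym (ℚ.*-identityʳ (fromℕ (suc a)))))
E-block-≥ a (suc L) = begin
  fromℕ (suc (a ℕ.+ suc L))                                              ≡⟨ cong (λ z → fromℕ (suc z)) (ℕ.+-suc a L) ⟩
  fromℕ (suc (suc (a ℕ.+ L)))                                            ≡⟨ E-rec-≥ (a ℕ.+ L) ⟩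
  fromℕ (suc (a ℕ.+ L)) * E 2 r                                          ≤⟨ *-monoʳ (E≥0 (rec≥0 (a ℕ.+ L)) 2) (E-block-≥ a L) ⟩
  fromℕ (suc a) * E (L ℕ.* 2 ℕ.+ 1) (blockSum a L) * E 2 r               ≡⟨ trans (ℚ.*-assoc (fromℕ (suc a)) _ _) (cong (fromℕ (suc a) *_) (ℚ.*-comm _ (E 2 r))) ⟩
  fromℕ (suc a) * (E 2 r * E (L ℕ.* 2 ℕ.+ 1) (blockSum a L))             ≤⟨ *-monoˡ (fromℕ≥0 (suc a)) (E-+-≥ 2 (L ℕ.* 2 ℕ.+ 1) (rec≥0 (a ℕ.+ L)) (blockSum≥0 a L)) ⟩
  fromℕ (suc a) * E (suc (suc (L ℕ.* 2 ℕ.+ 1))) (r + blockSum a L)       ≡⟨ cong (λ z → fromℕ (suc a) * E (suc (suc (L ℕ.* 2 ℕ.+ 1))) z) (trans (ℚ.+-comm r _) (sym (blockSum-suc a L))) ⟩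
  fromℕ (suc a) * E (suc (suc (L ℕ.* 2 ℕ.+ 1))) (blockSum a (suc L))     ∎
  where
  open ℚ.≤-Reasoning
  r = rec (a ℕ.+ L)

-- Lower bounds for exp

-- The index at which the k-th entry of lim a evaluates a k.
limIndex : (a : ℕ → ℝ) → ℕ → ℕ
limIndex a k = proj₁ (cauchy (a k) (rec k) (rec>0 k))

module _ (a : ℕ → ℝ) (ca : IsCauchyᴿ a) (k : ℕ) {m : ℕ} (h : limIndex a k ℕ.≤ m) where

  lim-≤ : seq (lim a ca) k ≤ seq (a k) m + rec k
  lim-≤ = ≤-eq (solve 2 (λ x y → x := (x :- y) :+ y) refl (seq (lim a ca) k) (seq (a k) m)) (ℚ.+-comm (seq (a k) m) (rec k))
    (ℚ.+-monoˡ-≤ (seq (a k) m) (proj₂ (cauchy (a k) (rec k) (rec>0 k)) ℕ.≤-refl h))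

  lim-≥ : seq (a k) m ≤ seq (lim a ca) k + rec k
  lim-≥ = ≤-eq (solve 2 (λ x y → x := (x :- y) :+ y) refl (seq (a k) m) (seq (lim a ca) k)) (ℚ.+-comm (seq (lim a ca) k) (rec k))
    (ℚ.+-monoˡ-≤ (seq (lim a ca) k) (proj₂ (cauchy (a k) (rec k) (rec>0 k)) h ℕ.≤-refl))

seq-^ : ∀ x i m → seq (x ^ᴿ i) m ≡ seq x m ^ i
seq-^ x zero    m = refl
seq-^ x (suc i) m = cong (seq x m *_) (seq-^ x i m)

seq-series : ∀ x N m → seq (seriesᴿ (expTerm x) N) m ≡ E N (seq x m)
seq-series x zero    m = refl
seq-series x (suc N) m = cong₂ _+_ (seq-series x N m) (cong (_* rec! N) (seq-^ x N m))

expIndex : ℝ → ℕ → ℕ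
expIndex x = limIndex (seriesᴿ (expTerm x))

-- The k-th entry of `exp x` evaluates `E k` at an entry of x chosen by its modulus. Any later entry
-- m may be used in its place at the cost of 1/(k + 1), so m can be chosen to suit other estimates.
exp-seq-≤ : ∀ x k {m} → expIndex x k ℕ.≤ m → seq (exp x) k ≤ E k (seq x m) + rec k
exp-seq-≤ x k {m} h = ≤-eq refl (cong (_+ rec k) (sym (seq-series x k m))) (lim-≤ (seriesᴿ (expTerm x)) (exp-cauchy x) k h)

exp-seq-≥ : ∀ x k {m} → expIndex x k ℕ.≤ m → E k (seq x m) ≤ seq (exp x) k + rec k
exp-seq-≥ x k {m} h = ≤-eq (sym (seq-series x k m)) refl (lim-≥ (seriesᴿ (expTerm x)) (exp-cauchy x) k h)

rec≤1 : ∀ j → rec j ≤ 1ℚ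
rec≤1 j = rec-anti {0} {j} z≤n

1-rec≥0 : ∀ j → 0ℚ ≤ 1ℚ - rec j
1-rec≥0 j = ≤⇒0≤- (rec≤1 j)

≤+⇒-≤ : ∀ {a b c} → a ≤ b + c → a - b ≤ c
≤+⇒-≤ {a} {b} {c} h = ≤-eq refl (solve 2 (λ b c → c := (b :+ c) :- b) refl b c) (ℚ.+-monoˡ-≤ (- b) h)

-≤⇒≤+ : ∀ {a b c} → a - b ≤ c → a ≤ b + c
-≤⇒≤+ {a} {b} {c} h = ≤-eq (solve 2 (λ a b → a := b :+ (a :- b)) refl a b) refl (ℚ.+-monoʳ-≤ b h)

-- c ⊑ s says that c is at most exp (lim s), by Taylor polynomials whose length
-- may depend on the precision and on the entry of s at which they are evaluated.
infix 4 _⊑_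

_⊑_ : ℚ → (ℕ → ℚ) → Set
c ⊑ s = ∀ j → ∃ λ M → ∀ {k} → M ℕ.≤ k → ∃ λ K → (1ℚ - rec j) * c ≤ E K (s k)

NonNeg : (ℕ → ℚ) → Set
NonNeg s = ∀ m → 0ℚ ≤ s m

-- An entry k of x is fixed, which fixes the length K. Two factors 1 - r are lost, one in `⊑` and
-- one in moving from entry k to a later entry m; they cost at most 2rB ≤ 2δ, where B bounds c. The
-- third δ covers the distance between `exp x` at n and `E n`.
⊑⇒≤exp : ∀ x {c} → NonNeg (seq x) → c ⊑ seq x → fromℚ c ≤ᴿ exp x
⊑⇒≤exp x {c} 0≤x c⊑x ε 0<ε =
  let δ , 0<δ , 3δ≤ε = shrink 3 0<ε
      B , c≤B = above c
      η , 0<η , Bη≤δ = shrink B 0<δ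
      j , r≤η = below 0<η
      J , J≤δ = below 0<δ
      M , p = c⊑x j
      N , q = cauchy x (rec j) (rec>0 j)
      k = M ℕ.⊔ N
      K , c≤E = p (ℕ.m≤m⊔n M N)
      r = rec j
      rB≤δ = ℚ.≤-trans (≤-eq (ℚ.*-comm r (fromℕ B)) refl (*-monoˡ (fromℕ≥0 B) r≤η)) Bη≤δ
  in K ℕ.⊔ J , λ {n} hn → ≤+⇒-≤ (let
      m = N ℕ.⊔ expIndex x n
      xk≤ = -≤⇒≤+ {seq x k} {seq x m} {r} (q (ℕ.m≤n⊔m M N) (ℕ.m≤m⊔n N (expIndex x n)))
    in begin
      c
        ≡⟨ solve 2 (λ r c → c := (con 1ℚ :- r) :* ((con 1ℚ :- r) :* c) :+ (r :+ r :* (con 1ℚ :- r)) :* c) refl r c ⟩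
      (1ℚ - r) * ((1ℚ - r) * c) + (r + r * (1ℚ - r)) * c
        ≤⟨ ℚ.+-mono-≤
             (begin
               (1ℚ - r) * ((1ℚ - r) * c)       ≤⟨ *-monoˡ (1-rec≥0 j) c≤E ⟩
               (1ℚ - r) * E K (seq x k)        ≤⟨ *-monoˡ (1-rec≥0 j) (E-mono (0≤x k) xk≤ K) ⟩
               (1ℚ - r) * E K (seq x m + r)    ≤⟨ E-perturb K (0≤x m) (rec≥0 j) (rec≤1 j) ⟩
               E K (seq x m)                   ≤⟨ E-monoᴺ (0≤x m) (ℕ.m⊔n≤o⇒m≤o K J hn) ⟩
               E n (seq x m)                   ≤⟨ exp-seq-≥ x n (ℕ.m≤n⊔m N (expIndex x n)) ⟩
               seq (exp x) n + rec n           ≤⟨ ℚ.+-monoʳ-≤ (seq (exp x) n) (ℚ.≤-trans (rec-anti (ℕ.m⊔n≤o⇒n≤o K J hn)) J≤δ) ⟩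
               seq (exp x) n + δ               ∎)
             (begin
               (r + r * (1ℚ - r)) * c          ≤⟨ *-monoˡ (+≥0 (rec≥0 j) (*≥0 (rec≥0 j) (1-rec≥0 j))) c≤B ⟩
               (r + r * (1ℚ - r)) * fromℕ B    ≤⟨ +-slack (r * r * fromℕ B) (*≥0 (*≥0 (rec≥0 j) (rec≥0 j)) (fromℕ≥0 B))
                                                    (solve 2 (λ r B → r :* B :+ r :* B := (r :+ r :* (con 1ℚ :- r)) :* B :+ r :* r :* B) refl r (fromℕ B)) ⟩
               r * fromℕ B + r * fromℕ B       ≤⟨ ℚ.+-mono-≤ rB≤δ rB≤δ ⟩
               δ + δ                           ∎) ⟩
      seq (exp x) n + δ + (δ + δ)
        ≡⟨ solve 2 (λ e d → e :+ d :+ (d :+ d) := e :+ con (fromℕ 3) :* d) refl (seq (exp x) n) δ ⟩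
      seq (exp x) n + fromℕ 3 * δ
        ≤⟨ ℚ.+-monoʳ-≤ (seq (exp x) n) 3δ≤ε ⟩
      seq (exp x) n + ε ∎)
  where open ℚ.≤-Reasoning

exp-≤ : ∀ x {c} → (∀ K → ∃ λ M → ∀ {m} → M ℕ.≤ m → E K (seq x m) ≤ c) → exp x ≤ᴿ fromℚ c
exp-≤ x {c} h ε 0<ε =
  let J , J≤ε = below 0<ε
  in J , λ {n} hn → ≤+⇒-≤ (let
      M , p = h n
    in ℚ.≤-trans (exp-seq-≤ x n {M ℕ.⊔ expIndex x n} (ℕ.m≤n⊔m M (expIndex x n)))
         (ℚ.+-mono-≤ (p (ℕ.m≤m⊔n M (expIndex x n))) (ℚ.≤-trans (rec-anti hn) J≤ε)))

⊑-exact : ∀ {c s} → NonNeg s → (∃ λ M → ∀ {k} → M ℕ.≤ k → ∃ λ K → c ≤ E K (s k)) → c ⊑ s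
⊑-exact {c} {s} 0≤s (M , h) j = M , λ {k} hk → let K , p = h hk in K ,
  ℚ.≤-trans (*-monoˡ (1-rec≥0 j) p) (+-slack (rec j * E K (s k)) (*≥0 (rec≥0 j) (E≥0 (0≤s k) K))
    (solve 2 (λ r e → e := (con 1ℚ :- r) :* e :+ r :* e) refl (rec j) (E K (s k))))

⊑-E : ∀ {q} N → 0ℚ ≤ q → E N q ⊑ (λ _ → q)
⊑-E {q} N 0≤q = ⊑-exact (λ _ → 0≤q) (0 , λ _ → N , ℚ.≤-refl)

⊑-≗ : ∀ {c s u} → (∀ m → s m ≡ u m) → c ⊑ s → c ⊑ u
⊑-≗ {c} e h j = let M , p = h j in M , λ {k} hk → let K , q = p hk in K , subst (λ z → (1ℚ - rec j) * c ≤ E K z) (e k) q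

-- Chosen so that 1/(`double j` + 1) is half of 1/(j + 1): two losses at precision `double j` fit
-- into one at precision j.
double : ℕ → ℕ
double j = suc (2 ℕ.* j)

double-rec : ∀ j → rec (double j) + rec (double j) ≡ rec j
double-rec j = trans (cong (λ z → z + z) (trans (cong rec (sym (ℕ.+-suc j (j ℕ.+ 0)))) (sym (rec-* 1 j))))
  (solve 1 (λ r → con (rec 1) :* r :+ con (rec 1) :* r := r) refl (rec j))

1-rec-split : ∀ j → 1ℚ - rec j ≤ (1ℚ - rec (double j)) * (1ℚ - rec (double j))
1-rec-split j = +-slack (r * r) (*≥0 (rec≥0 (double j)) (rec≥0 (double j)))
  (trans (solve 1 (λ r → (con 1ℚ :- r) :* (con 1ℚ :- r) := (con 1ℚ :- (r :+ r)) :+ r :* r) refl r)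
    (cong (λ z → 1ℚ - z + r * r) (double-rec j)))
  where r = rec (double j)

⊑-+ : ∀ {c d s u} → 0ℚ ≤ c → 0ℚ ≤ d → NonNeg s → NonNeg u → c ⊑ s → d ⊑ u → c * d ⊑ (λ m → s m + u m)
⊑-+ {c} {d} {s} {u} 0≤c 0≤d 0≤s 0≤u h h′ j =
  let M , p = h (double j)
      N , q = h′ (double j)
  in M ℕ.⊔ N , λ {k} hk →
    let K , c≤ = p (ℕ.m⊔n≤o⇒m≤o M N hk)
        L , d≤ = q (ℕ.m⊔n≤o⇒n≤o M N hk)
        r = rec (double j)
    in K ℕ.+ L , (begin
      (1ℚ - rec j) * (c * d)                   ≤⟨ *-monoʳ (*≥0 0≤c 0≤d) (1-rec-split j) ⟩
      (1ℚ - r) * (1ℚ - r) * (c * d)            ≡⟨ solve 3 (λ r c d → r :* r :* (c :* d) := r :* c :* (r :* d)) refl (1ℚ - r) c d ⟩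
      (1ℚ - r) * c * ((1ℚ - r) * d)            ≤⟨ *-mono (*≥0 (1-rec≥0 (double j)) 0≤d) (E≥0 (0≤s k) K) c≤ d≤ ⟩
      E K (s k) * E L (u k)                    ≤⟨ E-+-≥ K L (0≤s k) (0≤u k) ⟩
      E (K ℕ.+ L) (s k + u k)                  ∎)
  where open ℚ.≤-Reasoning

⊑-× : ∀ {c s} → 0ℚ ≤ c → NonNeg s → c ⊑ s → ∀ n → c ^ n ⊑ (λ m → fromℕ n * s m)
⊑-× {c} {s} 0≤c 0≤s h zero    = ⊑-≗ (λ m → sym (ℚ.*-zeroˡ (s m))) (⊑-E 1 ℚ.≤-refl)
⊑-× {c} {s} 0≤c 0≤s h (suc n) = ⊑-≗
  (λ m → trans (solve 2 (λ k x → x :+ k :* x := (con 1ℚ :+ k) :* x) refl (fromℕ n) (s m)) (cong (_* s m) (sym (fromℕ-suc n))))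
  (⊑-+ 0≤c (^≥0 0≤c n) 0≤s (λ m → *≥0 (fromℕ≥0 n) (0≤s m)) h (⊑-× 0≤c 0≤s h n))

⊑-mono : ∀ {c s u} → NonNeg s → NonNeg u →
         (∀ ε → 0ℚ < ε → ∃ λ M → ∀ {m} → M ℕ.≤ m → s m ≤ u m + ε) → 0ℚ ≤ c → c ⊑ s → c ⊑ u
⊑-mono {c} {s} {u} 0≤s 0≤u le 0≤c h j =
  let r = rec (double j)
      M , p = h (double j)
      N , q = le r (rec>0 (double j))
  in M ℕ.⊔ N , λ {k} hk →
    let K , c≤ = p (ℕ.m⊔n≤o⇒m≤o M N hk)
    in K , (begin
      (1ℚ - rec j) * c                         ≤⟨ *-monoʳ 0≤c (1-rec-split j) ⟩
      (1ℚ - r) * (1ℚ - r) * c                  ≡⟨ ℚ.*-assoc (1ℚ - r) (1ℚ - r) c ⟩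
      (1ℚ - r) * ((1ℚ - r) * c)                ≤⟨ *-monoˡ (1-rec≥0 (double j)) c≤ ⟩
      (1ℚ - r) * E K (s k)                     ≤⟨ *-monoˡ (1-rec≥0 (double j)) (E-mono (0≤s k) (q (ℕ.m⊔n≤o⇒n≤o M N hk)) K) ⟩
      (1ℚ - r) * E K (u k + r)                 ≤⟨ E-perturb K (0≤u k) (rec≥0 (double j)) (rec≤1 (double j)) ⟩
      E K (u k)                                ∎)
  where open ℚ.≤-Reasoning

-- Logarithms, harmonic numbers and lower bounds for γ

log≥0 : ∀ p → NonNeg (logApprox p)
log≥0 p m = blockSum≥0 (suc m) ((p ∸ 1) ℕ.* suc m)

-- `logApprox (suc p) m` is the block of p(m + 1) terms that starts after m + 1. It ends at (p +
-- 1)(m + 1), so the upper estimate for blocks gives exactly p + 1, whatever the mesh.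
E-log-≤ : ∀ p m N → E N (logApprox (suc p) m) ≤ fromℕ (suc p)
E-log-≤ p m N = *-cancelˡ (fromℕ>0 m) (≤-eq refl
  (trans (ℚ.*-comm (fromℕ (suc m)) (fromℕ (suc p))) (sym (fromℕ-* (suc p) (suc m))))
  (E-block-≤ (suc m) (p ℕ.* suc m) N))

-- The lower estimate for the same block has denominator m + 2 instead of m + 1, which produces the
-- factor (m + 1)/(m + 2) = 1 - 1/(m + 2).
E-log-≥ : ∀ p m → ∃ λ K → (1ℚ - rec (suc m)) * fromℕ (suc p) ≤ E K (logApprox (suc p) m)
E-log-≥ p m = K , *-cancelˡ (fromℕ>0 (suc m)) (begin
  fromℕ (2 ℕ.+ m) * ((1ℚ - rec (suc m)) * fromℕ (suc p))
    ≡⟨ solve 3 (λ n r p → n :* ((con 1ℚ :- r) :* p) := (n :- n :* r) :* p) refl (fromℕ (2 ℕ.+ m)) (rec (suc m)) (fromℕ (suc p)) ⟩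
  (fromℕ (2 ℕ.+ m) - fromℕ (2 ℕ.+ m) * rec (suc m)) * fromℕ (suc p)
    ≡⟨ cong (_* fromℕ (suc p)) (trans (cong₂ _-_ (fromℕ-suc (suc m)) (fromℕ-rec (suc m)))
         (solve 1 (λ n → (con 1ℚ :+ n) :- con 1ℚ := n) refl (fromℕ (suc m)))) ⟩
  fromℕ (suc m) * fromℕ (suc p)
    ≡⟨ trans (ℚ.*-comm (fromℕ (suc m)) (fromℕ (suc p))) (sym (fromℕ-* (suc p) (suc m))) ⟩
  fromℕ (suc m ℕ.+ p ℕ.* suc m)
    ≤⟨ fromℕ-mono (ℕ.n≤1+n (suc m ℕ.+ p ℕ.* suc m)) ⟩
  fromℕ (suc (suc m ℕ.+ p ℕ.* suc m))
    ≤⟨ E-block-≥ (suc m) (p ℕ.* suc m) ⟩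
  fromℕ (2 ℕ.+ m) * E K (logApprox (suc p) m) ∎)
  where
  open ℚ.≤-Reasoning
  K = p ℕ.* suc m ℕ.* 2 ℕ.+ 1

⊑-log : ∀ p → fromℕ (suc p) ⊑ logApprox (suc p)
⊑-log p j = j , λ {k} hk → let K , q = E-log-≥ p k in K ,
  ℚ.≤-trans (*-monoʳ (fromℕ≥0 (suc p)) (ℚ.+-monoʳ-≤ 1ℚ (ℚ.neg-antimono-≤ (rec-anti (ℕ.≤-trans hk (ℕ.n≤1+n k)))))) q

-- Serves to make the entries of γ non-negative, as the estimates for `E` require. The sequence may
-- fall, but by no more than 1/(N + 1) - 1/(N + 2) in one step, so the bound 1/(N + 1) is inherited.
γ-approx-≥ : ∀ N m → rec N ≤ seq (γ-approx N) m
γ-approx-≥ zero    m = ℚ.≤-reflexive refl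
γ-approx-≥ (suc N) m = begin
  rec (suc N)
    ≡⟨ solve 2 (λ a b → b := a :+ (b :- a)) refl (rec N) (rec (suc N)) ⟩
  rec N + (rec (suc N) - rec N)
    ≤⟨ ℚ.+-mono-≤ (γ-approx-≥ N m) (ℚ.+-monoʳ-≤ (rec (suc N)) (ℚ.neg-antimono-≤ (block-≤ N m))) ⟩
  seq (γ-approx N) m + (rec (suc N) - blockSum (suc N ℕ.* suc m) (suc m))
    ≡⟨ cong (seq (γ-approx N) m +_) (sym (γ-step N m)) ⟩
  seq (γ-approx N) m + (seq (γ-approx (suc N)) m - seq (γ-approx N) m)
    ≡⟨ solve 2 (λ a b → a :+ (b :- a) := b) refl (seq (γ-approx N) m) (seq (γ-approx (suc N)) m) ⟩
  seq (γ-approx (suc N)) m ∎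
  where open ℚ.≤-Reasoning

γ-approx≥0 : ∀ N → NonNeg (seq (γ-approx N))
γ-approx≥0 N m = ℚ.≤-trans (rec≥0 N) (γ-approx-≥ N m)

γ≥0 : NonNeg (seq γ)
γ≥0 k = γ-approx≥0 k (limIndex γ-approx k)

harmonic≥0 : ∀ p → 0ℚ ≤ harmonic p
harmonic≥0 p = blockSum≥0 0 p

harmonic-suc : ∀ p → harmonic (suc p) ≡ harmonic p + rec p
harmonic-suc = ∑-snoc rec

γ+log : ∀ N m → seq (γ-approx N) m + logApprox (suc N) m ≡ harmonic (suc N)
γ+log N m = solve 2 (λ h l → (h :- l) :+ l := h) refl (harmonic (suc N)) (logApprox (suc N) m)

E-harmonic-≤ : ∀ q m N {y} → 0ℚ ≤ y → y + logApprox (suc q) m ≡ harmonic (suc q) →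
               E N (harmonic (suc q)) ≤ E N y * fromℕ (suc q)
E-harmonic-≤ q m N {y} 0≤y e = begin
  E N (harmonic (suc q))                  ≡⟨ cong (E N) (sym e) ⟩
  E N (y + logApprox (suc q) m)           ≤⟨ E-+-≤ N 0≤y (log≥0 (suc q) m) ⟩
  E N y * E N (logApprox (suc q) m)       ≤⟨ *-monoˡ (E≥0 0≤y N) (E-log-≤ q m N) ⟩
  E N y * fromℕ (suc q)                   ∎
  where open ℚ.≤-Reasoning

-- exp(H_q)/f(q) increases, and its limit is at most exp γ because f(q) ≥ q.
module _ (f : ℕ → ℚ) (p : ℕ) (f-step : ∀ q → p ℕ.≤ q → f (suc q) ≤ f q * E 3 (rec q)) (f-≥ : ∀ q → fromℕ q ≤ f q) where

  E-harmonic-ratio : ∀ N r → f (r ℕ.+ p) * E N (harmonic p) ≤ f p * E (r ℕ.* 3 ℕ.+ N) (harmonic (r ℕ.+ p))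
  E-harmonic-ratio N zero    = ℚ.≤-refl
  E-harmonic-ratio N (suc r) = begin
    f (suc q) * E N (harmonic p)                           ≤⟨ *-monoʳ (E≥0 (harmonic≥0 p) N) (f-step q (ℕ.m≤n+m p r)) ⟩
    f q * E 3 (rec q) * E N (harmonic p)                   ≡⟨ solve 3 (λ a b c → a :* b :* c := a :* c :* b) refl (f q) (E 3 (rec q)) (E N (harmonic p)) ⟩
    f q * E N (harmonic p) * E 3 (rec q)                   ≤⟨ *-monoʳ (E≥0 (rec≥0 q) 3) (E-harmonic-ratio N r) ⟩
    f p * E (r ℕ.* 3 ℕ.+ N) (harmonic q) * E 3 (rec q)     ≡⟨ solve 3 (λ a b c → a :* b :* c := a :* (c :* b)) refl (f p) (E (r ℕ.* 3 ℕ.+ N) (harmonic q)) (E 3 (rec q)) ⟩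
    f p * (E 3 (rec q) * E (r ℕ.* 3 ℕ.+ N) (harmonic q))   ≤⟨ *-monoˡ (ℚ.≤-trans (fromℕ≥0 p) (f-≥ p)) (E-+-≥ 3 (r ℕ.* 3 ℕ.+ N) (rec≥0 q) (harmonic≥0 q)) ⟩
    f p * E (3 ℕ.+ (r ℕ.* 3 ℕ.+ N)) (rec q + harmonic q)   ≡⟨ cong (λ z → f p * E (3 ℕ.+ (r ℕ.* 3 ℕ.+ N)) z) (trans (ℚ.+-comm (rec q) (harmonic q)) (sym (harmonic-suc q))) ⟩
    f p * E (suc r ℕ.* 3 ℕ.+ N) (harmonic (suc q))         ∎
    where
    open ℚ.≤-Reasoning
    q = r ℕ.+ p

  -- The k-th entry of γ approximates H_q - log q with q = k + 1. The growth of exp(H_q)/f(q) is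
  -- followed from p up to this q, and f(q) ≥ q then cancels against exp(log q).
  γ-≥ : ∀ {s} → 0ℚ ≤ s → s * f p ≡ 1ℚ → ∀ N → ∃ λ M → ∀ {k} → M ℕ.≤ k → ∃ λ K → s * E N (harmonic p) ≤ E K (seq γ k)
  γ-≥ {s} 0≤s sf≡1 N = p , λ {k} hk →
    let r = suc k ∸ p
        q≡ : r ℕ.+ p ≡ suc k
        q≡ = ℕ.m∸n+n≡m (ℕ.≤-trans hk (ℕ.n≤1+n k))
        K = r ℕ.* 3 ℕ.+ N
        q = fromℕ (suc k)
    in K , *-cancelˡ (fromℕ>0 k) (begin
      q * (s * E N (harmonic p))                   ≡⟨ solve 3 (λ a b c → a :* (b :* c) := b :* (a :* c)) refl q s (E N (harmonic p)) ⟩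
      s * (q * E N (harmonic p))                   ≤⟨ *-monoˡ 0≤s (*-monoʳ (E≥0 (harmonic≥0 p) N) (f-≥ (suc k))) ⟩
      s * (f (suc k) * E N (harmonic p))           ≤⟨ *-monoˡ 0≤s (subst (λ z → f z * E N (harmonic p) ≤ f p * E K (harmonic z)) q≡ (E-harmonic-ratio N r)) ⟩
      s * (f p * E K (harmonic (suc k)))           ≡⟨ trans (sym (ℚ.*-assoc s (f p) (E K (harmonic (suc k))))) (trans (cong (_* E K (harmonic (suc k))) sf≡1) (ℚ.*-identityˡ (E K (harmonic (suc k))))) ⟩
      E K (harmonic (suc k))                       ≤⟨ E-harmonic-≤ k (limIndex γ-approx k) K (γ≥0 k) (γ+log k (limIndex γ-approx k)) ⟩
      E K (seq γ k) * q                            ≡⟨ ℚ.*-comm (E K (seq γ k)) q ⟩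
      q * E K (seq γ k)                            ∎)
    where open ℚ.≤-Reasoning

-- The inequality Σ 1/i² ≤ π²/6 from the Leibniz series

sgn : ℕ → ℚ
sgn i = (- 1ℚ) ^ i

sgn² : ∀ i → sgn i * sgn i ≡ 1ℚ
sgn² zero    = refl
sgn² (suc i) = trans (solve 1 (λ s → (con (- 1ℚ) :* s) :* (con (- 1ℚ) :* s) := s :* s) refl (sgn i)) (sgn² i)

sgn-+ : ∀ i j → sgn (i ℕ.+ j) ≡ sgn i * sgn j
sgn-+ zero    j = sym (ℚ.*-identityˡ (sgn j))
sgn-+ (suc i) j = trans (cong (- 1ℚ *_) (sgn-+ i j)) (sym (ℚ.*-assoc (- 1ℚ) (sgn i) (sgn j)))

sgn-double : ∀ m → sgn (m ℕ.+ m) ≡ 1ℚ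
sgn-double m = trans (sgn-+ m m) (sgn² m)

∑-reverse : ∀ (g : ℕ → ℚ) m → ∑[ i < m ] g (m ∸ suc (toℕ i)) ≡ ∑[ i < m ] g (toℕ i)
∑-reverse g zero    = refl
∑-reverse g (suc m) = trans (cong (g m +_) (∑-reverse g m)) (trans (ℚ.+-comm (g m) (∑[ i < m ] g (toℕ i))) (sym (∑-snoc g m)))

∑-- : ∀ n (f g : Fin n → ℚ) → ∑[ i < n ] (f i - g i) ≡ ∑[ i < n ] f i - ∑[ i < n ] g i
∑-- n f g = trans (∑-+ n f (λ i → - g i)) (cong (λ z → ∑[ i < n ] f i + z) (sym (∑-neg n g)))

-- The reciprocal of the odd number 2i + 1.
odd : ℕ → ℚ
odd i = rec (2 ℕ.* i)

-- Partial sums of 1 - 1/2 + 1/3 - .... Only their recursion and the alternating-series error bound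
-- are used, never the limit log 2.
log2 : ℕ → ℚ
log2 = alternating rec

log2-suc : ∀ r → log2 (suc r) ≡ log2 r + sgn r * rec r
log2-suc = ∑-snoc (λ i → sgn i * rec i)

leibniz-suc : ∀ m → leibniz (suc m) ≡ leibniz m + sgn m * odd m
leibniz-suc = ∑-snoc (λ i → sgn i * odd i)

oddSquares : ℕ → ℚ
oddSquares m = ∑[ i < m ] (odd (toℕ i) * odd (toℕ i))

-- The off-diagonal part of the square of 1 - 1/3 + 1/5 - …: in the sum over all
-- pairs of odd integers in (-2m, 2m), write 1/(ab) = (1/a - 1/b)/(b - a).
cross : ℕ → ℚ
cross m = ∑[ i < m ] ((log2 (m ℕ.+ toℕ i) - log2 (m ∸ suc (toℕ i))) * odd (toℕ i))


fromℕ-∸ : ∀ {m i} → i ℕ.≤ m → fromℕ (m ∸ i) ≡ fromℕ m - fromℕ i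
fromℕ-∸ {m} {i} h = trans (solve 2 (λ a b → a := (b :+ a) :- b) refl (fromℕ (m ∸ i)) (fromℕ i))
  (cong (_- fromℕ i) (trans (sym (fromℕ-+ i (m ∸ i))) (cong fromℕ (ℕ.m+[n∸m]≡n h))))

odd-inv : ∀ i → (1ℚ + fromℕ 2 * fromℕ i) * odd i ≡ 1ℚ
odd-inv i = trans (cong (_* odd i) (sym (trans (fromℕ-suc (2 ℕ.* i)) (cong (1ℚ +_) (fromℕ-* 2 i))))) (fromℕ-rec (2 ℕ.* i))

-- Applied to a = m - i and b = m + i + 1, so that a + b = 2m + 1 and b - a = 2i + 1.
partial-fractions : ∀ a b A B o → a * A ≡ 1ℚ → b * B ≡ 1ℚ → (b - a) * o ≡ 1ℚ →
                    (a + b) * ((A + B) * o) ≡ fromℕ 4 * o + A - B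
partial-fractions a b A B o eA eB eo = begin
  (a + b) * ((A + B) * o)
    ≡⟨ solve 5 (λ a b A B o → (a :+ b) :* ((A :+ B) :* o) :=
         con (fromℕ 2) :* o :* (a :* A :+ b :* B) :+ (b :- a) :* o :* (A :- B)) refl a b A B o ⟩
  fromℕ 2 * o * (a * A + b * B) + (b - a) * o * (A - B)
    ≡⟨ cong₂ _+_ (cong₂ (λ x y → fromℕ 2 * o * (x + y)) eA eB) (cong (_* (A - B)) eo) ⟩
  fromℕ 2 * o * (1ℚ + 1ℚ) + 1ℚ * (A - B)
    ≡⟨ solve 3 (λ o A B → con (fromℕ 2) :* o :* (con 1ℚ :+ con 1ℚ) :+ con 1ℚ :* (A :- B) := con (fromℕ 4) :* o :+ A :- B) refl o A B ⟩
  fromℕ 4 * o + A - B ∎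
  where open ≡-Reasoning

∸-split : ∀ {m i} → i ℕ.< m → m ∸ i ≡ suc (m ∸ suc i)
∸-split {suc m} {i} (s≤s h) = ℕ.+-∸-assoc 1 h

-- Induction on m. From m to m + 1, each difference of `log2` in `cross` gains one term at either
-- end; `D i` is that gain. Multiplied by 2m + 1, the gains split into partial fractions: the terms
-- A, reversed, followed by the terms B, form `log2 (m + m)`, and the rest sums to 4 · (-1)^m · L.
-- The new summand i = m cancels the `log2`, leaving the mixed term of the squared Leibniz sum.
leibniz² : ∀ m → fromℕ 2 * (leibniz m * leibniz m) ≡ oddSquares m + cross m
leibniz² zero    = refl
leibniz² (suc m) = begin
  fromℕ 2 * (leibniz (suc m) * leibniz (suc m))
    ≡⟨ cong (λ z → fromℕ 2 * (z * z)) (leibniz-suc m) ⟩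
  fromℕ 2 * ((L + s * o) * (L + s * o))
    ≡⟨ solve 3 (λ L s o → con (fromℕ 2) :* ((L :+ s :* o) :* (L :+ s :* o)) :=
         con (fromℕ 2) :* (L :* L) :+ con (fromℕ 2) :* (s :* s) :* (o :* o) :+ con (fromℕ 4) :* (s :* L) :* o) refl L s o ⟩
  fromℕ 2 * (L * L) + fromℕ 2 * (s * s) * (o * o) + fromℕ 4 * (s * L) * o
    ≡⟨ cong₂ (λ a b → a + fromℕ 2 * b * (o * o) + fromℕ 4 * (s * L) * o) (leibniz² m) (sgn² m) ⟩
  oddSquares m + cross m + fromℕ 2 * 1ℚ * (o * o) + fromℕ 4 * (s * L) * o
    ≡⟨ solve 5 (λ q c x l o → q :+ c :+ con (fromℕ 2) :* con 1ℚ :* (o :* o) :+ l :* o :=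
         (q :+ o :* o) :+ (c :+ (o :* (l :- x) :+ (x :+ con 1ℚ :* o) :* o))) refl
         (oddSquares m) (cross m) (log2 (m ℕ.+ m)) (fromℕ 4 * (s * L)) o ⟩
  (oddSquares m + o * o) + (cross m + (o * (fromℕ 4 * (s * L) - log2 (m ℕ.+ m)) + (log2 (m ℕ.+ m) + 1ℚ * o) * o))
    ≡⟨ cong₂ _+_ (sym (∑-snoc (λ i → odd i * odd i) m)) (sym cross-suc) ⟩
  oddSquares (suc m) + cross (suc m) ∎
  where
  open ≡-Reasoning
  L = leibniz m
  s = sgn m
  o = odd m
  A B : ℕ → ℚ
  A i = rec (m ∸ suc i)
  B i = rec (m ℕ.+ i)
  n = 1ℚ + fromℕ 2 * fromℕ m
  sgn-A : ∀ {i} → i ℕ.< m → s * sgn i ≡ - sgn (m ∸ suc i)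
  sgn-A {i} h = trans (sym (sgn-+ m i)) (trans
    (cong sgn (trans (cong (ℕ._+ i) (sym (ℕ.m∸n+n≡m (ℕ.<⇒≤ h)))) (ℕ.+-assoc (m ∸ i) i i)))
    (trans (sgn-+ (m ∸ i) (i ℕ.+ i)) (trans (cong₂ _*_ (cong sgn (∸-split h)) (sgn-double i))
      (solve 1 (λ x → con (- 1ℚ) :* x :* con 1ℚ := :- x) refl (sgn (m ∸ suc i))))))
  scaled : ∀ {i} → i ℕ.< m → n * ((A i + B i) * odd i) ≡ fromℕ 4 * odd i + A i - B i
  scaled {i} h = trans (cong (_* ((A i + B i) * odd i)) n≡a+b)
    (partial-fractions a b (A i) (B i) (odd i)
      (trans (cong (_* A i) (trans (sym (fromℕ-∸ (ℕ.<⇒≤ h))) (cong fromℕ (∸-split h)))) (fromℕ-rec (m ∸ suc i)))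
      (trans (cong (_* B i) (sym (trans (fromℕ-suc (m ℕ.+ i)) (cong (1ℚ +_) (fromℕ-+ m i))))) (fromℕ-rec (m ℕ.+ i)))
      (trans (cong (_* odd i) b-a) (odd-inv i)))
    where
    a = fromℕ m - fromℕ i
    b = 1ℚ + (fromℕ m + fromℕ i)
    n≡a+b : n ≡ a + b
    n≡a+b = solve 2 (λ m i → con 1ℚ :+ con (fromℕ 2) :* m := (m :- i) :+ (con 1ℚ :+ (m :+ i))) refl (fromℕ m) (fromℕ i)
    b-a : b - a ≡ 1ℚ + fromℕ 2 * fromℕ i
    b-a = solve 2 (λ m i → (con 1ℚ :+ (m :+ i)) :- (m :- i) := con 1ℚ :+ con (fromℕ 2) :* i) refl (fromℕ m) (fromℕ i)
  D : ℕ → ℚ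
  D i = s * (sgn i * ((A i + B i) * odd i))
  n*D : ∀ {i} → i ℕ.< m → n * D i ≡ fromℕ 4 * s * (sgn i * odd i) - (sgn (m ∸ suc i) * A i + sgn (m ℕ.+ i) * B i)
  n*D {i} h = trans
    (solve 4 (λ n s t x → n :* (s :* (t :* x)) := s :* (t :* (n :* x))) refl n s (sgn i) ((A i + B i) * odd i))
    (trans (cong (λ z → s * (sgn i * z)) (scaled h))
      (trans (solve 5 (λ s t o A B → s :* (t :* (con (fromℕ 4) :* o :+ A :- B)) :=
                 con (fromℕ 4) :* s :* (t :* o) :- (:- (s :* t) :* A :+ (s :* t) :* B)) refl s (sgn i) (odd i) (A i) (B i))
        (cong₂ (λ x y → fromℕ 4 * s * (sgn i * odd i) - (x * A i + y * B i))
          (trans (cong -_ (sgn-A h)) (solve 1 (λ x → :- (:- x) := x) refl (sgn (m ∸ suc i)))) (sym (sgn-+ m i)))))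
  n*∑D : n * ∑[ i < m ] D (toℕ i) ≡ fromℕ 4 * (s * L) - log2 (m ℕ.+ m)
  n*∑D = begin
    n * ∑[ i < m ] D (toℕ i)
      ≡⟨ ∑-*ˡ m n (λ i → D (toℕ i)) ⟨
    ∑[ i < m ] (n * D (toℕ i))
      ≡⟨ ∑-congℕ m {λ i → n * D i} {λ i → fromℕ 4 * s * (sgn i * odd i) - (sgn (m ∸ suc i) * A i + sgn (m ℕ.+ i) * B i)} n*D ⟩
    ∑[ i < m ] (fromℕ 4 * s * (sgn (toℕ i) * odd (toℕ i)) - (sgn (m ∸ suc (toℕ i)) * A (toℕ i) + sgn (m ℕ.+ toℕ i) * B (toℕ i)))
      ≡⟨ ∑-- m (λ i → fromℕ 4 * s * (sgn (toℕ i) * odd (toℕ i))) (λ i → sgn (m ∸ suc (toℕ i)) * A (toℕ i) + sgn (m ℕ.+ toℕ i) * B (toℕ i)) ⟩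
    ∑[ i < m ] (fromℕ 4 * s * (sgn (toℕ i) * odd (toℕ i))) - ∑[ i < m ] (sgn (m ∸ suc (toℕ i)) * A (toℕ i) + sgn (m ℕ.+ toℕ i) * B (toℕ i))
      ≡⟨ cong₂ _-_
           (trans (∑-*ˡ m (fromℕ 4 * s) (λ i → sgn (toℕ i) * odd (toℕ i))) (ℚ.*-assoc (fromℕ 4) s L))
           (trans (∑-+ m (λ i → sgn (m ∸ suc (toℕ i)) * A (toℕ i)) (λ i → sgn (m ℕ.+ toℕ i) * B (toℕ i)))
             (trans (cong (_+ ∑[ i < m ] (sgn (m ℕ.+ toℕ i) * B (toℕ i))) (∑-reverse (λ i → sgn i * rec i) m))
               (sym (∑-append (λ i → sgn i * rec i) m m)))) ⟩
    fromℕ 4 * (s * L) - log2 (m ℕ.+ m) ∎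
  ∑D : ∑[ i < m ] D (toℕ i) ≡ o * (fromℕ 4 * (s * L) - log2 (m ℕ.+ m))
  ∑D = trans (sym (ℚ.*-identityˡ (∑[ i < m ] D (toℕ i)))) (trans
    (cong (_* ∑[ i < m ] D (toℕ i)) (sym (odd-inv m)))
    (trans (solve 3 (λ n o d → n :* o :* d := o :* (n :* d)) refl n o (∑[ i < m ] D (toℕ i))) (cong (o *_) n*∑D)))
  X : ℕ → ℚ
  X i = (log2 (m ℕ.+ i) - log2 (m ∸ suc i)) * odd i
  step : ∀ {i} → i ℕ.< m → (log2 (suc m ℕ.+ i) - log2 (suc m ∸ suc i)) * odd i ≡ X i + D i
  step {i} h = trans
    (cong (λ z → z * odd i) (cong₂ _-_
      (trans (log2-suc (m ℕ.+ i)) (cong (λ z → log2 (m ℕ.+ i) + z * B i) (sgn-+ m i)))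
      (trans (cong log2 (∸-split h)) (trans (log2-suc (m ∸ suc i))
        (cong (λ z → log2 (m ∸ suc i) + z * A i) (trans (solve 1 (λ x → x := :- (:- x)) refl (sgn (m ∸ suc i))) (cong -_ (sym (sgn-A h)))))))))
    (solve 7 (λ x y s t A B o → ((x :+ s :* t :* B) :- (y :+ (:- (s :* t)) :* A)) :* o :=
        (x :- y) :* o :+ s :* (t :* ((A :+ B) :* o))) refl
      (log2 (m ℕ.+ i)) (log2 (m ∸ suc i)) s (sgn i) (A i) (B i) (odd i))
  cross-suc : cross (suc m) ≡ cross m + (o * (fromℕ 4 * (s * L) - log2 (m ℕ.+ m)) + (log2 (m ℕ.+ m) + 1ℚ * o) * o)
  cross-suc = trans (∑-snoc (λ i → (log2 (suc m ℕ.+ i) - log2 (suc m ∸ suc i)) * odd i) m) (trans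
    (cong₂ _+_
      (trans (∑-congℕ m {λ i → (log2 (suc m ℕ.+ i) - log2 (suc m ∸ suc i)) * odd i} {λ i → X i + D i} step)
        (trans (∑-+ m (λ i → X (toℕ i)) (λ i → D (toℕ i))) (cong (cross m +_) ∑D)))
      (cong (_* o) (trans
        (cong₂ _-_
          (trans (log2-suc (m ℕ.+ m)) (cong₂ (λ a b → log2 (m ℕ.+ m) + a * b) (sgn-double m)
            (cong (λ z → rec (m ℕ.+ z)) (sym (ℕ.+-identityʳ m)))))
          (cong log2 (ℕ.n∸n≡0 m)))
        (solve 1 (λ x → x :- con 0ℚ := x) refl (log2 (m ℕ.+ m) + 1ℚ * o)))))
    (ℚ.+-assoc (cross m) (o * (fromℕ 4 * (s * L) - log2 (m ℕ.+ m))) ((log2 (m ℕ.+ m) + 1ℚ * o) * o)))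

-- The alternating series moves by at most 1/(m - i) between the two indices. Then 1/((m - i)(2i +
-- 1)) = (2/(2i + 1) + 1/(m - i))/(2m + 1), and summing over i gives at most three harmonic sums
-- over m + 1.
cross-≥ : ∀ m → - cross m ≤ fromℕ 3 * (harmonic m * rec m)
cross-≥ m = begin
  - cross m
    ≡⟨ ∑-neg m (λ i → (log2 (m ℕ.+ toℕ i) - log2 (m ∸ suc (toℕ i))) * odd (toℕ i)) ⟩
  ∑[ i < m ] (- ((log2 (m ℕ.+ toℕ i) - log2 (m ∸ suc (toℕ i))) * odd (toℕ i)))
    ≤⟨ ∑-monoℕ m {λ i → - ((log2 (m ℕ.+ i) - log2 (m ∸ suc i)) * odd i)} {λ i → odd m * (fromℕ 2 * odd i + A i)} term ⟩
  ∑[ i < m ] (odd m * (fromℕ 2 * odd (toℕ i) + A (toℕ i)))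
    ≡⟨ trans (∑-*ˡ m (odd m) (λ i → fromℕ 2 * odd (toℕ i) + A (toℕ i)))
         (cong (odd m *_) (trans (∑-+ m (λ i → fromℕ 2 * odd (toℕ i)) (λ i → A (toℕ i)))
           (cong₂ _+_ (∑-*ˡ m (fromℕ 2) (λ i → odd (toℕ i))) (∑-reverse rec m)))) ⟩
  odd m * (fromℕ 2 * ∑[ i < m ] odd (toℕ i) + harmonic m)
    ≤⟨ *-mono (+≥0 (*≥0 (fromℕ≥0 2) (∑≥0 m (λ i → odd (toℕ i)) λ i → rec≥0 (2 ℕ.* toℕ i))) H≥0) (rec≥0 m) (odd≤rec m)
         (ℚ.+-monoˡ-≤ (harmonic m) (*-monoˡ (fromℕ≥0 2) (∑-≤ m _ _ λ i → odd≤rec (toℕ i)))) ⟩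
  rec m * (fromℕ 2 * harmonic m + harmonic m)
    ≡⟨ solve 2 (λ r h → r :* (con (fromℕ 2) :* h :+ h) := con (fromℕ 3) :* (h :* r)) refl (rec m) (harmonic m) ⟩
  fromℕ 3 * (harmonic m * rec m) ∎
  where
  open ℚ.≤-Reasoning
  A : ℕ → ℚ
  A i = rec (m ∸ suc i)
  H≥0 : 0ℚ ≤ harmonic m
  H≥0 = blockSum≥0 0 m
  odd≤rec : ∀ i → odd i ≤ rec i
  odd≤rec i = rec-anti (ℕ.m≤m+n i (i ℕ.+ 0))
  term : ∀ {i} → i ℕ.< m → - ((log2 (m ℕ.+ i) - log2 (m ∸ suc i)) * odd i) ≤ odd m * (fromℕ 2 * odd i + A i)
  term {i} h = ≤-eq
    (solve 3 (λ x y o → :- ((x :- y) :* o) := (y :- x) :* o) refl (log2 (m ℕ.+ i)) (log2 (m ∸ suc i)) (odd i))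
    split
    (*-monoʳ (rec≥0 (2 ℕ.* i)) (subst (λ z → log2 (m ∸ suc i) - log2 z ≤ A i) (ℕ.m+[n∸m]≡n le)
      (proj₂ (alternating-near rec (decreasing rec≥0 λ j → rec-anti (ℕ.n≤1+n j)) (m ∸ suc i) (m ℕ.+ i ∸ (m ∸ suc i))))))
    where
    le : m ∸ suc i ℕ.≤ m ℕ.+ i
    le = ℕ.≤-trans (ℕ.m∸n≤m m (suc i)) (ℕ.m≤m+n m i)
    a = fromℕ m - fromℕ i
    aA : a * A i ≡ 1ℚ
    aA = trans (cong (_* A i) (trans (sym (fromℕ-∸ (ℕ.<⇒≤ h))) (cong fromℕ (∸-split h)))) (fromℕ-rec (m ∸ suc i))
    split : odd m * (fromℕ 2 * odd i + A i) ≡ A i * odd i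
    split = trans (cong₂ (λ x y → odd m * (fromℕ 2 * x + y))
        (trans (sym (ℚ.*-identityˡ (odd i))) (cong (_* odd i) (sym aA)))
        (trans (sym (ℚ.*-identityˡ (A i))) (cong (_* A i) (sym (odd-inv i)))))
      (trans (solve 5 (λ q m i o A → q :* (con (fromℕ 2) :* ((m :- i) :* A :* o) :+ ((con 1ℚ :+ con (fromℕ 2) :* i) :* o) :* A) :=
            ((con 1ℚ :+ con (fromℕ 2) :* m) :* q) :* (A :* o)) refl (odd m) (fromℕ m) (fromℕ i) (odd i) (A i))
        (trans (cong (_* (A i * odd i)) (odd-inv m)) (ℚ.*-identityˡ (A i * odd i))))

-- As K is arbitrary, harmonic m = o(m).
harmonic-≤ : ∀ K m → harmonic m ≤ fromℕ K + fromℕ m * rec K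
harmonic-≤ K zero    = +≥0 (fromℕ≥0 K) (*≥0 (fromℕ≥0 0) (rec≥0 K))
harmonic-≤ K (suc m) with ℕ.≤-<-connex K m
... | inj₁ K≤m = ≤-eq (∑-snoc rec m)
  (trans (cong (λ z → fromℕ K + z * rec K) (fromℕ-suc m))
    (solve 3 (λ k m r → k :+ (con 1ℚ :+ m) :* r := (k :+ m :* r) :+ r) refl (fromℕ K) (fromℕ m) (rec K)))
  (ℚ.+-mono-≤ (harmonic-≤ K m) (rec-anti K≤m))
... | inj₂ m<K = ℚ.≤-trans (∑-≤ (suc m) (λ i → rec (toℕ i)) (λ _ → 1ℚ) λ i → rec-anti {0} {toℕ i} z≤n)
  (ℚ.≤-trans (≤-eq (trans (∑-const (suc m) 1ℚ) (ℚ.*-identityʳ (fromℕ (suc m)))) refl (fromℕ-mono m<K))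
    (+-slack (fromℕ (suc m) * rec K) (*≥0 (fromℕ≥0 (suc m)) (rec≥0 K)) refl))

oddSquares-≤ : ∀ K m → oddSquares m ≤ fromℕ 2 * (leibniz m * leibniz m) + fromℕ 3 * (fromℕ K * rec m + rec K)
oddSquares-≤ K m = begin
  oddSquares m
    ≡⟨ solve 2 (λ a b → a := (a :+ b) :+ (:- b)) refl (oddSquares m) (cross m) ⟩
  oddSquares m + cross m - cross m
    ≤⟨ ℚ.+-mono-≤ (ℚ.≤-reflexive (sym (leibniz² m))) (cross-≥ m) ⟩
  fromℕ 2 * (leibniz m * leibniz m) + fromℕ 3 * (harmonic m * rec m)
    ≤⟨ ℚ.+-monoʳ-≤ (fromℕ 2 * (leibniz m * leibniz m)) (*-monoˡ (fromℕ≥0 3) bound) ⟩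
  fromℕ 2 * (leibniz m * leibniz m) + fromℕ 3 * (fromℕ K * rec m + rec K) ∎
  where
  open ℚ.≤-Reasoning
  bound : harmonic m * rec m ≤ fromℕ K * rec m + rec K
  bound = begin
    harmonic m * rec m                             ≤⟨ *-monoʳ (rec≥0 m) (harmonic-≤ K m) ⟩
    (fromℕ K + fromℕ m * rec K) * rec m            ≡⟨ solve 4 (λ k m r q → (k :+ m :* q) :* r := k :* r :+ q :* (m :* r)) refl (fromℕ K) (fromℕ m) (rec m) (rec K) ⟩
    fromℕ K * rec m + rec K * (fromℕ m * rec m)    ≤⟨ ℚ.+-monoʳ-≤ (fromℕ K * rec m) (*-monoˡ (rec≥0 K) (*-monoʳ (rec≥0 m) (fromℕ-mono (ℕ.n≤1+n m)))) ⟩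
    fromℕ K * rec m + rec K * (fromℕ (suc m) * rec m) ≡⟨ cong (fromℕ K * rec m +_) (trans (cong (rec K *_) (fromℕ-rec m)) (ℚ.*-identityʳ (rec K))) ⟩
    fromℕ K * rec m + rec K                        ∎

squares : ℕ → ℚ
squares m = ∑[ i < m ] (rec (toℕ i) * rec (toℕ i))

squares-suc : ∀ m → squares (suc m) ≡ squares m + rec m * rec m
squares-suc = ∑-snoc (λ i → rec i * rec i)

squares-mono : ∀ m j → squares m ≤ squares (m ℕ.+ j)
squares-mono m j = +-slack (∑[ i < j ] (rec (m ℕ.+ toℕ i) * rec (m ℕ.+ toℕ i)))
  (∑≥0 j (λ i → rec (m ℕ.+ toℕ i) * rec (m ℕ.+ toℕ i)) λ i → *≥0 (rec≥0 (m ℕ.+ toℕ i)) (rec≥0 (m ℕ.+ toℕ i)))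
  (∑-append (λ i → rec i * rec i) m j)

rec-even : ∀ m → rec (suc (2 ℕ.* m)) ≡ ½ * rec m
rec-even m = trans (cong rec (sym (ℕ.+-suc m (m ℕ.+ 0)))) (sym (rec-* 1 m))

squares-double : ∀ m → squares (2 ℕ.* m) ≡ oddSquares m + ½ * ½ * squares m
squares-double zero    = refl
squares-double (suc m) = begin
  squares (2 ℕ.* suc m)
    ≡⟨ cong squares (cong suc (ℕ.+-suc m (m ℕ.+ 0))) ⟩
  squares (suc (suc (2 ℕ.* m)))
    ≡⟨ trans (squares-suc (suc (2 ℕ.* m))) (cong₂ _+_ (squares-suc (2 ℕ.* m)) (cong (λ z → z * z) (rec-even m))) ⟩
  squares (2 ℕ.* m) + odd m * odd m + ½ * rec m * (½ * rec m)
    ≡⟨ cong (λ z → z + odd m * odd m + ½ * rec m * (½ * rec m)) (squares-double m) ⟩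
  oddSquares m + ½ * ½ * squares m + odd m * odd m + ½ * rec m * (½ * rec m)
    ≡⟨ solve 4 (λ q s o r → q :+ con ½ :* con ½ :* s :+ o :* o :+ con ½ :* r :* (con ½ :* r) :=
         (q :+ o :* o) :+ con ½ :* con ½ :* (s :+ r :* r)) refl (oddSquares m) (squares m) (odd m) (rec m) ⟩
  (oddSquares m + odd m * odd m) + ½ * ½ * (squares m + rec m * rec m)
    ≡⟨ cong₂ (λ a b → a + ½ * ½ * b) (sym (∑-snoc (λ i → odd i * odd i) m)) (sym (squares-suc m)) ⟩
  oddSquares (suc m) + ½ * ½ * squares (suc m) ∎
  where open ≡-Reasoning

⅔ : ℚ
⅔ = fromℕ 2 * rec 2

-- The even terms up to 2m carry a quarter of the sum up to m. Since doubling the range does not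
-- decrease the sum, the odd terms carry at least three quarters of it.
squares-≤ : ∀ m → squares m ≤ fromℕ 2 * ⅔ * oddSquares m
squares-≤ m = ≤-eq
  (solve 1 (λ s → s := con (fromℕ 2 * ⅔) :* (s :- con ½ :* con ½ :* s)) refl (squares m))
  (cong (fromℕ 2 * ⅔ *_) (trans (solve 2 (λ a b → a := (a :+ b) :- b) refl (oddSquares m) (½ * ½ * squares m))
    (cong (_- ½ * ½ * squares m) (sym (squares-double m)))))
  (*-monoˡ (*≥0 (fromℕ≥0 2) (*≥0 (fromℕ≥0 2) (rec≥0 2)))
    (ℚ.+-monoˡ-≤ (- (½ * ½ * squares m)) (squares-mono m (m ℕ.+ 0))))

basel : ∀ p ε → 0ℚ < ε → ∃ λ M → ∀ {m} → M ℕ.≤ m → squares p ≤ rec 5 * seq (π ^ᴿ 2) m + ε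
basel p ε 0<ε =
  let δ , 0<δ , 8δ≤ε = shrink 8 0<ε
      K , rK≤δ = below 0<δ
      η , 0<η , Kη≤δ = shrink K 0<δ
      M , rM≤η = below 0<η
  in p ℕ.⊔ M , λ {m} h → let L = leibniz m in begin
    squares p
      ≤⟨ subst (λ z → squares p ≤ squares z) (ℕ.m+[n∸m]≡n (ℕ.m⊔n≤o⇒m≤o p M h)) (squares-mono p (m ∸ p)) ⟩
    squares m
      ≤⟨ squares-≤ m ⟩
    fromℕ 2 * ⅔ * oddSquares m
      ≤⟨ *-monoˡ (*≥0 (fromℕ≥0 2) (*≥0 (fromℕ≥0 2) (rec≥0 2))) (oddSquares-≤ K m) ⟩
    fromℕ 2 * ⅔ * (fromℕ 2 * (L * L) + fromℕ 3 * (fromℕ K * rec m + rec K))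
      ≤⟨ *-monoˡ (*≥0 (fromℕ≥0 2) (*≥0 (fromℕ≥0 2) (rec≥0 2))) (ℚ.+-monoʳ-≤ (fromℕ 2 * (L * L)) (*-monoˡ (fromℕ≥0 3)
           (ℚ.+-mono-≤ (ℚ.≤-trans (*-monoˡ (fromℕ≥0 K) (ℚ.≤-trans (rec-anti (ℕ.m⊔n≤o⇒n≤o p M h)) rM≤η)) Kη≤δ) rK≤δ))) ⟩
    fromℕ 2 * ⅔ * (fromℕ 2 * (L * L) + fromℕ 3 * (δ + δ))
      -- Here 4/3 · 2L² = (4L)²/6, and 4L is the m-th entry of π; the error is 4/3 · 3 · 2δ = 8δ.
      ≡⟨ solve 2 (λ L δ → con (fromℕ 2 * ⅔) :* (con (fromℕ 2) :* (L :* L) :+ con (fromℕ 3) :* (δ :+ δ)) :=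
           con (rec 5) :* (con (fromℕ 4) :* L :* (con (fromℕ 4) :* L :* con 1ℚ)) :+ con (fromℕ 8) :* δ) refl L δ ⟩
    rec 5 * seq (π ^ᴿ 2) m + fromℕ 8 * δ
      ≤⟨ ℚ.+-monoʳ-≤ (rec 5 * seq (π ^ᴿ 2) m) 8δ≤ε ⟩
    rec 5 * seq (π ^ᴿ 2) m + ε ∎
  where open ℚ.≤-Reasoning

-- Records of permutations

lookup-∷ʳ-inject₁ : ∀ {A : Set} {n} (xs : Vec A n) {x} i → lookup (xs ∷ʳ x) (inject₁ i) ≡ lookup xs i
lookup-∷ʳ-inject₁ (_ ∷ _)  zero    = refl
lookup-∷ʳ-inject₁ (_ ∷ xs) (suc i) = lookup-∷ʳ-inject₁ xs i

lookup-∷ʳ-fromℕ : ∀ {A : Set} {n} (xs : Vec A n) {x} → lookup (xs ∷ʳ x) (Fin.fromℕ n) ≡ x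
lookup-∷ʳ-fromℕ []       = refl
lookup-∷ʳ-fromℕ (_ ∷ xs) = lookup-∷ʳ-fromℕ xs

-- Append the value v, renumbering the earlier values so as to make room for it.
extend : ∀ {n} → Vec (Fin n) n → Fin (suc n) → Vec (Fin (suc n)) (suc n)
extend σ v = Vec.map (punchIn v) σ ∷ʳ v

module _ {n} (σ : Vec (Fin n) n) (v : Fin (suc n)) where

  lookup-extend-inject₁ : ∀ i → lookup (extend σ v) (inject₁ i) ≡ punchIn v (lookup σ i)
  lookup-extend-inject₁ i = trans (lookup-∷ʳ-inject₁ (Vec.map (punchIn v) σ) i) (Vec.lookup-map i (punchIn v) σ)

  lookup-extend-fromℕ : lookup (extend σ v) (Fin.fromℕ n) ≡ v
  lookup-extend-fromℕ = lookup-∷ʳ-fromℕ (Vec.map (punchIn v) σ)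

map-injective : ∀ {A B : Set} {n} (f : A → B) → (∀ {x y} → f x ≡ f y → x ≡ y) →
                ∀ (xs ys : Vec A n) → Vec.map f xs ≡ Vec.map f ys → xs ≡ ys
map-injective f inj []       []       e = refl
map-injective f inj (x ∷ xs) (y ∷ ys) e =
  cong₂ _∷_ (inj (Vec.∷-injectiveˡ e)) (map-injective f inj xs ys (Vec.∷-injectiveʳ e))

extend-injective : ∀ {n} {σ τ : Vec (Fin n) n} {v w} → extend σ v ≡ extend τ w → σ ≡ τ × v ≡ w
extend-injective {σ = σ} {τ} {v} {w} e with Vec.∷ʳ-injective (Vec.map (punchIn v) σ) (Vec.map (punchIn w) τ) e
... | e′ , refl = map-injective (punchIn v) (Fin.punchIn-injective v _ _) σ τ e′ , refl

extend-permutation : ∀ {n} (σ : Vec (Fin n) n) v → IsPermutation σ → IsPermutation (extend σ v)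
extend-permutation {n} σ v inj {i} {j} e with view i | view j
... | ‵fromℕ     | ‵fromℕ     = refl
... | ‵fromℕ     | ‵inject₁ j = contradiction
  (trans (sym (lookup-extend-inject₁ σ v j)) (trans (sym e) (lookup-extend-fromℕ σ v))) (Fin.punchInᵢ≢i v (lookup σ j))
... | ‵inject₁ i | ‵fromℕ     = contradiction
  (trans (sym (lookup-extend-inject₁ σ v i)) (trans e (lookup-extend-fromℕ σ v))) (Fin.punchInᵢ≢i v (lookup σ i))
... | ‵inject₁ i | ‵inject₁ j = cong inject₁ (inj (Fin.punchIn-injective v _ _
  (trans (sym (lookup-extend-inject₁ σ v i)) (trans e (lookup-extend-inject₁ σ v j)))))

extend-surjective : ∀ {n} (π : Vec (Fin (suc n)) (suc n)) → IsPermutation π →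
                    ∃₂ λ σ v → IsPermutation σ × π ≡ extend σ v
extend-surjective {n} π inj with initLast π
... | xs , v , refl = σ , v , σ-inj , sym (cong (_∷ʳ v) σ-map)
  where
  v≢ : ∀ i → v ≢ lookup xs i
  v≢ i e = Fin.fromℕ≢inject₁ (inj {Fin.fromℕ n} {inject₁ i}
    (trans (lookup-∷ʳ-fromℕ xs) (trans e (sym (lookup-∷ʳ-inject₁ xs i)))))
  σ = Vec.tabulate λ i → punchOut (v≢ i)
  σ-inj : IsPermutation σ
  σ-inj {i} {j} e = Fin.inject₁-injective (inj (trans (lookup-∷ʳ-inject₁ xs i) (trans
    (Fin.punchOut-injective (v≢ i) (v≢ j)
      (trans (sym (Vec.lookup∘tabulate _ i)) (trans e (Vec.lookup∘tabulate _ j))))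
    (sym (lookup-∷ʳ-inject₁ xs j)))))
  σ-map : Vec.map (punchIn v) σ ≡ xs
  σ-map = trans (sym (Vec.tabulate-∘ (punchIn v) λ i → punchOut (v≢ i)))
    (trans (Vec.tabulate-cong λ i → Fin.punchIn-punchOut (v≢ i)) (Vec.tabulate∘lookup xs))

∈-vectors⁻ : ∀ {A : Set} n {xs : List A} (v : Vec A n) → v ∈ vectors n xs → ∀ i → lookup v i ∈ xs
∈-vectors⁻ (suc n) {xs} v h i with ∈-cartesianProductWith⁻ _∷_ xs (vectors n xs) h
∈-vectors⁻ (suc n) {xs} _ h zero    | x , w , x∈ , w∈ , refl = x∈
∈-vectors⁻ (suc n) {xs} _ h (suc i) | x , w , x∈ , w∈ , refl = ∈-vectors⁻ n w w∈ i

vectors-unique : ∀ {A : Set} n {xs : List A} → Unique xs → Unique (vectors n xs)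
vectors-unique zero    u = [] ∷ []
vectors-unique (suc n) u = Unique.cartesianProductWith⁺ _∷_ Vec.∷-injective u (vectors-unique n u)

permutations-unique : ∀ n → Unique (permutations n)
permutations-unique n = Unique.filter⁺ isPermutation? (vectors-unique n (Unique.allFin⁺ n))

∈-permutations⁺ : ∀ {n} (π : Vec (Fin n) n) → IsPermutation π → π ∈ permutations n
∈-permutations⁺ {n} π = ∈-filter⁺ isPermutation? (∈-vectors (List.allFin n) π λ i → ∈-allFin _)

∈-permutations⁻ : ∀ {n} {π : Vec (Fin n) n} → π ∈ permutations n → IsPermutation π
∈-permutations⁻ {n} h = proj₂ (∈-filter⁻ isPermutation? {xs = vectors n (List.allFin n)} h)

-- Both lists are free of duplicates and have the same members, hence agree up to order. This
-- suffices because they are only summed over.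
permutations-suc : ∀ n → permutations (suc n) ↭ cartesianProductWith extend (permutations n) (List.allFin (suc n))
permutations-suc n = ∼bag⇒↭ (unique∧set⇒bag (permutations-unique (suc n))
  (Unique.cartesianProductWith⁺ extend extend-injective (permutations-unique n) (Unique.allFin⁺ (suc n)))
  (mk⇔ to from))
  where
  to : ∀ {π} → π ∈ permutations (suc n) → π ∈ cartesianProductWith extend (permutations n) (List.allFin (suc n))
  to {π} h with extend-surjective π (∈-permutations⁻ h)
  ... | σ , v , p , refl = ∈-cartesianProductWith⁺ extend (∈-permutations⁺ σ p) (∈-allFin v)
  from : ∀ {π} → π ∈ cartesianProductWith extend (permutations n) (List.allFin (suc n)) → π ∈ permutations (suc n)
  from h with ∈-cartesianProductWith⁻ extend (permutations n) (List.allFin (suc n)) h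
  ... | σ , v , σ∈ , _ , refl = ∈-permutations⁺ (extend σ v) (extend-permutation σ v (∈-permutations⁻ σ∈))

punchIn-mono-< : ∀ {n} i {j k : Fin n} → j Fin.< k → punchIn i j Fin.< punchIn i k
punchIn-mono-< i {j} {k} j<k = ℕ.≰⇒> λ le → ℕ.<⇒≱ j<k (Fin.punchIn-cancel-≤ i k j le)

punchIn-cancel-< : ∀ {n} i {j k : Fin n} → punchIn i j Fin.< punchIn i k → j Fin.< k
punchIn-cancel-< i {j} {k} h = ℕ.≰⇒> λ le → ℕ.<⇒≱ h (Fin.punchIn-mono-≤ i k j le)

module _ {n} (σ : Vec (Fin n) n) (v : Fin (suc n)) where

  isRecord-extend-inject₁ : ∀ α → IsRecord (inject₁ α) (extend σ v) ⇔ IsRecord α σ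
  isRecord-extend-inject₁ α = mk⇔
    (λ h α′ lt → punchIn-cancel-< v (subst₂ Fin._<_ (lookup-extend-inject₁ σ v α) (lookup-extend-inject₁ σ v α′)
      (h (inject₁ α′) (subst₂ ℕ._<_ (sym (Fin.toℕ-inject₁ α′)) (sym (Fin.toℕ-inject₁ α)) lt))))
    from
    where
    from : IsRecord α σ → IsRecord (inject₁ α) (extend σ v)
    from h α′ lt with view α′
    ... | ‵fromℕ      = contradiction (subst₂ ℕ._<_ (Fin.toℕ-fromℕ n) (Fin.toℕ-inject₁ α) lt) (ℕ.<⇒≯ (toℕ< α))
    ... | ‵inject₁ α′ = subst₂ Fin._<_ (sym (lookup-extend-inject₁ σ v α)) (sym (lookup-extend-inject₁ σ v α′))
      (punchIn-mono-< v (h α′ (subst₂ ℕ._<_ (Fin.toℕ-inject₁ α′) (Fin.toℕ-inject₁ α) lt)))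

-- If the new last value v ≥ 1 were a record, then σ would miss the value 0.
isRecord-extend-fromℕ : ∀ {n} (σ : Vec (Fin n) n) → IsPermutation σ → ∀ v →
                        IsRecord (Fin.fromℕ n) (extend σ v) ⇔ v ≡ zero
isRecord-extend-fromℕ {n} σ inj v = mk⇔ (to σ inj v) from
  where
  from : v ≡ zero → IsRecord (Fin.fromℕ n) (extend σ v)
  from refl α′ lt with view α′
  ... | ‵fromℕ      = contradiction lt (ℕ.<-irrefl refl)
  ... | ‵inject₁ α′ = subst₂ Fin._<_ (sym (lookup-extend-fromℕ σ zero)) (sym (lookup-extend-inject₁ σ zero α′)) (s≤s z≤n)
  to : ∀ {n} (σ : Vec (Fin n) n) → IsPermutation σ → ∀ v → IsRecord (Fin.fromℕ n) (extend σ v) → v ≡ zero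
  to         σ inj zero    h = refl
  to {suc n} σ inj (suc v) h = contradiction (Fin.injective⇒≤ {f = λ i → punchOut (0≢ i)} λ {i} {j} e →
      inj (Fin.punchOut-injective (0≢ i) (0≢ j) e)) (ℕ.<-irrefl refl)
    where
    0≢ : ∀ i → zero ≢ lookup σ i
    0≢ i e with subst₂ Fin._<_ (lookup-extend-fromℕ σ (suc v))
      (trans (lookup-extend-inject₁ σ (suc v) i) (cong (punchIn (suc v)) (sym e)))
      (h (inject₁ i) (subst₂ ℕ._<_ (sym (Fin.toℕ-inject₁ i)) (sym (Fin.toℕ-fromℕ (suc n))) (toℕ< i)))
    ... | ()

-- Sums over lists and over tuples of permutations

∑L : ∀ {A : Set} → List A → (A → ℚ) → ℚ
∑L []       f = 0ℚ
∑L (x ∷ xs) f = f x + ∑L xs f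

∑L-cong : ∀ {A : Set} (xs : List A) {f g : A → ℚ} → (∀ {x} → x ∈ xs → f x ≡ g x) → ∑L xs f ≡ ∑L xs g
∑L-cong []       h = refl
∑L-cong (x ∷ xs) h = cong₂ _+_ (h (here refl)) (∑L-cong xs (h ∘ there))

∑L-++ : ∀ {A : Set} (xs ys : List A) f → ∑L (xs ++ ys) f ≡ ∑L xs f + ∑L ys f
∑L-++ []       ys f = sym (ℚ.+-identityˡ _)
∑L-++ (x ∷ xs) ys f = trans (cong (f x +_) (∑L-++ xs ys f)) (sym (ℚ.+-assoc (f x) _ _))

∑L-map : ∀ {A B : Set} (g : A → B) xs f → ∑L (List.map g xs) f ≡ ∑L xs (f ∘ g)
∑L-map g []       f = refl
∑L-map g (x ∷ xs) f = cong (f (g x) +_) (∑L-map g xs f)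

∑L-↭ : ∀ {A : Set} {xs ys : List A} → xs ↭ ys → ∀ f → ∑L xs f ≡ ∑L ys f
∑L-↭ ↭.refl         f = refl
∑L-↭ (↭.prep x p)   f = cong (f x +_) (∑L-↭ p f)
∑L-↭ (↭.swap x y p) f = trans (cong (λ z → f x + (f y + z)) (∑L-↭ p f))
  (solve 3 (λ a b c → a :+ (b :+ c) := b :+ (a :+ c)) refl (f x) (f y) _)
∑L-↭ (↭.trans p q)  f = trans (∑L-↭ p f) (∑L-↭ q f)

∑L-cartesianProductWith : ∀ {A B C : Set} (h : A → B → C) xs ys f →
                          ∑L (cartesianProductWith h xs ys) f ≡ ∑L xs λ x → ∑L ys λ y → f (h x y)
∑L-cartesianProductWith h []       ys f = refl
∑L-cartesianProductWith h (x ∷ xs) ys f = trans (∑L-++ (List.map (h x) ys) _ f)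
  (cong₂ _+_ (∑L-map (h x) ys f) (∑L-cartesianProductWith h xs ys f))

∑L-0 : ∀ {A : Set} (xs : List A) → ∑L xs (λ _ → 0ℚ) ≡ 0ℚ
∑L-0 []       = refl
∑L-0 (x ∷ xs) = trans (ℚ.+-identityˡ _) (∑L-0 xs)

∑L-+ : ∀ {A : Set} (xs : List A) f g → ∑L xs (λ x → f x + g x) ≡ ∑L xs f + ∑L xs g
∑L-+ []       f g = refl
∑L-+ (x ∷ xs) f g = trans (cong (f x + g x +_) (∑L-+ xs f g))
  (solve 4 (λ a b c d → (a :+ b) :+ (c :+ d) := (a :+ c) :+ (b :+ d)) refl (f x) (g x) _ _)

∑L-*ˡ : ∀ {A : Set} (xs : List A) c f → ∑L xs (λ x → c * f x) ≡ c * ∑L xs f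
∑L-*ˡ []       c f = sym (ℚ.*-zeroʳ c)
∑L-*ˡ (x ∷ xs) c f = trans (cong (c * f x +_) (∑L-*ˡ xs c f)) (sym (ℚ.*-distribˡ-+ c _ _))

∑L-swap : ∀ {A B : Set} (xs : List A) (ys : List B) (f : A → B → ℚ) →
          ∑L xs (λ x → ∑L ys (f x)) ≡ ∑L ys (λ y → ∑L xs λ x → f x y)
∑L-swap []       ys f = sym (∑L-0 ys)
∑L-swap (x ∷ xs) ys f = trans (cong (∑L ys (f x) +_) (∑L-swap xs ys f)) (sym (∑L-+ ys (f x) λ y → ∑L xs λ x → f x y))

∑L-vectors-suc : ∀ {A : Set} k (xs : List A) f →
                 ∑L (vectors (suc k) xs) f ≡ ∑L xs λ x → ∑L (vectors k xs) λ v → f (x ∷ v)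
∑L-vectors-suc k xs f = ∑L-cartesianProductWith _∷_ xs (vectors k xs) f

∑L-vectors-↭ : ∀ {A : Set} k {xs ys : List A} → xs ↭ ys → ∀ f → ∑L (vectors k xs) f ≡ ∑L (vectors k ys) f
∑L-vectors-↭ zero    p f = refl
∑L-vectors-↭ (suc k) {xs} {ys} p f = begin
  ∑L (vectors (suc k) xs) f                           ≡⟨ ∑L-vectors-suc k xs f ⟩
  ∑L xs (λ x → ∑L (vectors k xs) λ v → f (x ∷ v))     ≡⟨ ∑L-cong xs (λ {x} _ → ∑L-vectors-↭ k p (f ∘ (x ∷_))) ⟩
  ∑L xs (λ x → ∑L (vectors k ys) λ v → f (x ∷ v))     ≡⟨ ∑L-↭ p _ ⟩
  ∑L ys (λ x → ∑L (vectors k ys) λ v → f (x ∷ v))     ≡⟨ ∑L-vectors-suc k ys f ⟨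
  ∑L (vectors (suc k) ys) f                           ∎
  where open ≡-Reasoning

-- Regroups k pairs (permutation, last value) into a tuple of permutations and an independent tuple
-- of last values, so that the last position can be summed on its own.
∑L-vectors-zipWith : ∀ {A B C : Set} k (h : A → B → C) xs ys f →
  ∑L (vectors k (cartesianProductWith h xs ys)) f
    ≡ ∑L (vectors k xs) λ v → ∑L (vectors k ys) λ w → f (zipWith h v w)
∑L-vectors-zipWith zero    h xs ys f = sym (ℚ.+-identityʳ _)
∑L-vectors-zipWith (suc k) h xs ys f = begin
  ∑L (vectors (suc k) zs) f
    ≡⟨ ∑L-vectors-suc k zs f ⟩
  ∑L zs (λ z → ∑L (vectors k zs) λ u → f (z ∷ u))
    ≡⟨ ∑L-cartesianProductWith h xs ys _ ⟩
  ∑L xs (λ x → ∑L ys λ y → ∑L (vectors k zs) λ u → f (h x y ∷ u))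
    ≡⟨ ∑L-cong xs (λ {x} _ → trans
         (∑L-cong ys λ {y} _ → ∑L-vectors-zipWith k h xs ys λ u → f (h x y ∷ u))
         (∑L-swap ys (vectors k xs) λ y v → ∑L (vectors k ys) λ w → f (h x y ∷ zipWith h v w))) ⟩
  ∑L xs (λ x → ∑L (vectors k xs) λ v → ∑L ys λ y → ∑L (vectors k ys) λ w → f (h x y ∷ zipWith h v w))
    ≡⟨ ∑L-cong xs (λ {x} _ → ∑L-cong (vectors k xs) λ {v} _ →
         sym (∑L-vectors-suc k ys λ w → f (zipWith h (x ∷ v) w))) ⟩
  ∑L xs (λ x → ∑L (vectors k xs) λ v → ∑L (vectors (suc k) ys) λ w → f (zipWith h (x ∷ v) w))
    ≡⟨ ∑L-vectors-suc k xs _ ⟨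
  ∑L (vectors (suc k) xs) (λ v → ∑L (vectors (suc k) ys) λ w → f (zipWith h v w)) ∎
  where
  open ≡-Reasoning
  zs = cartesianProductWith h xs ys

∑L-tuples-suc : ∀ k n f → ∑L (tuples k (suc n)) f
  ≡ ∑L (tuples k n) λ σs → ∑L (vectors k (List.allFin (suc n))) λ vs → f (zipWith extend σs vs)
∑L-tuples-suc k n f = trans (∑L-vectors-↭ k (permutations-suc n) f)
  (∑L-vectors-zipWith k extend (permutations n) (List.allFin (suc n)) f)

-- The distribution of the weight

bit : Bool → ℕ
bit true  = 1
bit false = 0

-- 0 beyond the end
at : ∀ {m} → Vec (Fin 2) m → ℕ → ℕ
at []      _       = 0
at (c ∷ C) zero    = toℕ c
at (c ∷ C) (suc i) = at C i

at-lookup : ∀ {m} (C : Vec (Fin 2) m) β → at C (toℕ β) ≡ toℕ (lookup C β)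
at-lookup (c ∷ C) zero    = refl
at-lookup (c ∷ C) (suc β) = at-lookup C β

count-cons : ∀ {A : Set} {P : A → Set} (P? : Decidable P) {n} x (xs : Vec A n) →
             Vec.count P? (x ∷ xs) ≡ bit (does (P? x)) ℕ.+ Vec.count P? xs
count-cons P? x xs with does (P? x)
... | true  = refl
... | false = refl

count-tabulate : ∀ {A : Set} {P : A → Set} (P? : Decidable P) n (f : Fin n → A) →
                 Vec.count P? (Vec.tabulate f) ≡ ℕ∑.sum λ i → bit (does (P? (f i)))
count-tabulate P? zero    f = refl
count-tabulate P? (suc n) f = trans (count-cons P? (f zero) (Vec.tabulate (f ∘ suc)))
  (cong (bit (does (P? (f zero))) ℕ.+_) (count-tabulate P? n (f ∘ suc)))

count-zipWith : ∀ {A B C : Set} {P : A → Set} {Q : C → Set} (P? : Decidable P) (Q? : Decidable Q) (h : A → B → C) →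
                ∀ {n} (xs : Vec A n) (ys : Vec B n) → (∀ i → Q (h (lookup xs i) (lookup ys i)) ⇔ P (lookup xs i)) →
                Vec.count Q? (zipWith h xs ys) ≡ Vec.count P? xs
count-zipWith P? Q? h []       []       eq = refl
count-zipWith P? Q? h (x ∷ xs) (y ∷ ys) eq = trans (count-cons Q? (h x y) (zipWith h xs ys))
  (trans (cong₂ (λ a b → bit a ℕ.+ b) (does-⇔ (eq zero) (Q? (h x y)) (P? x)) (count-zipWith P? Q? h xs ys (eq ∘ suc)))
    (sym (count-cons P? x xs)))

count-zipWith′ : ∀ {A B C : Set} {P : B → Set} {Q : C → Set} (P? : Decidable P) (Q? : Decidable Q) (h : A → B → C) →
                ∀ {n} (xs : Vec A n) (ys : Vec B n) → (∀ i → Q (h (lookup xs i) (lookup ys i)) ⇔ P (lookup ys i)) →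
                Vec.count Q? (zipWith h xs ys) ≡ Vec.count P? ys
count-zipWith′ P? Q? h []       []       eq = refl
count-zipWith′ P? Q? h (x ∷ xs) (y ∷ ys) eq = trans (count-cons Q? (h x y) (zipWith h xs ys))
  (trans (cong₂ (λ a b → bit a ℕ.+ b) (does-⇔ (eq zero) (Q? (h x y)) (P? y)) (count-zipWith′ P? Q? h xs ys (eq ∘ suc)))
    (sym (count-cons P? y ys)))

weight-∑ : ∀ {k n} (C : Code k) (πs : Vec (Vec (Fin n) n) k) →
           weight C πs ≡ ℕ∑.sum λ α → at C (Vec.count (isRecord? α) πs)
weight-∑ {k} {n} C πs = trans (count-tabulate (inOptimizationSet? C πs) n id) (ℕ∑.sum-cong-≗ λ α →
  trans (bit-≟ (lookup C (recordCount πs α)))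
    (trans (sym (at-lookup C (recordCount πs α)))
      (cong (at C) (toℕ-fromℕ< (s≤s (Vec.count≤n (isRecord? α) πs))))))
  where
  bit-≟ : ∀ (x : Fin 2) → bit (does (x Fin.≟ suc zero)) ≡ toℕ x
  bit-≟ zero       = refl
  bit-≟ (suc zero) = refl

zeros : ∀ {n k} → Vec (Fin (suc n)) k → ℕ
zeros = Vec.count (Fin._≟ zero)

-- Renumbering keeps the order of the earlier values, so the earlier positions keep their records.
-- The last position is a record exactly where the new value is 0, so its record count is the number
-- of zeros.
weight-extend : ∀ {k n} (C : Code k) (σs : Vec (Vec (Fin n) n) k) vs → (∀ i → IsPermutation (lookup σs i)) →
                weight C (zipWith extend σs vs) ≡ weight C σs ℕ.+ at C (zeros vs)
weight-extend {k} {n} C σs vs perm = begin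
  weight C (zipWith extend σs vs)
    ≡⟨ weight-∑ C (zipWith extend σs vs) ⟩
  ℕ∑.sum (λ α → at C (Vec.count (isRecord? α) (zipWith extend σs vs)))
    ≡⟨ ℕ∑.sum-init-last (λ α → at C (Vec.count (isRecord? α) (zipWith extend σs vs))) ⟩
  ℕ∑.sum (λ α → at C (Vec.count (isRecord? (inject₁ α)) (zipWith extend σs vs)))
    ℕ.+ at C (Vec.count (isRecord? (Fin.fromℕ n)) (zipWith extend σs vs))
    ≡⟨ cong₂ ℕ._+_
         (trans
           (ℕ∑.sum-cong-≗ λ α → cong (at C) (count-zipWith (isRecord? α) (isRecord? (inject₁ α)) extend σs vs
             λ i → isRecord-extend-inject₁ (lookup σs i) (lookup vs i) α))
           (sym (weight-∑ C σs)))
         (cong (at C) (count-zipWith′ (Fin._≟ zero) (isRecord? (Fin.fromℕ n)) extend σs vs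
           λ i → isRecord-extend-fromℕ (lookup σs i) (perm i) (lookup vs i))) ⟩
  weight C σs ℕ.+ at C (zeros vs) ∎
  where open ≡-Reasoning

∑L-tabulate : ∀ {A : Set} m (h : Fin m → A) (g : A → ℚ) → ∑L (List.tabulate h) g ≡ ∑[ i < m ] g (h i)
∑L-tabulate zero    h g = refl
∑L-tabulate (suc m) h g = cong (g (h zero) +_) (∑L-tabulate m (h ∘ suc) g)

∑L-zeros-suc : ∀ k n φ → ∑L (vectors (suc k) (List.allFin (suc n))) (φ ∘ zeros)
  ≡ ∑L (vectors k (List.allFin (suc n))) (φ ∘ suc ∘ zeros) + fromℕ n * ∑L (vectors k (List.allFin (suc n))) (φ ∘ zeros)
∑L-zeros-suc k n φ = trans (∑L-vectors-suc k (List.allFin (suc n)) (φ ∘ zeros))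
  (cong (∑L V (φ ∘ suc ∘ zeros) +_)
    (trans (∑L-tabulate n suc λ x → ∑L V λ v → φ (zeros (x ∷ v))) (∑-const n (∑L V (φ ∘ zeros)))))
  where V = vectors k (List.allFin (suc n))

-- Σ_β C(k,β) φ(β) x^β, by Pascal's rule.
binomialSum : ℕ → ℚ → (ℕ → ℚ) → ℚ
binomialSum zero    x φ = φ 0
binomialSum (suc k) x φ = binomialSum k x φ + x * binomialSum k x (φ ∘ suc)

-- Among the vectors in {0,…,n}^k, C(k,β) n^(k-β) have β zero entries.
∑L-zeros : ∀ k n φ → ∑L (vectors k (List.allFin (suc (suc n)))) (φ ∘ zeros) ≡ fromℕ (suc n) ^ k * binomialSum k (rec n) φ
∑L-zeros zero    n φ = trans (ℚ.+-identityʳ (φ 0)) (sym (ℚ.*-identityˡ (φ 0)))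
∑L-zeros (suc k) n φ = begin
  ∑L (vectors (suc k) (List.allFin (suc (suc n)))) (φ ∘ zeros)
    ≡⟨ ∑L-zeros-suc k (suc n) φ ⟩
  ∑L (vectors k (List.allFin (suc (suc n)))) (φ ∘ suc ∘ zeros) + N * ∑L (vectors k (List.allFin (suc (suc n)))) (φ ∘ zeros)
    ≡⟨ cong₂ (λ a b → a + N * b) (∑L-zeros k n (φ ∘ suc)) (∑L-zeros k n φ) ⟩
  N ^ k * b + N * (N ^ k * a)
    ≡⟨ cong (_+ N * (N ^ k * a)) (trans (sym (ℚ.*-identityˡ (N ^ k * b))) (cong (_* (N ^ k * b)) (sym (fromℕ-rec n)))) ⟩
  N * rec n * (N ^ k * b) + N * (N ^ k * a)
    ≡⟨ solve 5 (λ N r p a b → N :* r :* (p :* b) :+ N :* (p :* a) := (N :* p) :* (a :+ r :* b)) refl N (rec n) (N ^ k) a b ⟩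
  N ^ suc k * binomialSum (suc k) (rec n) φ ∎
  where
  open ≡-Reasoning
  N = fromℕ (suc n)
  a = binomialSum k (rec n) φ
  b = binomialSum k (rec n) (φ ∘ suc)

-- Position 1 is a record of every permutation.
∑L-zeros₀ : ∀ k φ → ∑L (vectors k (List.allFin 1)) (φ ∘ zeros) ≡ φ k
∑L-zeros₀ zero    φ = ℚ.+-identityʳ (φ 0)
∑L-zeros₀ (suc k) φ = trans (∑L-zeros-suc k 0 φ) (trans (cong (∑L V (φ ∘ suc ∘ zeros) +_) (ℚ.*-zeroˡ (∑L V (φ ∘ zeros))))
  (trans (ℚ.+-identityʳ _) (∑L-zeros₀ k (φ ∘ suc))))
  where V = vectors k (List.allFin 1)

-- Plays the role of the generating polynomial: multiplication by x is precomposition of φ with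
-- `suc`, and extracting the coefficient of x^m is φ = `δ m`.
moment : ∀ {k} → Code k → ℕ → (ℕ → ℚ) → ℚ
moment {k} C n φ = ∑L (tuples k n) (φ ∘ weight C)

-- The number of ways to choose the last values of the k permutations so that
-- the last position lies in the optimization set.
hits misses : ∀ {k} → Code k → ℕ → ℚ
hits   {k} C n = ∑L (vectors k (List.allFin (suc n))) (λ vs → fromℕ (at C (zeros vs)))
misses {k} C n = ∑L (vectors k (List.allFin (suc n))) (λ vs → 1ℚ - fromℕ (at C (zeros vs)))

at≤1 : ∀ {m} (C : Vec (Fin 2) m) i → at C i ℕ.≤ 1
at≤1 []              i       = z≤n
at≤1 (zero ∷ C)      zero    = z≤n
at≤1 (suc zero ∷ C)  zero    = s≤s z≤n
at≤1 (c ∷ C)         (suc i) = at≤1 C i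

moment-suc : ∀ {k} (C : Code k) n φ → moment C (suc n) φ ≡ hits C n * moment C n (φ ∘ suc) + misses C n * moment C n φ
moment-suc {k} C n φ = begin
  moment C (suc n) φ
    ≡⟨ ∑L-tuples-suc k n (φ ∘ weight C) ⟩
  ∑L T (λ σs → ∑L V λ vs → φ (weight C (zipWith extend σs vs)))
    ≡⟨ ∑L-cong T (λ {σs} σs∈ → ∑L-cong V λ {vs} _ → trans
         (cong φ (weight-extend C σs vs λ i → ∈-permutations⁻ (∈-vectors⁻ k σs σs∈ i)))
         (split (weight C σs) (at C (zeros vs)) (at≤1 C (zeros vs)))) ⟩
  ∑L T (λ σs → ∑L V λ vs → φ (suc (weight C σs)) * fromℕ (at C (zeros vs)) + φ (weight C σs) * (1ℚ - fromℕ (at C (zeros vs))))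
    ≡⟨ ∑L-cong T (λ {σs} _ → trans (∑L-+ V _ _) (cong₂ _+_
         (trans (∑L-*ˡ V (φ (suc (weight C σs))) (λ vs → fromℕ (at C (zeros vs)))) (ℚ.*-comm _ (hits C n)))
         (trans (∑L-*ˡ V (φ (weight C σs)) (λ vs → 1ℚ - fromℕ (at C (zeros vs)))) (ℚ.*-comm _ (misses C n))))) ⟩
  ∑L T (λ σs → hits C n * φ (suc (weight C σs)) + misses C n * φ (weight C σs))
    ≡⟨ trans (∑L-+ T _ _) (cong₂ _+_ (∑L-*ˡ T (hits C n) _) (∑L-*ˡ T (misses C n) _)) ⟩
  hits C n * moment C n (φ ∘ suc) + misses C n * moment C n φ ∎
  where
  open ≡-Reasoning
  T = tuples k n
  V = vectors k (List.allFin (suc n))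
  -- On b = 0, 1 the value φ(w + b) is affine in b. The sum over the last values therefore sees them
  -- only through `hits` and `misses`.
  split : ∀ w b → b ℕ.≤ 1 → φ (w ℕ.+ b) ≡ φ (suc w) * fromℕ b + φ w * (1ℚ - fromℕ b)
  split w zero    h = trans (cong φ (ℕ.+-identityʳ w)) (solve 2 (λ a b → b := a :* con 0ℚ :+ b :* (con 1ℚ :- con 0ℚ)) refl (φ (suc w)) (φ w))
  split w (suc zero) h = trans (cong φ (ℕ.+-comm w 1)) (solve 2 (λ a b → a := a :* con 1ℚ :+ b :* (con 1ℚ :- con 1ℚ)) refl (φ (suc w)) (φ w))
  split w (suc (suc b)) (s≤s ())

δ : ℕ → ℕ → ℚ
δ m w = fromℕ (bit (does (w ℕ.≟ m)))

length-filter : ∀ {A : Set} {P : A → Set} (P? : Decidable P) xs →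
                fromℕ (length (filter P? xs)) ≡ ∑L xs λ x → fromℕ (bit (does (P? x)))
length-filter P? []       = refl
length-filter P? (x ∷ xs) = trans (cong fromℕ (length-filter-∷ x xs))
  (trans (fromℕ-+ (bit (does (P? x))) (length (filter P? xs)))
    (cong (fromℕ (bit (does (P? x))) +_) (length-filter P? xs)))
  where
  length-filter-∷ : ∀ x xs → length (filter P? (x ∷ xs)) ≡ bit (does (P? x)) ℕ.+ length (filter P? xs)
  length-filter-∷ x xs with does (P? x)
  ... | true  = refl
  ... | false = refl

O-moment : ∀ {k} (C : Code k) n m → fromℕ (O C n m) ≡ moment C n (δ m)
O-moment {k} C n m = length-filter (λ πs → weight C πs ℕ.≟ m) (tuples k n)

moment-cong : ∀ {k} (C : Code k) n {φ ψ : ℕ → ℚ} → (∀ w → φ w ≡ ψ w) → moment C n φ ≡ moment C n ψ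
moment-cong {k} C n h = ∑L-cong (tuples k n) λ {πs} _ → h (weight C πs)

-- The coefficient of x^m in the product over i < n of hits · x + misses.
o : ∀ {k} → Code k → ℕ → ℕ → ℚ
o C zero    zero    = 1ℚ
o C zero    (suc m) = 0ℚ
o C (suc n) zero    = misses C n * o C n zero
o C (suc n) (suc m) = hits C n * o C n m + misses C n * o C n (suc m)

O≡o : ∀ {k} (C : Code k) n m → fromℕ (O C n m) ≡ o C n m
O≡o {k} C n m = trans (O-moment C n m) (go n m)
  where
  vec0 : ∀ k (f : Vec (Vec (Fin 0) 0) k → ℚ) → (∀ v → f v ≡ f (Vec.replicate k [])) → ∑L (tuples k 0) f ≡ f (Vec.replicate k [])
  vec0 zero    f h = ℚ.+-identityʳ (f [])
  vec0 (suc k) f h = trans (∑L-vectors-suc k (permutations 0) f) (trans (ℚ.+-identityʳ (∑L (vectors k (permutations 0)) λ v → f ([] ∷ v)))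
    (vec0 k (λ v → f ([] ∷ v)) λ v → h ([] ∷ v)))
  base : ∀ φ → moment C 0 φ ≡ φ 0
  base φ = vec0 k (φ ∘ weight C) λ _ → refl
  δ-suc : ∀ m w → δ (suc m) (suc w) ≡ δ m w
  δ-suc m w = refl
  go : ∀ n m → moment C n (δ m) ≡ o C n m
  go zero    zero    = base (δ 0)
  go zero    (suc m) = base (δ (suc m))
  go (suc n) zero    = trans (moment-suc C n (δ 0)) (trans
    (cong₂ _+_ (trans (cong (hits C n *_) (trans (moment-cong C n {δ 0 ∘ suc} {λ _ → 0ℚ} λ _ → refl) (∑L-0 (tuples k n)))) (ℚ.*-zeroʳ (hits C n))) (cong (misses C n *_) (go n 0)))
    (ℚ.+-identityˡ (misses C n * o C n 0)))
  go (suc n) (suc m) = trans (moment-suc C n (δ (suc m)))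
    (cong₂ (λ a b → hits C n * a + misses C n * b) (trans (moment-cong C n (δ-suc m)) (go n m)) (go n (suc m)))

-- The recursion for O

binomialSum-∑ : ∀ k x φ → ∑[ β ≤ k ] (fromℕ (k choose toℕ β) * φ (toℕ β) * x ^ toℕ β) ≡ binomialSum k x φ
binomialSum-∑ zero    x φ = solve 1 (λ a → con 1ℚ :* a :* con 1ℚ :+ con 0ℚ := a) refl (φ 0)
binomialSum-∑ (suc k) x φ = begin
  g 0 + ∑[ i ≤ k ] (fromℕ (suc k choose suc (toℕ i)) * φ (suc (toℕ i)) * x ^ suc (toℕ i))
    ≡⟨ cong (g 0 +_) (trans (∑-cong (suc k) λ i → pascal (toℕ i)) (∑-+ (suc k) (λ i → x * h (toℕ i)) (λ i → g (suc (toℕ i))))) ⟩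
  g 0 + (∑[ i ≤ k ] (x * h (toℕ i)) + ∑[ i ≤ k ] g (suc (toℕ i)))
    ≡⟨ solve 3 (λ a b c → a :+ (b :+ c) := (a :+ c) :+ b) refl (g 0) (∑[ i ≤ k ] (x * h (toℕ i))) (∑[ i ≤ k ] g (suc (toℕ i))) ⟩
  ∑[ i ≤ suc k ] g (toℕ i) + ∑[ i ≤ k ] (x * h (toℕ i))
    ≡⟨ cong₂ _+_
         (trans (∑-snoc g (suc k)) (trans (cong (λ z → ∑[ i ≤ k ] g (toℕ i) + z) g-last) (ℚ.+-identityʳ (∑[ i ≤ k ] g (toℕ i)))))
         (∑-*ˡ (suc k) x (λ i → h (toℕ i))) ⟩
  ∑[ i ≤ k ] g (toℕ i) + x * ∑[ i ≤ k ] h (toℕ i)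
    ≡⟨ cong₂ (λ a b → a + x * b) (binomialSum-∑ k x φ) (binomialSum-∑ k x (φ ∘ suc)) ⟩
  binomialSum (suc k) x φ ∎
  where
  open ≡-Reasoning
  g h : ℕ → ℚ
  g i = fromℕ (k choose i) * φ i * x ^ i
  h i = fromℕ (k choose i) * φ (suc i) * x ^ i
  pascal : ∀ i → fromℕ (suc k choose suc i) * φ (suc i) * x ^ suc i ≡ x * h i + g (suc i)
  pascal i = trans
    (cong (λ z → z * φ (suc i) * (x * x ^ i))
      (trans (cong fromℕ (sym (nCk+nC[k+1]≡[n+1]C[k+1] k i))) (fromℕ-+ (k choose i) (k choose suc i))))
    (solve 5 (λ a b p x y → (a :+ b) :* p :* (x :* y) := x :* (a :* p :* y) :+ b :* p :* (x :* y)) refl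
      (fromℕ (k choose i)) (fromℕ (k choose suc i)) (φ (suc i)) x (x ^ i))
  g-last : g (suc k) ≡ 0ℚ
  g-last = trans (cong (λ z → fromℕ z * φ (suc k) * x ^ suc k) (k>n⇒nCk≡0 (ℕ.n<1+n k)))
    (solve 2 (λ a b → con 0ℚ :* a :* b := con 0ℚ) refl (φ (suc k)) (x ^ suc k))

binomialSum≥0 : ∀ k {x φ} → 0ℚ ≤ x → (∀ i → 0ℚ ≤ φ i) → 0ℚ ≤ binomialSum k x φ
binomialSum≥0 zero    0≤x h = h 0
binomialSum≥0 (suc k) 0≤x h = +≥0 (binomialSum≥0 k 0≤x h) (*≥0 0≤x (binomialSum≥0 k 0≤x (h ∘ suc)))

binomialSum-mono : ∀ k {x y φ} → 0ℚ ≤ x → x ≤ y → (∀ i → 0ℚ ≤ φ i) → binomialSum k x φ ≤ binomialSum k y φ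
binomialSum-mono zero    0≤x x≤y h = ℚ.≤-refl
binomialSum-mono (suc k) 0≤x x≤y h = ℚ.+-mono-≤ (binomialSum-mono k 0≤x x≤y h)
  (*-mono (binomialSum≥0 k 0≤x (h ∘ suc)) (ℚ.≤-trans 0≤x x≤y) x≤y (binomialSum-mono k 0≤x x≤y (h ∘ suc)))

-- The binomial theorem, for φ + ψ = 1.
binomialSum-+ : ∀ k x {φ ψ : ℕ → ℚ} → (∀ {i} → i ℕ.≤ k → φ i + ψ i ≡ 1ℚ) →
                binomialSum k x φ + binomialSum k x ψ ≡ (1ℚ + x) ^ k
binomialSum-+ zero    x h = h z≤n
binomialSum-+ (suc k) x {φ} {ψ} h = trans
  (solve 5 (λ a b c d x → (a :+ x :* b) :+ (c :+ x :* d) := (a :+ c) :+ x :* (b :+ d)) refl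
    (binomialSum k x φ) (binomialSum k x (φ ∘ suc)) (binomialSum k x ψ) (binomialSum k x (ψ ∘ suc)) x)
  (trans (cong₂ (λ a b → a + x * b)
    (binomialSum-+ k x {φ} {ψ} λ le → h (ℕ.≤-trans le (ℕ.n≤1+n k)))
    (binomialSum-+ k x {φ ∘ suc} {ψ ∘ suc} λ le → h (s≤s le)))
    (solve 2 (λ p x → p :+ x :* p := (con 1ℚ :+ x) :* p) refl ((1ℚ + x) ^ k) x))

-- The factors F, their products and the coefficient bound

coeff : ∀ {m} → Vec (Fin 2) m → ℕ → ℚ
coeff C i = fromℕ (at C i)

coeff≥0 : ∀ {m} (C : Vec (Fin 2) m) i → 0ℚ ≤ coeff C i
coeff≥0 C i = fromℕ≥0 (at C i)

coeff-map : ∀ {m} (C : Vec (Fin 2) m) {i} → i ℕ.< m → coeff (Vec.map opposite C) i ≡ 1ℚ - coeff C i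
coeff-map (zero ∷ C)     {zero}  h       = refl
coeff-map (suc zero ∷ C) {zero}  h       = refl
coeff-map (c ∷ C)        {suc i} (s≤s h) = coeff-map C h

module _ {k} (C : Code k) where

  coeff-′ : ∀ {i} → i ℕ.≤ k → coeff (C ′) i ≡ 1ℚ - coeff C i
  coeff-′ h = coeff-map C (s≤s h)

  -- F with index j + 2, so that the base 1/(j + 1) is defined for all j. In the recursive form,
  -- sign and monotonicity are inductions on k.
  F₊ : ℕ → ℚ
  F₊ j = binomialSum k (rec j) (coeff C)

  F≡F₊ : ∀ j → F (2 ℕ.+ j) (val C) ≡ F₊ j
  F≡F₊ j = trans
    (∑-cong (suc k) λ β → cong (λ z → fromℕ (k choose toℕ β) * fromℕ z * rec j ^ toℕ β) (sym (at-lookup C β)))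
    (binomialSum-∑ k (rec j) (coeff C))

  F₊≥0 : ∀ j → 0ℚ ≤ F₊ j
  F₊≥0 j = binomialSum≥0 k (rec≥0 j) (coeff≥0 C)

  F₊-anti : ∀ {i j} → i ℕ.≤ j → F₊ j ≤ F₊ i
  F₊-anti {i} {j} i≤j = binomialSum-mono k (rec≥0 j) (rec-anti i≤j) (coeff≥0 C)

  -- The product in O_max for C ′.
  ∏F : ℕ → ℚ
  ∏F zero    = 1ℚ
  ∏F (suc r) = ∏F r * F₊ r

  ∏F≥0 : ∀ r → 0ℚ ≤ ∏F r
  ∏F≥0 zero    = 0≤1
  ∏F≥0 (suc r) = *≥0 (∏F≥0 r) (F₊≥0 r)

  ∏≡∏F : ∀ r → ∏[ i < r ] F (2 ℕ.+ toℕ i) (val C) ≡ ∏F r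
  ∏≡∏F r = trans (sym (ℚ.*-identityˡ (∏[ i < r ] F (2 ℕ.+ toℕ i) (val C)))) (∏-shift r 0)
    where
    -- The library product takes off its first factor, `∏F` its last; the induction carries the
    -- factors already absorbed in `∏F j`.
    ∏-shift : ∀ r j → ∏F j * ∏[ i < r ] F (2 ℕ.+ (j ℕ.+ toℕ i)) (val C) ≡ ∏F (j ℕ.+ r)
    ∏-shift zero    j = trans (ℚ.*-identityʳ (∏F j)) (cong ∏F (sym (ℕ.+-identityʳ j)))
    ∏-shift (suc r) j = trans
      (cong₂ (λ a b → ∏F j * (F (2 ℕ.+ a) (val C) * b)) (ℕ.+-identityʳ j)
        (∏-cong r λ i → cong (λ a → F (2 ℕ.+ a) (val C)) (ℕ.+-suc j (toℕ i))))
      (trans (cong (λ a → ∏F j * (a * ∏[ i < r ] F (2 ℕ.+ (suc j ℕ.+ toℕ i)) (val C))) (F≡F₊ j))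
        (trans (sym (ℚ.*-assoc (∏F j) (F₊ j) (∏[ i < r ] F (2 ℕ.+ (suc j ℕ.+ toℕ i)) (val C))))
          (trans (∏-shift r (suc j)) (cong ∏F (sym (ℕ.+-suc j r))))))
      where
      ∏-cong : ∀ n {a b : Fin n → ℚ} → (∀ i → a i ≡ b i) → ∏-syntax n a ≡ ∏-syntax n b
      ∏-cong zero    h = refl
      ∏-cong (suc n) h = cong₂ _*_ (h zero) (∏-cong n (h ∘ suc))

  -- H_n(C) for n = p + 1.
  ∑F : ℕ → ℚ
  ∑F zero    = 0ℚ
  ∑F (suc p) = ∑F p + F₊ p

  ∑F≥0 : ∀ p → 0ℚ ≤ ∑F p
  ∑F≥0 zero    = ℚ.≤-refl
  ∑F≥0 (suc p) = +≥0 (∑F≥0 p) (F₊≥0 p)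

  𝐇≡∑F : ∀ p → 𝐇 (suc p) (val C) ≡ ∑F p
  𝐇≡∑F zero = trans (∑-cong (suc k) λ β → ℚ.*-zeroʳ (val C β * fromℕ (k choose toℕ β)))
    (trans (∑-const (suc k) 0ℚ) (ℚ.*-zeroʳ (fromℕ (suc k))))
  𝐇≡∑F (suc p) = trans
    (∑-cong (suc k) λ β → trans
      (cong (val C β * fromℕ (k choose toℕ β) *_) (∑-snoc (λ i → rec i ^ toℕ β) p))
      (trans (ℚ.*-distribˡ-+ (val C β * fromℕ (k choose toℕ β)) (∑[ i < p ] (rec (toℕ i) ^ toℕ β)) (rec p ^ toℕ β))
        (cong (λ z → val C β * fromℕ (k choose toℕ β) * ∑[ i < p ] (rec (toℕ i) ^ toℕ β) + z * rec p ^ toℕ β)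
          (ℚ.*-comm (val C β) (fromℕ (k choose toℕ β))))))
    (trans (∑-+ (suc k) (λ β → val C β * fromℕ (k choose toℕ β) * ∑[ i < p ] (rec (toℕ i) ^ toℕ β))
        (λ β → fromℕ (k choose toℕ β) * val C β * rec p ^ toℕ β))
      (cong₂ _+_ (𝐇≡∑F p) (F≡F₊ p)))

  hits-suc : ∀ j → hits C (suc j) ≡ fromℕ (suc j) ^ k * F₊ j
  hits-suc j = ∑L-zeros k j (coeff C)

  hits₀ : hits C 0 ≡ coeff C k
  hits₀ = ∑L-zeros₀ k (coeff C)

  misses-hits : ∀ n → misses C n ≡ hits (C ′) n
  misses-hits n = ∑L-cong (vectors k (List.allFin (suc n))) λ {vs} _ →
    sym (coeff-′ (Vec.count≤n (Fin._≟ zero) vs))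

  hits-misses : ∀ n → hits C n ≡ misses (C ′) n
  hits-misses n = ∑L-cong (vectors k (List.allFin (suc n))) λ {vs} _ → trans
    (solve 1 (λ a → a := con 1ℚ :- (con 1ℚ :- a)) refl (coeff C (zeros vs)))
    (cong (λ z → 1ℚ - z) (sym (coeff-′ (Vec.count≤n (Fin._≟ zero) vs))))

  hits+misses : ∀ n → hits C n + misses C n ≡ fromℕ (suc n) ^ k
  hits+misses n = trans (sym (∑L-+ V (λ vs → coeff C (zeros vs)) (λ vs → 1ℚ - coeff C (zeros vs)))) (trans
    (∑L-cong V λ {vs} _ → solve 1 (λ a → a :+ (con 1ℚ :- a) := con 1ℚ) refl (coeff C (zeros vs)))
    (ones k))
    where
    V = vectors k (List.allFin (suc n))
    ones : ∀ k → ∑L (vectors k (List.allFin (suc n))) (λ _ → 1ℚ) ≡ fromℕ (suc n) ^ k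
    ones zero    = refl
    ones (suc k) = trans (∑L-vectors-suc k (List.allFin (suc n)) (λ _ → 1ℚ)) (trans
      (∑L-cong (List.allFin (suc n)) λ _ → ones k)
      (trans (∑L-tabulate (suc n) id (λ _ → fromℕ (suc n) ^ k)) (∑-const (suc n) (fromℕ (suc n) ^ k))))

  o-zero : ∀ n j → o C n (j ℕ.+ suc n) ≡ 0ℚ
  o-zero zero    zero    = refl
  o-zero zero    (suc j) = refl
  o-zero (suc n) zero    = trans (cong₂ (λ a b → hits C n * a + misses C n * b) (o-zero n 0) (o-zero n 1))
    (solve 2 (λ a b → a :* con 0ℚ :+ b :* con 0ℚ := con 0ℚ) refl (hits C n) (misses C n))
  o-zero (suc n) (suc j) = trans (cong₂ (λ a b → hits C n * a + misses C n * b)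
    (trans (cong (o C n) (ℕ.+-suc j (suc n))) (o-zero n (suc j)))
    (trans (cong (o C n ∘ suc) (ℕ.+-suc j (suc n))) (o-zero n (suc (suc j)))))
    (solve 2 (λ a b → a :* con 0ℚ :+ b :* con 0ℚ := con 0ℚ) refl (hits C n) (misses C n))

  o-total : ∀ n → ∑[ m ≤ n ] o C n (toℕ m) ≡ fromℕ (n !) ^ k
  o-total zero    = sym (1^≡1 k)
  o-total (suc n) = begin
    B * o C n 0 + ∑[ m ≤ n ] (A * o C n (toℕ m) + B * o C n (suc (toℕ m)))
      ≡⟨ cong (B * o C n 0 +_) (trans (∑-+ (suc n) (λ m → A * o C n (toℕ m)) (λ m → B * o C n (suc (toℕ m))))
           (cong₂ _+_ (∑-*ˡ (suc n) A (λ m → o C n (toℕ m))) (∑-*ˡ (suc n) B (λ m → o C n (suc (toℕ m)))))) ⟩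
    B * o C n 0 + (A * S + B * ∑[ m ≤ n ] o C n (suc (toℕ m)))
      ≡⟨ solve 5 (λ b o a s t → b :* o :+ (a :* s :+ b :* t) := a :* s :+ b :* (o :+ t)) refl
           B (o C n 0) A S (∑[ m ≤ n ] o C n (suc (toℕ m))) ⟩
    A * S + B * ∑[ m ≤ suc n ] o C n (toℕ m)
      ≡⟨ cong (λ z → A * S + B * z) (trans (∑-snoc (o C n) (suc n))
           (trans (cong (S +_) (o-zero n 0)) (ℚ.+-identityʳ S))) ⟩
    A * S + B * S
      ≡⟨ trans (sym (ℚ.*-distribʳ-+ S A B)) (cong₂ _*_ (hits+misses n) (o-total n)) ⟩
    fromℕ (suc n) ^ k * fromℕ (n !) ^ k
      ≡⟨ trans (sym (*-^ (fromℕ (suc n)) (fromℕ (n !)) k)) (cong (_^ k) (sym (fromℕ-* (suc n) (n !)))) ⟩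
    fromℕ (suc n !) ^ k ∎
    where
    open ≡-Reasoning
    A = hits C n
    B = misses C n
    S = ∑[ m ≤ n ] o C n (toℕ m)

  O-total : ∀ n → ∑[ m ≤ n ] fromℕ (O C n (toℕ m)) ≡ fromℕ (n !) ^ k
  O-total n = trans (∑-cong (suc n) λ m → O≡o C n (toℕ m)) (o-total n)

F₊+F₊′ : ∀ {k} (C : Code k) j → F₊ C j + F₊ (C ′) j ≡ (1ℚ + rec j) ^ k
F₊+F₊′ {k} C j = binomialSum-+ k (rec j) {coeff C} {coeff (C ′)} λ {i} le → trans (cong (coeff C i +_) (coeff-′ C le))
  (solve 1 (λ a → a :+ (con 1ℚ :- a) := con 1ℚ) refl (coeff C i))

-- Complementing the code complements the optimization set.
o-complement : ∀ {k} (C : Code k) a b → o C (a ℕ.+ b) a ≡ o (C ′) (a ℕ.+ b) b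
o-complement C zero    zero    = refl
o-complement C zero    (suc b) = trans (cong₂ _*_ (misses-hits C b) (o-complement C zero b))
  (sym (trans (cong (λ z → hits (C ′) b * o (C ′) b b + misses (C ′) b * z) (o-zero (C ′) b 0))
    (solve 2 (λ a b → a :+ b :* con 0ℚ := a) refl (hits (C ′) b * o (C ′) b b) (misses (C ′) b))))
o-complement C (suc a) zero    = trans (cong₂ _+_
    (cong₂ _*_ (hits-misses C (a ℕ.+ 0)) (o-complement C a zero))
    (trans (cong (λ z → misses C (a ℕ.+ 0) * o C (a ℕ.+ 0) (suc z)) (sym (ℕ.+-identityʳ a)))
      (trans (cong (misses C (a ℕ.+ 0) *_) (o-zero C (a ℕ.+ 0) 0)) (ℚ.*-zeroʳ (misses C (a ℕ.+ 0))))))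
  (ℚ.+-identityʳ (misses (C ′) (a ℕ.+ 0) * o (C ′) (a ℕ.+ 0) 0))
o-complement C (suc a) (suc b) = trans (ℚ.+-comm (hits C N * o C N a) (misses C N * o C N (suc a)))
  (cong₂ _+_
    (cong₂ _*_ (misses-hits C N) (subst (λ n → o C n (suc a) ≡ o (C ′) n b) (sym (ℕ.+-suc a b)) (o-complement C (suc a) b)))
    (cong₂ _*_ (hits-misses C N) (o-complement C a (suc b))))
  where N = a ℕ.+ suc b

-- The coefficient of x^s in ∏_{j<p} (F₊ C j · x + F₊ (C ′) j).
coefficient : ∀ {k} → Code k → ℕ → ℕ → ℚ
coefficient C zero    zero    = 1ℚ
coefficient C zero    (suc s) = 0ℚ
coefficient C (suc p) zero    = F₊ (C ′) p * coefficient C p zero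
coefficient C (suc p) (suc s) = F₊ C p * coefficient C p s + F₊ (C ′) p * coefficient C p (suc s)

module _ {k} (C : Code k) where

  coefficient-zero : ∀ p j → coefficient C p (j ℕ.+ suc p) ≡ 0ℚ
  coefficient-zero zero    zero    = refl
  coefficient-zero zero    (suc j) = refl
  coefficient-zero (suc p) zero    = trans (cong₂ (λ a b → F₊ C p * a + F₊ (C ′) p * b) (coefficient-zero p 0) (coefficient-zero p 1))
    (solve 2 (λ a b → a :* con 0ℚ :+ b :* con 0ℚ := con 0ℚ) refl (F₊ C p) (F₊ (C ′) p))
  coefficient-zero (suc p) (suc j) = trans (cong₂ (λ a b → F₊ C p * a + F₊ (C ′) p * b)
    (trans (cong (coefficient C p) (ℕ.+-suc j (suc p))) (coefficient-zero p (suc j)))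
    (trans (cong (coefficient C p ∘ suc) (ℕ.+-suc j (suc p))) (coefficient-zero p (suc (suc j)))))
    (solve 2 (λ a b → a :* con 0ℚ :+ b :* con 0ℚ := con 0ℚ) refl (F₊ C p) (F₊ (C ′) p))

  -- Consider the last factor, of index q = s + r. A miss there contributes F(C′) at q, at most its
  -- value at r - 1, which is the last factor of `∏F (C ′) r`; for r = 0 the coefficient lies beyond
  -- the degree and vanishes. A hit contributes f · h^s/s! with f = F(C) at q, and h^(s+1)/(s+1)! +
  -- f · h^s/s! is the beginning of the expansion of (h + f)^(s+1)/(s+1)!.
  coefficient-≤ : ∀ s r → coefficient C (s ℕ.+ r) s ≤ t s (∑F C (s ℕ.+ r)) * ∏F (C ′) r
  coefficient-≤ zero    zero    = ℚ.≤-refl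
  coefficient-≤ zero    (suc r) = ≤-eq (ℚ.*-comm (F₊ (C ′) r) (coefficient C r zero)) (sym (ℚ.*-assoc 1ℚ (∏F (C ′) r) (F₊ (C ′) r)))
    (*-monoʳ (F₊≥0 (C ′) r) (coefficient-≤ zero r))
  coefficient-≤ (suc s) r = begin
    F₊ C q * coefficient C q s + F₊ (C ′) q * coefficient C q (suc s)
      ≤⟨ ℚ.+-mono-≤ (*-monoˡ (F₊≥0 C q) (coefficient-≤ s r)) (second r refl) ⟩
    F₊ C q * (t s (∑F C q) * ∏F (C ′) r) + t (suc s) (∑F C q) * ∏F (C ′) r
      ≡⟨ solve 4 (λ f x y p → f :* (x :* p) :+ y :* p := (y :+ f :* x) :* p) refl
           (F₊ C q) (t s (∑F C q)) (t (suc s) (∑F C q)) (∏F (C ′) r) ⟩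
    (t (suc s) (∑F C q) + F₊ C q * t s (∑F C q)) * ∏F (C ′) r
      ≤⟨ *-monoʳ (∏F≥0 (C ′) r) (t-superadditive s (∑F≥0 C q) (F₊≥0 C q)) ⟩
    t (suc s) (∑F C q + F₊ C q) * ∏F (C ′) r ∎
    where
    open ℚ.≤-Reasoning
    q = s ℕ.+ r
    t-superadditive : ∀ s {x y} → 0ℚ ≤ x → 0ℚ ≤ y → t (suc s) x + y * t s x ≤ t (suc s) (x + y)
    t-superadditive s {x} {y} 0≤x 0≤y = ≤-eq
      (solve 3 (λ a y b → a :+ y :* b := con 1ℚ :* con 1ℚ :* a :+ y :* con 1ℚ :* con 1ℚ :* b) refl (t (suc s) x) y (t s x))
      (trans (cong (t (suc s)) (ℚ.+-comm x y)) (sym (conv-t (suc s) y x)))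
      (ℚ.+-monoʳ-≤ (1ℚ * 1ℚ * t (suc s) x) (+-slack (∑[ i < s ] (t (suc (suc (toℕ i))) y * t (suc s ∸ suc (suc (toℕ i))) x))
        (∑≥0 s (λ i → t (suc (suc (toℕ i))) y * t (suc s ∸ suc (suc (toℕ i))) x)
          λ i → *≥0 (t≥0 0≤y (suc (suc (toℕ i)))) (t≥0 0≤x (suc s ∸ suc (suc (toℕ i)))))
        refl))
    second : ∀ r′ → r ≡ r′ → F₊ (C ′) q * coefficient C q (suc s) ≤ t (suc s) (∑F C q) * ∏F (C ′) r
    second zero refl = ≤-eq
      (trans (cong (λ z → F₊ (C ′) q * coefficient C q (suc z)) (sym (ℕ.+-identityʳ s)))
        (trans (cong (F₊ (C ′) q *_) (coefficient-zero q 0)) (ℚ.*-zeroʳ (F₊ (C ′) q))))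
      refl (*≥0 (t≥0 (∑F≥0 C q) (suc s)) (∏F≥0 (C ′) r))
    second (suc r′) refl = ≤-eq refl
      (trans (cong (t (suc s) (∑F C q) *_) (ℚ.*-comm (∏F (C ′) r′) (F₊ (C ′) r′)))
        (solve 3 (λ a b c → a :* (b :* c) := b :* (a :* c)) refl (t (suc s) (∑F C q)) (F₊ (C ′) r′) (∏F (C ′) r′)))
      (*-mono (coefficient≥0 q (suc s)) (F₊≥0 (C ′) r′)
        (F₊-anti (C ′) (ℕ.≤-trans (ℕ.n≤1+n r′) (ℕ.m≤n+m (suc r′) s)))
        (subst (λ z → coefficient C z (suc s) ≤ t (suc s) (∑F C z) * ∏F (C ′) r′) (sym (ℕ.+-suc s r′)) (coefficient-≤ (suc s) r′)))
      where
      coefficient≥0 : ∀ p s → 0ℚ ≤ coefficient C p s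
      coefficient≥0 zero    zero    = 0≤1
      coefficient≥0 zero    (suc s) = ℚ.≤-refl
      coefficient≥0 (suc p) zero    = *≥0 (F₊≥0 (C ′) p) (coefficient≥0 p zero)
      coefficient≥0 (suc p) (suc s) = +≥0 (*≥0 (F₊≥0 C p) (coefficient≥0 p s)) (*≥0 (F₊≥0 (C ′) p) (coefficient≥0 p (suc s)))

-- The bound O_max

÷-! : ∀ a j → ((ℤ.+ a) / (j !)) {{j !≢0}} ≡ fromℕ a * rec! j
÷-! a j = go (j !) {{j !≢0}}
  where
  go : ∀ n .{{_ : ℕ.NonZero n}} → (ℤ.+ a) / n ≡ fromℕ a * ((ℤ.+ 1) / n)
  go (suc n) = /≡*rec a n

module _ {k} (C : Code k) where

  -- V p j is O_max at the argument whose paper index is m = j + 1, for n = p + 1.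
  V : ℕ → ℕ → ℚ
  V p j = fromℕ (p !) ^ k * (t j (∑F C p) * ∏F (C ′) (p ∸ j))

  at-last : ∀ {m} (C : Vec (Fin 2) (suc m)) → at C m ≡ toℕ (last C)
  at-last {zero}  (c ∷ [])    = refl
  at-last {suc m} (c ∷ C)     = at-last C

  abstract
    -- `Omax` as a function of the index m in the closed formula, before the shift by c_k - 1. It is
    -- opaque and enters later proofs only through the equations that follow.
    OmaxAt : ℕ → ℕ → ℚ
    OmaxAt n m =
      if does ((1 ℕ.≤? m) ×-dec (m ℕ.≤? n))
      then ((ℤ.+ (((n ∸ 1) !) ℕ.^ k)) / (m ∸ 1) !) {{(m ∸ 1) !≢0}}
             * 𝐇 n (val C) ^ (m ∸ 1)
             * ∏[ i < n ∸ m ] F (2 ℕ.+ toℕ i) (val (C ′))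
      else 0ℚ

    OmaxAt-suc : ∀ {p j} → j ℕ.≤ p → OmaxAt (suc p) (suc j) ≡ V p j
    OmaxAt-suc {p} {j} j≤p = trans in-range
      (trans (cong₂ _*_ (cong₂ _*_
          (trans (÷-! ((p !) ℕ.^ k) j) (cong (_* rec! j) (fromℕ-^ (p !) k)))
          (cong (_^ j) (𝐇≡∑F C p)))
        (∏≡∏F (C ′) (p ∸ j)))
        (solve 4 (λ a b c d → a :* b :* c :* d := a :* (c :* b :* d)) refl
          (fromℕ (p !) ^ k) (rec! j) (∑F C p ^ j) (∏F (C ′) (p ∸ j))))
      where
      X : ℚ
      X = ((ℤ.+ ((p !) ℕ.^ k)) / (j !)) {{j !≢0}} * 𝐇 (suc p) (val C) ^ j * ∏[ i < p ∸ j ] F (2 ℕ.+ toℕ i) (val (C ′))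
      if-X : Bool → ℚ
      if-X b = if b then X else 0ℚ
      in-range : OmaxAt (suc p) (suc j) ≡ X
      in-range = cong if-X (dec-true ((1 ℕ.≤? suc j) ×-dec (suc j ℕ.≤? suc p)) (s≤s z≤n , s≤s j≤p))

    OmaxAt-> : ∀ n m → n ℕ.< m → OmaxAt n m ≡ 0ℚ
    OmaxAt-> n m n<m = cong if-X (dec-false ((1 ℕ.≤? m) ×-dec (m ℕ.≤? n)) λ (_ , m≤n) → ℕ.<⇒≱ n<m m≤n)
      where
      if-X : Bool → ℚ
      if-X b = if b
        then ((ℤ.+ (((n ∸ 1) !) ℕ.^ k)) / (m ∸ 1) !) {{(m ∸ 1) !≢0}}
               * 𝐇 n (val C) ^ (m ∸ 1)
               * ∏[ i < n ∸ m ] F (2 ℕ.+ toℕ i) (val (C ′))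
        else 0ℚ

    OmaxAt-0 : ∀ n → OmaxAt n 0 ≡ 0ℚ
    OmaxAt-0 n = refl

    Omax-at : ∀ n s → Omax C n s ≡ OmaxAt n (suc s ∸ at C k)
    Omax-at n s = cong (λ c → OmaxAt n (suc s ∸ c)) (sym (at-last C))

  data Last : Set where
    last0 : at C k ≡ 0 → Last
    last1 : at C k ≡ 1 → Last

  last? : Last
  last? with at C k in eq | at≤1 C k
  ... | zero        | _ = last0 eq
  ... | suc zero    | _ = last1 eq
  ... | suc (suc _) | s≤s ()

  Omax-0 : ∀ {p j} → at C k ≡ 0 → j ℕ.≤ p → Omax C (suc p) j ≡ V p j
  Omax-0 {p} {j} e j≤p = trans (Omax-at (suc p) j) (trans (cong (λ c → OmaxAt (suc p) (suc j ∸ c)) e) (OmaxAt-suc j≤p))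

  Omax-0-> : ∀ p → at C k ≡ 0 → Omax C (suc p) (suc p) ≡ 0ℚ
  Omax-0-> p e = trans (Omax-at (suc p) (suc p)) (trans (cong (λ c → OmaxAt (suc p) (suc (suc p) ∸ c)) e)
    (OmaxAt-> (suc p) (suc (suc p)) (ℕ.n<1+n (suc p))))

  Omax-1 : ∀ {p j} → at C k ≡ 1 → j ℕ.≤ p → Omax C (suc p) (suc j) ≡ V p j
  Omax-1 {p} {j} e j≤p = trans (Omax-at (suc p) (suc j)) (trans (cong (λ c → OmaxAt (suc p) (suc (suc j) ∸ c)) e) (OmaxAt-suc j≤p))

  Omax-1-0 : ∀ n → at C k ≡ 1 → Omax C n 0 ≡ 0ℚ
  Omax-1-0 n e = trans (Omax-at n 0) (trans (cong (λ c → OmaxAt n (1 ∸ c)) e) (OmaxAt-0 n))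

  -- Among the n + 1 arguments exactly one falls outside 1 ≤ m ≤ n: the last one if c_k = 0, where m
  -- = n + 1, and the first one if c_k = 1, where m = 0.
  Omax-total : ∀ p → ∑[ m ≤ suc p ] Omax C (suc p) (toℕ m) ≡ ∑[ j < suc p ] V p (toℕ j)
  Omax-total p = go last?
    where
    go : Last → ∑[ m ≤ suc p ] Omax C (suc p) (toℕ m) ≡ ∑[ j < suc p ] V p (toℕ j)
    go (last0 e) = trans (∑-snoc (Omax C (suc p)) (suc p)) (trans
      (cong₂ _+_ (∑-congℕ (suc p) {Omax C (suc p)} {V p} λ h → Omax-0 e (s≤s⁻¹ h)) (Omax-0-> p e))
      (ℚ.+-identityʳ (∑[ j < suc p ] V p (toℕ j))))
    go (last1 e) = trans
      (cong₂ _+_ (Omax-1-0 (suc p) e) (∑-congℕ (suc p) {Omax C (suc p) ∘ suc} {V p} λ h → Omax-1 e (s≤s⁻¹ h)))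
      (ℚ.+-identityˡ (∑[ j < suc p ] V p (toℕ j)))

  private
    scale : ∀ p → fromℕ (suc p) ^ k * fromℕ (p !) ^ k ≡ fromℕ (suc p !) ^ k
    scale p = trans (sym (*-^ (fromℕ (suc p)) (fromℕ (p !)) k)) (cong (_^ k) (sym (fromℕ-* (suc p) (p !))))

    1! : 1ℚ ≡ fromℕ (0 !) ^ k
    1! = sym (1^≡1 k)

    misses-suc : ∀ p → misses C (suc p) ≡ fromℕ (suc p) ^ k * F₊ (C ′) p
    misses-suc p = trans (misses-hits C (suc p)) (hits-suc (C ′) p)

    scale-F₊ : ∀ p g x → fromℕ (suc p) ^ k * g * (fromℕ (p !) ^ k * x) ≡ fromℕ (suc p !) ^ k * (g * x)
    scale-F₊ p g x = trans
      (solve 4 (λ a b c d → a :* b :* (c :* d) := a :* c :* (b :* d)) refl (fromℕ (suc p) ^ k) g (fromℕ (p !) ^ k) x)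
      (cong (_* (g * x)) (scale p))

  -- Position 1 is a record of all k permutations, so its factor is c_k x + (1 - c_k), here equal to
  -- 1. In `o-1` it is x, which explains the shift of the argument there and in `Omax`.
  o-0 : ∀ p s → at C k ≡ 0 → o C (suc p) s ≡ fromℕ (p !) ^ k * coefficient C p s
  o-0 zero zero    e = trans (ℚ.*-identityʳ (misses C 0)) (trans
    (trans (misses-hits C 0) (trans (hits₀ (C ′)) (trans (coeff-′ C ℕ.≤-refl) (cong (λ c → 1ℚ - fromℕ c) e))))
    (trans 1! (sym (ℚ.*-identityʳ (fromℕ (0 !) ^ k)))))
  o-0 zero (suc s) e = trans (cong (λ z → z * o C 0 s + misses C 0 * 0ℚ) (trans (hits₀ C) (cong fromℕ e)))
    (solve 3 (λ a b c → con 0ℚ :* a :+ b :* con 0ℚ := c :* con 0ℚ) refl (o C 0 s) (misses C 0) (fromℕ (0 !) ^ k))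
  o-0 (suc p) zero e = trans (cong₂ _*_ (misses-suc p) (o-0 p zero e)) (scale-F₊ p (F₊ (C ′) p) (coefficient C p zero))
  o-0 (suc p) (suc s) e = trans
    (cong₂ _+_
      (trans (cong₂ _*_ (hits-suc C p) (o-0 p s e)) (scale-F₊ p (F₊ C p) (coefficient C p s)))
      (trans (cong₂ _*_ (misses-suc p) (o-0 p (suc s) e)) (scale-F₊ p (F₊ (C ′) p) (coefficient C p (suc s)))))
    (sym (ℚ.*-distribˡ-+ (fromℕ (suc p !) ^ k) (F₊ C p * coefficient C p s) (F₊ (C ′) p * coefficient C p (suc s))))

  o-1-0 : ∀ p → at C k ≡ 1 → o C (suc p) 0 ≡ 0ℚ
  o-1-0 zero    e = trans (ℚ.*-identityʳ (misses C 0))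
    (trans (misses-hits C 0) (trans (hits₀ (C ′)) (trans (coeff-′ C ℕ.≤-refl) (cong (λ c → 1ℚ - fromℕ c) e))))
  o-1-0 (suc p) e = trans (cong (misses C (suc p) *_) (o-1-0 p e)) (ℚ.*-zeroʳ (misses C (suc p)))

  o-1 : ∀ p s → at C k ≡ 1 → o C (suc p) (suc s) ≡ fromℕ (p !) ^ k * coefficient C p s
  o-1 zero zero    e = trans (cong (λ z → z * 1ℚ + misses C 0 * 0ℚ) (trans (hits₀ C) (cong fromℕ e)))
    (trans (cong (1ℚ * 1ℚ +_) (ℚ.*-zeroʳ (misses C 0))) (trans 1! (sym (ℚ.*-identityʳ (fromℕ (0 !) ^ k)))))
  o-1 zero (suc s) e = solve 3 (λ a b c → a :* con 0ℚ :+ b :* con 0ℚ := c :* con 0ℚ) refl (hits C 0) (misses C 0) (fromℕ (0 !) ^ k)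
  o-1 (suc p) zero e = trans
    (cong₂ _+_
      (trans (cong (hits C (suc p) *_) (o-1-0 p e)) (ℚ.*-zeroʳ (hits C (suc p))))
      (trans (cong₂ _*_ (misses-suc p) (o-1 p zero e)) (scale-F₊ p (F₊ (C ′) p) (coefficient C p zero))))
    (ℚ.+-identityˡ (fromℕ (suc p !) ^ k * (F₊ (C ′) p * coefficient C p zero)))
  o-1 (suc p) (suc s) e = trans
    (cong₂ _+_
      (trans (cong₂ _*_ (hits-suc C p) (o-1 p s e)) (scale-F₊ p (F₊ C p) (coefficient C p s)))
      (trans (cong₂ _*_ (misses-suc p) (o-1 p (suc s) e)) (scale-F₊ p (F₊ (C ′) p) (coefficient C p (suc s)))))
    (sym (ℚ.*-distribˡ-+ (fromℕ (suc p !) ^ k) (F₊ C p * coefficient C p s) (F₊ (C ′) p * coefficient C p (suc s))))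

  coefficient≤V : ∀ {p j} → j ℕ.≤ p → fromℕ (p !) ^ k * coefficient C p j ≤ V p j
  coefficient≤V {p} {j} j≤p = *-monoˡ (^≥0 (fromℕ≥0 (p !)) k)
    (subst (λ q → coefficient C q j ≤ t j (∑F C q) * ∏F (C ′) (p ∸ j)) (ℕ.m+[n∸m]≡n j≤p) (coefficient-≤ C j (p ∸ j)))

  o≤Omax : ∀ p s → s ℕ.≤ suc p → o C (suc p) s ≤ Omax C (suc p) s
  o≤Omax p s s≤ = go last? s s≤ (ℕ.m≤n⇒m<n∨m≡n s≤)
    where
    go : Last → ∀ s → s ℕ.≤ suc p → s ℕ.< suc p ⊎ s ≡ suc p → o C (suc p) s ≤ Omax C (suc p) s
    go (last0 e) s       _        (inj₁ s<)   = ≤-eq (o-0 p s e) (Omax-0 e (s≤s⁻¹ s<)) (coefficient≤V (s≤s⁻¹ s<))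
    go (last0 e) s       _        (inj₂ refl) = ℚ.≤-reflexive (trans (trans (o-0 p (suc p) e)
      (trans (cong (fromℕ (p !) ^ k *_) (coefficient-zero C p 0)) (ℚ.*-zeroʳ (fromℕ (p !) ^ k)))) (sym (Omax-0-> p e)))
    go (last1 e) zero    _        _           = ℚ.≤-reflexive (trans (o-1-0 p e) (sym (Omax-1-0 (suc p) e)))
    go (last1 e) (suc j) (s≤s le) _           = ≤-eq (o-1 p j e) (Omax-1 e le) (coefficient≤V le)

O≤Omax-′ : ∀ {k} (C : Code k) p m → m ℕ.≤ suc p → fromℕ (O C (suc p) m) ≤ Omax (C ′) (suc p) (suc p ∸ m)
O≤Omax-′ C p m m≤ = ≤-eq
  (trans (O≡o C (suc p) m) (subst (λ n → o C n m ≡ o (C ′) n (suc p ∸ m)) (ℕ.m+[n∸m]≡n m≤) (o-complement C m (suc p ∸ m))))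
  refl (o≤Omax (C ′) p (suc p ∸ m) (ℕ.m∸n≤m (suc p) m))

-- Euler's constant

-- With f(q) = q + 1 already the linear Taylor polynomial suffices, with equality. The resulting exp
-- γ ≥ exp(H_p)/(p + 1) is all that the Stirling bound asks for, since (n - 1)/n · exp(H_p - log p)
-- equals the right side for p = n - 1.
γ-≥₁ : ∀ p N → ∃ λ M → ∀ {k} → M ℕ.≤ k → ∃ λ K → rec p * E N (harmonic p) ≤ E K (seq γ k)
γ-≥₁ p N = γ-≥ (fromℕ ∘ suc) p
  (λ q _ → ≤-eq (E-rec-≥ q) refl (*-monoˡ (fromℕ≥0 (suc q)) (E-monoᴺ {rec q} {2} {3} (rec≥0 q) (s≤s (s≤s z≤n)))))
  (λ q → fromℕ-mono (ℕ.n≤1+n q)) (rec≥0 p) (trans (ℚ.*-comm (rec p) (fromℕ (suc p))) (fromℕ-rec p)) N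

-- For f(q) = q + c and x = 1/(q + 1), f(q)(1 + x + x²/2) - f(q + 1) = (c - 1/2) x - (1 - c) x²/2,
-- which is non-negative from q = 2 on only if c ≥ 4/7. Conversely, the estimate `base` below asks
-- for (p + 1) p (1 - c)/(p + c) ≥ 1, which at p = 2 means c ≤ 4/7. So 4/7 is the one constant that
-- meets both demands.
4/7 : ℚ
4/7 = fromℕ 4 * rec 6

1/14 : ℚ
1/14 = rec 13

-- 1/(p + 4/7)
s₂ : ℕ → ℚ
s₂ p = fromℕ 7 * rec (3 ℕ.+ 7 ℕ.* p)

s₂-inv : ∀ p → s₂ p * (fromℕ p + 4/7) ≡ 1ℚ
s₂-inv p = begin
  fromℕ 7 * r * (fromℕ p + 4/7)
    ≡⟨ solve 2 (λ r p → con (fromℕ 7) :* r :* (p :+ con 4/7) := (con (fromℕ 4) :+ con (fromℕ 7) :* p) :* r) refl r (fromℕ p) ⟩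
  (fromℕ 4 + fromℕ 7 * fromℕ p) * r
    ≡⟨ cong (_* r) (sym (trans (fromℕ-+ 4 (7 ℕ.* p)) (cong (fromℕ 4 +_) (fromℕ-* 7 p)))) ⟩
  fromℕ (4 ℕ.+ 7 ℕ.* p) * r
    ≡⟨ fromℕ-rec (3 ℕ.+ 7 ℕ.* p) ⟩
  1ℚ ∎
  where
  open ≡-Reasoning
  r = rec (3 ℕ.+ 7 ℕ.* p)

-- With f(q) = q + 4/7 and x = 1/(q + 1), f(q + 1) ≤ f(q) (1 + x + x²/2) holds from q = 2 on.
γ-≥₂ : ∀ p → 2 ℕ.≤ p → ∀ N → ∃ λ M → ∀ {k} → M ℕ.≤ k → ∃ λ K → s₂ p * E N (harmonic p) ≤ E K (seq γ k)
γ-≥₂ p 2≤p N = γ-≥ (λ q → fromℕ q + 4/7) p step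
  (λ q → +-slack 4/7 (*≥0 (fromℕ≥0 4) (rec≥0 6)) refl)
  (*≥0 (fromℕ≥0 7) (rec≥0 (3 ℕ.+ 7 ℕ.* p))) (s₂-inv p) N
  where
  step : ∀ q → p ℕ.≤ q → fromℕ (suc q) + 4/7 ≤ (fromℕ q + 4/7) * E 3 (rec q)
  step q p≤q = +-slack (1/14 * (r * (1ℚ - fromℕ 3 * r)))
    (*≥0 (rec≥0 13) (*≥0 (rec≥0 q) (≤⇒0≤- (≤-eq refl (sym (fromℕ-rec 2)) (*-monoˡ (fromℕ≥0 3) (rec-anti (ℕ.≤-trans 2≤p p≤q)))))))
    (begin
      (fromℕ q + 4/7) * E 3 r
        ≡⟨ cong ((fromℕ q + 4/7) *_) (E3 r) ⟩
      (fromℕ q + 4/7) * (1ℚ + r + r * r * ½)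
        ≡⟨ solve 2 (λ q r → (q :+ con 4/7) :* (con 1ℚ :+ r :+ r :* r :* con ½) :=
             ((q :+ con 4/7) :+ (con 1ℚ :+ q) :* r :* (con 1ℚ :+ r :* con ½)) :- (r :* con (rec 6 * fromℕ 3) :+ r :* r :* con (rec 13 * fromℕ 3))) refl (fromℕ q) r ⟩
      fromℕ q + 4/7 + (1ℚ + fromℕ q) * r * (1ℚ + r * ½) - (r * (rec 6 * fromℕ 3) + r * r * (rec 13 * fromℕ 3))
        ≡⟨ cong (λ z → fromℕ q + 4/7 + z * (1ℚ + r * ½) - (r * (rec 6 * fromℕ 3) + r * r * (rec 13 * fromℕ 3)))
             (trans (cong (_* r) (sym (fromℕ-suc q))) (fromℕ-rec q)) ⟩
      fromℕ q + 4/7 + 1ℚ * (1ℚ + r * ½) - (r * (rec 6 * fromℕ 3) + r * r * (rec 13 * fromℕ 3))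
        ≡⟨ solve 2 (λ q r → q :+ con 4/7 :+ con 1ℚ :* (con 1ℚ :+ r :* con ½) :- (r :* con (rec 6 * fromℕ 3) :+ r :* r :* con (rec 13 * fromℕ 3)) :=
             ((con 1ℚ :+ q) :+ con 4/7) :+ con 1/14 :* (r :* (con 1ℚ :- con (fromℕ 3) :* r))) refl (fromℕ q) r ⟩
      (1ℚ + fromℕ q) + 4/7 + 1/14 * (r * (1ℚ - fromℕ 3 * r))
        ≡⟨ cong (λ z → z + 4/7 + 1/14 * (r * (1ℚ - fromℕ 3 * r))) (sym (fromℕ-suc q)) ⟩
      fromℕ (suc q) + 4/7 + 1/14 * (r * (1ℚ - fromℕ 3 * r)) ∎)
    where
    open ≡-Reasoning
    r = rec q

-- From index C on the terms at least halve, so twice the next term dominates the remaining tail,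
-- and E_i + 2 t_i does not increase.
E-tail : ∀ {x} C → 0ℚ ≤ x → x + x ≤ fromℕ (suc C) → ∀ j → E (j ℕ.+ C) x + fromℕ 2 * t (j ℕ.+ C) x ≤ E C x + fromℕ 2 * t C x
E-tail {x} C 0≤x 2x≤ zero    = ℚ.≤-refl
E-tail {x} C 0≤x 2x≤ (suc j) = ℚ.≤-trans
  (≤-eq refl (solve 2 (λ e u → e :+ con (fromℕ 2) :* u := (e :+ u) :+ u) refl (E i x) (t i x))
    (ℚ.+-monoʳ-≤ (E i x + t i x) (begin
      fromℕ 2 * t (suc i) x         ≡⟨ trans (cong (fromℕ 2 *_) (t-suc′ i x)) (solve 3 (λ x u r → con (fromℕ 2) :* (x :* u :* r) := (x :+ x) :* r :* u) refl x (t i x) (rec i)) ⟩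
      (x + x) * rec i * t i x       ≤⟨ *-monoʳ (t≥0 0≤x i) (*-monoʳ (rec≥0 i) (ℚ.≤-trans 2x≤ (fromℕ-mono (s≤s (ℕ.m≤n+m C j))))) ⟩
      fromℕ (suc i) * rec i * t i x ≡⟨ trans (cong (_* t i x) (fromℕ-rec i)) (ℚ.*-identityˡ (t i x)) ⟩
      t i x                         ∎)))
  (E-tail C 0≤x 2x≤ j)
  where
  open ℚ.≤-Reasoning
  i = j ℕ.+ C

E-≤-tail : ∀ {x} C → 0ℚ ≤ x → x + x ≤ fromℕ (suc C) → ∀ N → E N x ≤ E C x + fromℕ 2 * t C x
E-≤-tail {x} C 0≤x 2x≤ N = ℚ.≤-trans (E-monoᴺ 0≤x (ℕ.m≤m+n N C))
  (ℚ.≤-trans (+-slack (fromℕ 2 * t (N ℕ.+ C) x) (*≥0 (fromℕ≥0 2) (t≥0 0≤x (N ℕ.+ C))) refl) (E-tail C 0≤x 2x≤ N))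

-- exp(H_q)/(q + 1/2) decreases, by exp x ≤ (2 + x)/(2 - x).
E-harmonic-decreasing : ∀ p r N → fromℕ (1 ℕ.+ 2 ℕ.* p) * E (2 ℕ.+ N) (harmonic (r ℕ.+ p)) ≤ fromℕ (1 ℕ.+ 2 ℕ.* (r ℕ.+ p)) * E (2 ℕ.+ N) (harmonic p)
E-harmonic-decreasing p zero    N = ℚ.≤-refl
E-harmonic-decreasing p (suc r) N = begin
  a * E N′ (harmonic (suc q))               ≡⟨ cong (λ z → a * E N′ z) (harmonic-suc q) ⟩
  a * E N′ (harmonic q + rec q)             ≤⟨ *-monoˡ (fromℕ≥0 (1 ℕ.+ 2 ℕ.* p)) (E-+-≤ N′ (harmonic≥0 q) (rec≥0 q)) ⟩
  a * (E N′ (harmonic q) * E N′ (rec q))    ≡⟨ ℚ.*-assoc a (E N′ (harmonic q)) (E N′ (rec q)) ⟨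
  a * E N′ (harmonic q) * E N′ (rec q)      ≤⟨ *-monoʳ (E≥0 (rec≥0 q) N′) (E-harmonic-decreasing p r N) ⟩
  b * E N′ (harmonic p) * E N′ (rec q)      ≡⟨ solve 3 (λ b h e → b :* h :* e := (b :* e) :* h) refl b (E N′ (harmonic p)) (E N′ (rec q)) ⟩
  b * E N′ (rec q) * E N′ (harmonic p)      ≤⟨ *-monoʳ (E≥0 (harmonic≥0 p) N′) step ⟩
  fromℕ (1 ℕ.+ 2 ℕ.* suc q) * E N′ (harmonic p) ∎
  where
  open ℚ.≤-Reasoning
  q = r ℕ.+ p
  N′ = 2 ℕ.+ N
  a = fromℕ (1 ℕ.+ 2 ℕ.* p)
  b = fromℕ (1 ℕ.+ 2 ℕ.* q)
  n = fromℕ (suc q)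
  affine : ∀ c d q → fromℕ (c ℕ.+ d ℕ.* q) ≡ fromℕ c + fromℕ d * fromℕ q
  affine c d q = trans (fromℕ-+ c (d ℕ.* q)) (cong (fromℕ c +_) (fromℕ-* d q))
  b≡ : b ≡ n * (fromℕ 2 - rec q)
  b≡ = trans (affine 1 2 q) (trans
    (solve 1 (λ q → con 1ℚ :+ con (fromℕ 2) :* q := con (fromℕ 2) :* (con 1ℚ :+ q) :- con 1ℚ) refl (fromℕ q))
    (trans (cong₂ (λ x y → fromℕ 2 * x - y) (sym (fromℕ-suc q)) (sym (fromℕ-rec q)))
      (solve 2 (λ n r → con (fromℕ 2) :* n :- n :* r := n :* (con (fromℕ 2) :- r)) refl n (rec q))))
  c≡ : fromℕ (1 ℕ.+ 2 ℕ.* suc q) ≡ n * (fromℕ 2 + rec q)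
  c≡ = trans (affine 1 2 (suc q)) (trans
    (cong (λ z → z + fromℕ 2 * n) (sym (fromℕ-rec q)))
      (solve 2 (λ n r → n :* r :+ con (fromℕ 2) :* n := n :* (con (fromℕ 2) :+ r)) refl n (rec q)))
  step : b * E N′ (rec q) ≤ fromℕ (1 ℕ.+ 2 ℕ.* suc q)
  step = ≤-eq (trans (cong (_* E N′ (rec q)) b≡) (ℚ.*-assoc n (fromℕ 2 - rec q) (E N′ (rec q)))) c≡
    (*-monoˡ (fromℕ≥0 (suc q)) (E-≤₂ (rec≥0 q) N))

-- H₆₄ = 4.7438909… and exp H₆₄ = 114.88033…, so that exp H₆₄ / 64.5 < 1.78110.
harmonic₆₄ : ℚ
harmonic₆₄ = ℤ.+ 4743891 / 1000000

exp-harmonic₆₄ : ℚ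
exp-harmonic₆₄ = ℤ.+ 1148804 / 10000

-- Decided by evaluation at the rounded argument. With 22 terms the tail bound 2 · t_22 is of order
-- 10^-6, well inside the rounding to four decimals.
E-harmonic-64 : ∀ N → E N (harmonic 64) ≤ exp-harmonic₆₄
E-harmonic-64 N = ℚ.≤-trans
  (E-mono (harmonic≥0 64) (toWitness {a? = harmonic 64 ℚ.≤? harmonic₆₄} tt) N)
  (ℚ.≤-trans (E-≤-tail 22 (toWitness {a? = 0ℚ ℚ.≤? harmonic₆₄} tt) (toWitness {a? = harmonic₆₄ + harmonic₆₄ ℚ.≤? fromℕ 23} tt) N)
    (toWitness {a? = E 22 harmonic₆₄ + fromℕ 2 * t 22 harmonic₆₄ ℚ.≤? exp-harmonic₆₄} tt))

1-rec : ℕ → ℚ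
1-rec k = 1ℚ - rec k

-- The bound exp γ ≤ exp(H_64)/64.5 with denominators cleared: 129 = 2 · 64 + 1, and 2 + 1/(k + 1)
-- is (2(k + 1) + 1)/(k + 1). One factor 1 - 1/(k + 1) pays for replacing the entry of γ by a later
-- entry of the approximant, the other for the Riemann sum of log (k + 1) falling short.
E-γ-≤ : ∀ k → 64 ℕ.≤ suc k → ∀ K → fromℕ 129 * (1-rec k * 1-rec k) * E K (seq γ k) ≤ exp-harmonic₆₄ * (fromℕ 2 + rec k)
E-γ-≤ k 64≤ K = *-cancelˡ (fromℕ>0 k) (begin
  n * (fromℕ 129 * (1-rec k * 1-rec k) * E K (seq γ k))
    ≡⟨ solve 4 (λ n u d e → n :* (u :* (d :* d) :* e) := u :* ((d :* e) :* (d :* n))) refl n (fromℕ 129) (1-rec k) (E K (seq γ k)) ⟩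
  fromℕ 129 * (1-rec k * E K (seq γ k) * (1-rec k * n))
    ≤⟨ *-monoˡ (fromℕ≥0 129) (*-mono (*≥0 (1-rec≥0 k) (fromℕ≥0 (suc k))) (E≥0 (γ-approx≥0 k m) K)
         (ℚ.≤-trans (*-monoˡ (1-rec≥0 k) (E-mono (γ≥0 k) (lim-≤ γ-approx γ-cauchy k (ℕ.m≤n⊔m k (limIndex γ-approx k))) K))
           (E-perturb K (γ-approx≥0 k m) (rec≥0 k) (rec≤1 k)))
         (ℚ.≤-trans (*-monoʳ (fromℕ≥0 (suc k)) (ℚ.+-monoʳ-≤ 1ℚ (ℚ.neg-antimono-≤ (rec-anti (ℕ.≤-trans (ℕ.m≤m⊔n k (limIndex γ-approx k)) (ℕ.n≤1+n m))))))
           (proj₂ (E-log-≥ k m)))) ⟩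
  fromℕ 129 * (E K (seq (γ-approx k) m) * E L (logApprox (suc k) m))
    ≤⟨ *-monoˡ (fromℕ≥0 129) (E-+-≥ K L (γ-approx≥0 k m) (log≥0 (suc k) m)) ⟩
  fromℕ 129 * E (K ℕ.+ L) (seq (γ-approx k) m + logApprox (suc k) m)
    ≡⟨ cong (λ z → fromℕ 129 * E (K ℕ.+ L) z) (γ+log k m) ⟩
  fromℕ 129 * E (K ℕ.+ L) (harmonic (suc k))
    ≤⟨ *-monoˡ (fromℕ≥0 129) (E-monoᴺ (harmonic≥0 (suc k)) (ℕ.m≤n+m (K ℕ.+ L) 2)) ⟩
  fromℕ 129 * E (2 ℕ.+ (K ℕ.+ L)) (harmonic (suc k))
    ≤⟨ subst (λ z → fromℕ 129 * E (2 ℕ.+ (K ℕ.+ L)) (harmonic z) ≤ fromℕ (1 ℕ.+ 2 ℕ.* z) * E (2 ℕ.+ (K ℕ.+ L)) (harmonic 64))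
         (ℕ.m∸n+n≡m 64≤) (E-harmonic-decreasing 64 (suc k ∸ 64) (K ℕ.+ L)) ⟩
  fromℕ (1 ℕ.+ 2 ℕ.* suc k) * E (2 ℕ.+ (K ℕ.+ L)) (harmonic 64)
    ≤⟨ *-monoˡ (fromℕ≥0 (1 ℕ.+ 2 ℕ.* suc k)) (E-harmonic-64 (2 ℕ.+ (K ℕ.+ L))) ⟩
  fromℕ (1 ℕ.+ 2 ℕ.* suc k) * exp-harmonic₆₄
    ≡⟨ cong (_* exp-harmonic₆₄) (trans (fromℕ-+ 1 (2 ℕ.* suc k)) (cong₂ _+_ (sym (fromℕ-rec k)) (fromℕ-* 2 (suc k)))) ⟩
  (n * rec k + fromℕ 2 * n) * exp-harmonic₆₄
    ≡⟨ solve 4 (λ n r two c → (n :* r :+ two :* n) :* c := n :* (c :* (two :+ r))) refl n (rec k) (fromℕ 2) exp-harmonic₆₄ ⟩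
  n * (exp-harmonic₆₄ * (fromℕ 2 + rec k)) ∎)
  where
  open ℚ.≤-Reasoning
  n = fromℕ (suc k)
  m = k ℕ.⊔ limIndex γ-approx k
  L = proj₁ (E-log-≥ k m)

exp-γ-≤ : exp γ ≤ᴿ fromℚ (ℤ.+ 17811 / 10000)
-- From this index on, 1/(k + 1) ≤ 10^-6. As 2 · 114.8804/129 = 1.78109..., losses of this size
-- still leave the value below 1.7811.
exp-γ-≤ = exp-≤ γ λ K → 999999 , λ {k} hk → *-cancelˡ {D} {E K (seq γ k)} {ℤ.+ 17811 / 10000} (ℚ.positive⁻¹ D) (begin
  D * E K (seq γ k)
    ≤⟨ *-monoʳ (E≥0 (γ≥0 k) K) (*-monoˡ (fromℕ≥0 129) (*-mono (1-rec≥0 999999) (1-rec≥0 k) (le hk) (le hk))) ⟩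
  fromℕ 129 * (1-rec k * 1-rec k) * E K (seq γ k)
    ≤⟨ E-γ-≤ k (ℕ.≤-trans (ℕ.≤-trans (toWitness {a? = 64 ℕ.≤? 999999} tt) hk) (ℕ.n≤1+n k)) K ⟩
  exp-harmonic₆₄ * (fromℕ 2 + rec k)
    ≤⟨ *-monoˡ (toWitness {a? = 0ℚ ℚ.≤? exp-harmonic₆₄} tt) (ℚ.+-monoʳ-≤ (fromℕ 2) (rec-anti hk)) ⟩
  exp-harmonic₆₄ * (fromℕ 2 + rec 999999)
    ≤⟨ toWitness {a? = exp-harmonic₆₄ * (fromℕ 2 + rec 999999) ℚ.≤? D * (ℤ.+ 17811 / 10000)} tt ⟩
  D * (ℤ.+ 17811 / 10000) ∎)
  where
  open ℚ.≤-Reasoning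
  D : ℚ
  D = fromℕ 129 * (1-rec 999999 * 1-rec 999999)
  le : ∀ {k} → 999999 ℕ.≤ k → 1-rec 999999 ≤ 1-rec k
  le h = ℚ.+-monoʳ-≤ 1ℚ (ℚ.neg-antimono-≤ (rec-anti h))

-- Stirling numbers

1/≥0 : ∀ q .{{_ : NonZero q}} → 0ℚ < q → 0ℚ ≤ 1/ q
1/≥0 q@(mkℚ ℤ.+[1+ n ] d c) 0<q = ℚ.nonNegative⁻¹ (1/ q)
1/≥0 (mkℚ ℤ.+0 d c)         0<q with () ← positive 0<q
1/≥0 (mkℚ ℤ.-[1+ n ] d c)   0<q with () ← positive 0<q

÷-≤ : ∀ p q .{{_ : NonZero q}} c → 0ℚ < q → p ≤ c * q → p ÷ q ≤ c
÷-≤ p q c 0<q p≤cq = ≤-eq refl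
  (trans (sym (ℚ.*-identityʳ c)) (trans (cong (c *_) (sym (ℚ.*-inverseʳ q))) (sym (ℚ.*-assoc c q (1/ q)))))
  (*-monoʳ (1/≥0 q 0<q) p≤cq)

fromℚ-≤ : ∀ {a b x} → a ≤ b → fromℚ b ≤ᴿ x → fromℚ a ≤ᴿ x
fromℚ-≤ {x = x} a≤b h ε 0<ε = let N , p = h ε 0<ε in N , λ {n} hn → ℚ.≤-trans (ℚ.+-monoˡ-≤ (- seq x n) a≤b) (p hn)

module _ {r} (0≤r : 0ℚ ≤ r) (r≤1 : r ≤ 1ℚ) where

  private
    r*-≤ : ∀ {ε} → 0ℚ ≤ ε → r * ε ≤ ε
    r*-≤ {ε} 0≤ε = ≤-eq refl (sym (ℚ.*-identityˡ ε)) (*-monoʳ 0≤ε r≤1)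

  fromℚ-*ᴿ-≥ : ∀ {c x} → fromℚ c ≤ᴿ x → fromℚ (r * c) ≤ᴿ fromℚ r *ᴿ x
  fromℚ-*ᴿ-≥ {c} {x} h ε 0<ε = let N , p = h ε 0<ε in N , λ {n} hn → ℚ.≤-trans
    (≤-eq (solve 3 (λ r c x → r :* c :- r :* x := r :* (c :- x)) refl r c (seq x n)) refl (*-monoˡ 0≤r (p hn)))
    (r*-≤ (ℚ.<⇒≤ 0<ε))

  -- Lower bounds for exp are available for rationals only. The real r · x is therefore approached
  -- by the rationals r (x_k - 1/(k + 1)), and each of these is compared with y.
  fromℚ-*ᴿ-≤ : ∀ {x y} → (∀ k → fromℚ (r * (seq x k - rec k)) ≤ᴿ y) → fromℚ r *ᴿ x ≤ᴿ y
  fromℚ-*ᴿ-≤ {x} {y} h ε 0<ε =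
    let δ , 0<δ , 3δ≤ε = shrink 3 0<ε
        N , p = cauchy x δ 0<δ
        K , rK≤δ = below 0<δ
        k = N ℕ.⊔ K
        M , q = h k δ 0<δ
        X = seq x k
    in N ℕ.⊔ M , λ {n} hn → (begin
      r * seq x n - seq y n
        ≡⟨ solve 5 (λ r x y z u → r :* x :- y := r :* (x :- z) :+ r :* u :+ (r :* (z :- u) :- y)) refl r (seq x n) (seq y n) X (rec k) ⟩
      r * (seq x n - X) + r * rec k + (r * (X - rec k) - seq y n)
        ≤⟨ ℚ.+-mono-≤ (ℚ.+-mono-≤
             (ℚ.≤-trans (*-monoˡ 0≤r (p (ℕ.m⊔n≤o⇒m≤o N M hn) (ℕ.m≤m⊔n N K))) (r*-≤ (ℚ.<⇒≤ 0<δ)))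
             (ℚ.≤-trans (r*-≤ (rec≥0 k)) (ℚ.≤-trans (rec-anti (ℕ.m≤n⊔m N K)) rK≤δ)))
             (q (ℕ.m⊔n≤o⇒n≤o N M hn)) ⟩
      δ + δ + δ
        ≡⟨ solve 1 (λ δ → δ :+ δ :+ δ := con (fromℕ 3) :* δ) refl δ ⟩
      fromℕ 3 * δ
        ≤⟨ 3δ≤ε ⟩
      ε ∎)
    where open ℚ.≤-Reasoning

stirling-zero : ∀ n j → stirling n (j ℕ.+ suc n) ≡ 0
stirling-zero zero    zero    = refl
stirling-zero zero    (suc j) = refl
stirling-zero (suc n) zero    = cong₂ ℕ._+_ (trans (cong (n ℕ.*_) (stirling-zero n 1)) (ℕ.*-zeroʳ n)) (stirling-zero n 0)
stirling-zero (suc n) (suc j) = cong₂ ℕ._+_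
  (trans (cong (n ℕ.*_) (trans (cong (stirling n ∘ suc) (ℕ.+-suc j (suc n))) (stirling-zero n (suc (suc j))))) (ℕ.*-zeroʳ n))
  (trans (cong (stirling n) (ℕ.+-suc j (suc n))) (stirling-zero n (suc j)))

stirling-total : ∀ n → ∑[ m ≤ n ] fromℕ (stirling n (toℕ m)) ≡ fromℕ (n !)
stirling-total zero    = refl
stirling-total (suc n) = begin
  0ℚ + ∑[ m ≤ n ] fromℕ (n ℕ.* stirling n (suc (toℕ m)) ℕ.+ stirling n (toℕ m))
    ≡⟨ trans (ℚ.+-identityˡ (∑[ m ≤ n ] fromℕ (n ℕ.* stirling n (suc (toℕ m)) ℕ.+ stirling n (toℕ m))))
         (∑-cong (suc n) λ m → trans (fromℕ-+ (n ℕ.* stirling n (suc (toℕ m))) (stirling n (toℕ m)))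
           (cong (_+ σ (toℕ m)) (fromℕ-* n (stirling n (suc (toℕ m)))))) ⟩
  ∑[ m ≤ n ] (N * σ (suc (toℕ m)) + σ (toℕ m))
    ≡⟨ trans (∑-+ (suc n) (λ m → N * σ (suc (toℕ m))) (λ m → σ (toℕ m)))
         (cong (_+ S) (trans (∑-*ˡ (suc n) N (λ m → σ (suc (toℕ m)))) shifted)) ⟩
  N * S + S
    ≡⟨ solve 2 (λ n s → n :* s :+ s := (con 1ℚ :+ n) :* s) refl N S ⟩
  (1ℚ + N) * S
    ≡⟨ cong₂ _*_ (sym (fromℕ-suc n)) (stirling-total n) ⟩
  fromℕ (suc n) * fromℕ (n !)
    ≡⟨ fromℕ-* (suc n) (n !) ⟨
  fromℕ (suc n !) ∎
  where
  open ≡-Reasoning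
  N = fromℕ n
  σ : ℕ → ℚ
  σ m = fromℕ (stirling n m)
  S = ∑[ m ≤ n ] σ (toℕ m)
  n*σ0 : N * σ 0 ≡ 0ℚ
  n*σ0 = trans (sym (fromℕ-* n (stirling n 0))) (cong fromℕ (vanish n))
    where
    vanish : ∀ n → n ℕ.* stirling n 0 ≡ 0
    vanish zero    = refl
    vanish (suc n) = ℕ.*-zeroʳ n
  shifted : N * ∑[ m ≤ n ] σ (suc (toℕ m)) ≡ N * S
  shifted = trans (sym (ℚ.+-identityˡ (N * ∑[ m ≤ n ] σ (suc (toℕ m))))) (trans
    (cong (_+ N * ∑[ m ≤ n ] σ (suc (toℕ m))) (sym n*σ0))
    (trans (sym (ℚ.*-distribˡ-+ N (σ 0) (∑[ m ≤ n ] σ (suc (toℕ m)))))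
      (cong (N *_) (trans (∑-snoc σ (suc n)) (trans (cong (λ z → S + fromℕ z) (stirling-zero n 0)) (ℚ.+-identityʳ S))))))

stirlingMax-total : ∀ p → ∑[ m ≤ suc p ] stirlingMax (suc p) (toℕ m) ≡ fromℕ (p !) * E (suc p) (harmonic p)
stirlingMax-total p = trans (ℚ.+-identityˡ (∑[ j ≤ p ] stirlingMax (suc p) (suc (toℕ j)))) (trans
  (∑-cong (suc p) λ j → trans (cong (_* harmonic p ^ toℕ j) (÷-! (p !) (toℕ j)))
    (solve 3 (λ a r x → a :* r :* x := a :* (x :* r)) refl (fromℕ (p !)) (rec! (toℕ j)) (harmonic p ^ toℕ j)))
  (trans (∑-*ˡ (suc p) (fromℕ (p !)) (λ j → t (toℕ j) (harmonic p))) (cong (fromℕ (p !) *_) (sym (E-∑ (suc p) (harmonic p))))))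

-- Here x stands for H_p - log p with p = q + 1, and r for p/(p + 1).
module _ (q : ℕ) {r : ℚ} {x : ℝ} (r≡ : r ≡ fromℕ (suc q) * rec (suc q)) (0≤x : NonNeg (seq x))
         (x+log : ∀ m → seq x m + logApprox (suc q) m ≡ harmonic (suc q)) where

  private
    p n : ℕ
    p = suc q
    n = suc p

    r≥0 : 0ℚ ≤ r
    r≥0 = ≤-eq refl r≡ (*≥0 (fromℕ≥0 p) (rec≥0 p))

    r≤1 : r ≤ 1ℚ
    r≤1 = ≤-eq r≡ (sym (fromℕ-rec p)) (*-monoʳ (rec≥0 p) (fromℕ-mono (ℕ.n≤1+n p)))

    A B Y : ℚ
    A = ∑[ m ≤ n ] stirlingMax n (toℕ m)
    B = ∑[ m ≤ n ] fromℕ (stirling n (toℕ m))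
    Y = E n (harmonic p)

    Y-≤ : ∀ k → rec q * Y ≤ E n (seq x k)
    Y-≤ k = ≤-eq refl
      (trans (sym (ℚ.*-identityʳ e)) (trans (cong (e *_) (sym (fromℕ-rec q))) (solve 3 (λ e p r → e :* (p :* r) := r :* (e :* p)) refl e (fromℕ p) (rec q))))
      (*-monoˡ (rec≥0 q) (E-harmonic-≤ q k n (0≤x k) (x+log k)))
      where e = E n (seq x k)

    0<B : 0ℚ < B
    0<B = subst (0ℚ <_) (sym (stirling-total n)) (ℚ.<-≤-trans (rec>0 0) (fromℕ-mono {1} (ℕ.1≤n! n)))

    A≡ : A ≡ r * (rec q * Y) * B
    A≡ = begin
      A
        ≡⟨ stirlingMax-total p ⟩
      fromℕ (p !) * Y
        ≡⟨ solve 2 (λ a y → a :* y := con 1ℚ :* con 1ℚ :* (a :* y)) refl (fromℕ (p !)) Y ⟩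
      1ℚ * 1ℚ * (fromℕ (p !) * Y)
        ≡⟨ cong₂ (λ a b → a * b * (fromℕ (p !) * Y)) (sym (fromℕ-rec q)) (sym (fromℕ-rec p)) ⟩
      fromℕ p * rec q * (fromℕ n * rec p) * (fromℕ (p !) * Y)
        ≡⟨ solve 6 (λ p r n s a y → p :* r :* (n :* s) :* (a :* y) := p :* s :* (r :* y) :* (n :* a)) refl (fromℕ p) (rec q) (fromℕ n) (rec p) (fromℕ (p !)) Y ⟩
      fromℕ p * rec p * (rec q * Y) * (fromℕ n * fromℕ (p !))
        ≡⟨ cong₂ (λ a b → a * (rec q * Y) * b) (sym r≡) (sym (trans (stirling-total n) (fromℕ-* n (p !)))) ⟩
      r * (rec q * Y) * B ∎
      where open ≡-Reasoning

    ratio : (A ÷ B) {{stirling-total-nonZero n}} ≤ r * (rec q * Y)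
    ratio = ÷-≤ A B {{stirling-total-nonZero n}} (r * (rec q * Y)) 0<B (ℚ.≤-reflexive A≡)

    -- r · exp x = p · exp x/(p + 1), and p · exp x is in effect exp(log p + x) = exp(H_p), so
    -- `γ-≥₁` applies. The summand 1/(k + 1) covers the error of the entry of `exp x`, and the
    -- factor 1 - 1/(j + 1) the defect of the Riemann sum of log p.
    lower : ∀ k → r * (seq (exp x) k - rec k) ⊑ seq γ
    lower k j = M , λ hk → let L , g = bound hk in L , ℚ.≤-trans main g
      where
      open ℚ.≤-Reasoning
      m = j ℕ.⊔ expIndex x k
      K = proj₁ (E-log-≥ q m)
      M = proj₁ (γ-≥₁ p (K ℕ.+ k))
      bound = proj₂ (γ-≥₁ p (K ℕ.+ k))
      ℓ = logApprox p m
      y = seq x m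
      main : (1ℚ - rec j) * (r * (seq (exp x) k - rec k)) ≤ rec p * E (K ℕ.+ k) (harmonic p)
      main = begin
        (1ℚ - rec j) * (r * (seq (exp x) k - rec k))
          ≡⟨ cong (λ z → (1ℚ - rec j) * (z * (seq (exp x) k - rec k))) r≡ ⟩
        (1ℚ - rec j) * (fromℕ p * rec p * (seq (exp x) k - rec k))
          ≤⟨ *-monoˡ (1-rec≥0 j) (*-monoˡ (*≥0 (fromℕ≥0 p) (rec≥0 p))
               (≤+⇒-≤ (≤-eq refl (ℚ.+-comm (rec k) (E k y)) (exp-seq-≤ x k (ℕ.m≤n⊔m j (expIndex x k)))))) ⟩
        (1ℚ - rec j) * (fromℕ p * rec p * E k y)
          ≤⟨ *-monoʳ (*≥0 (*≥0 (fromℕ≥0 p) (rec≥0 p)) (E≥0 (0≤x m) k))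
               (ℚ.+-monoʳ-≤ 1ℚ (ℚ.neg-antimono-≤ (rec-anti (ℕ.≤-trans (ℕ.m≤m⊔n j (expIndex x k)) (ℕ.n≤1+n m))))) ⟩
        (1ℚ - rec (suc m)) * (fromℕ p * rec p * E k y)
          ≡⟨ solve 4 (λ d p r e → d :* (p :* r :* e) := r :* ((d :* p) :* e)) refl (1ℚ - rec (suc m)) (fromℕ p) (rec p) (E k y) ⟩
        rec p * ((1ℚ - rec (suc m)) * fromℕ p * E k y)
          ≤⟨ *-monoˡ (rec≥0 p) (*-monoʳ (E≥0 (0≤x m) k) (proj₂ (E-log-≥ q m))) ⟩
        rec p * (E K ℓ * E k y)
          ≤⟨ *-monoˡ (rec≥0 p) (E-+-≥ K k (log≥0 p m) (0≤x m)) ⟩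
        rec p * E (K ℕ.+ k) (ℓ + y)
          ≡⟨ cong (λ z → rec p * E (K ℕ.+ k) z) (trans (ℚ.+-comm ℓ y) (x+log m)) ⟩
        rec p * E (K ℕ.+ k) (harmonic p) ∎

  stirling-ratio : fromℚ (((∑[ m ≤ n ] stirlingMax n (toℕ m)) ÷ (∑[ m ≤ n ] fromℕ (stirling n (toℕ m)))) {{stirling-total-nonZero n}})
                     ≤ᴿ fromℚ r *ᴿ exp x
  stirling-ratio = fromℚ-≤ {x = fromℚ r *ᴿ exp x} ratio
    (fromℚ-*ᴿ-≥ r≥0 r≤1 {x = exp x} (⊑⇒≤exp x 0≤x (⊑-exact 0≤x (0 , λ {k} _ → n , Y-≤ k))))

  exp-harmonic-log-≤ : fromℚ r *ᴿ exp x ≤ᴿ exp γ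
  exp-harmonic-log-≤ = fromℚ-*ᴿ-≤ {r} r≥0 r≤1 {x = exp x} {y = exp γ} λ k → ⊑⇒≤exp γ γ≥0 (lower k)

-- The sum of O_max against λ

-- The sum of the V p j, without the common factor p!^k.
maxSum : ∀ {k} → Code k → ℕ → ℚ
maxSum C p = ∑[ j ≤ p ] (t (toℕ j) (∑F C p) * ∏F (C ′) (p ∸ toℕ j))

module _ {k} (C D : Code k) (p : ℕ) where

  private
    n : ℕ
    n = suc p

  -- The denominator is n!^k whatever the code. Hence the codes above and below the bar may differ,
  -- and (ii) and (iii) are the instances D = C and D = C′ of one bound.
  Omax-ratio-≤ : ∀ {c} → maxSum D p ≤ c * fromℕ n ^ k →
    ((∑[ m ≤ n ] Omax D n (toℕ m)) ÷ (∑[ m ≤ n ] fromℕ (O C n (toℕ m)))) {{O-total-nonZero C n}} ≤ c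
  Omax-ratio-≤ {c} le = ÷-≤ A B {{O-total-nonZero C n}} c 0<B (begin
    A                                     ≡⟨ trans (Omax-total D p) (∑-*ˡ n (fromℕ (p !) ^ k) (λ j → t (toℕ j) (∑F D p) * ∏F (D ′) (p ∸ toℕ j))) ⟩
    fromℕ (p !) ^ k * maxSum D p          ≤⟨ *-monoˡ (^≥0 (fromℕ≥0 (p !)) k) le ⟩
    fromℕ (p !) ^ k * (c * fromℕ n ^ k)   ≡⟨ solve 3 (λ a c b → a :* (c :* b) := c :* (b :* a)) refl (fromℕ (p !) ^ k) c (fromℕ n ^ k) ⟩
    c * (fromℕ n ^ k * fromℕ (p !) ^ k)   ≡⟨ cong (c *_) (sym B≡) ⟩
    c * B                                 ∎)
    where
    open ℚ.≤-Reasoning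
    A = ∑[ m ≤ n ] Omax D n (toℕ m)
    B = ∑[ m ≤ n ] fromℕ (O C n (toℕ m))
    B≡ : B ≡ fromℕ n ^ k * fromℕ (p !) ^ k
    B≡ = trans (O-total C n) (trans (cong (_^ k) (fromℕ-* n (p !))) (*-^ (fromℕ n) (fromℕ (p !)) k))
    0<B : 0ℚ < B
    0<B = ℚ.<-≤-trans (rec>0 0) (≤-eq refl (O-total C n) (1≤^ (fromℕ-mono {1} (ℕ.1≤n! n)) k))

module _ {k} (C : Code k) where

  F₊-≤ : ∀ j → F₊ C j ≤ (1ℚ + rec j) ^ k
  F₊-≤ j = +-slack (F₊ (C ′) j) (F₊≥0 (C ′) j) (sym (F₊+F₊′ C j))

  -- With all coefficients 1 the factor of index j would be ((j + 2)/(j + 1))^k by the binomial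
  -- theorem, and these telescope.
  ∏F-≤ : ∀ r → ∏F C r ≤ fromℕ (suc r) ^ k
  ∏F-≤ zero    = 1≤^ ℚ.≤-refl k
  ∏F-≤ (suc r) = ≤-eq refl
    (trans (cong (_^ k) (trans (fromℕ-suc (suc r)) (trans (cong (_+ fromℕ (suc r)) (sym (fromℕ-rec r)))
        (solve 2 (λ n r → n :* r :+ n := n :* (con 1ℚ :+ r)) refl (fromℕ (suc r)) (rec r)))))
      (*-^ (fromℕ (suc r)) (1ℚ + rec r) k))
    (*-mono (F₊≥0 C r) (^≥0 (fromℕ≥0 (suc r)) k) (∏F-≤ r) (F₊-≤ r))

module _ {k} (C : Code k) (p : ℕ) where

  private
    n : ℚ
    n = fromℕ (suc p)

  maxSum-≤ : maxSum C p ≤ E (suc p) (∑F C p) * n ^ k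
  maxSum-≤ = begin
    ∑[ j ≤ p ] (t (toℕ j) (∑F C p) * ∏F (C ′) (p ∸ toℕ j))
      ≤⟨ ∑-≤ (suc p) (λ j → t (toℕ j) (∑F C p) * ∏F (C ′) (p ∸ toℕ j)) (λ j → n ^ k * t (toℕ j) (∑F C p)) (λ j →
           ≤-eq refl (ℚ.*-comm (n ^ k) (t (toℕ j) (∑F C p))) (*-monoˡ (t≥0 (∑F≥0 C p) (toℕ j)) (ℚ.≤-trans (∏F-≤ (C ′) (p ∸ toℕ j))
             (^-mono (fromℕ≥0 (suc (p ∸ toℕ j))) (fromℕ-mono (s≤s (ℕ.m∸n≤m p (toℕ j)))) k)))) ⟩
    ∑[ j ≤ p ] (n ^ k * t (toℕ j) (∑F C p))
      ≡⟨ trans (∑-*ˡ (suc p) (n ^ k) (λ j → t (toℕ j) (∑F C p))) (trans (cong (n ^ k *_) (sym (E-∑ (suc p) (∑F C p)))) (ℚ.*-comm (n ^ k) (E (suc p) (∑F C p)))) ⟩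
    E (suc p) (∑F C p) * n ^ k ∎
    where open ℚ.≤-Reasoning

  -- All terms but the first carry the smaller factor p^k.
  maxSum-≤′ : maxSum C p ≤ n ^ k - fromℕ p ^ k + fromℕ p ^ k * E (suc p) (∑F C p)
  maxSum-≤′ = begin
    t 0 x * ∏F (C ′) p + ∑[ j < p ] (t (suc (toℕ j)) x * ∏F (C ′) (p ∸ suc (toℕ j)))
      ≤⟨ ℚ.+-mono-≤ (≤-eq (ℚ.*-identityˡ (∏F (C ′) p)) refl (∏F-≤ (C ′) p))
           (∑-monoℕ p {λ j → t (suc j) x * ∏F (C ′) (p ∸ suc j)} {λ j → b * t (suc j) x} λ {j} j<p →
             ≤-eq refl (ℚ.*-comm b (t (suc j) x)) (*-monoˡ (t≥0 (∑F≥0 C p) (suc j)) (ℚ.≤-trans (∏F-≤ (C ′) (p ∸ suc j))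
               (^-mono (fromℕ≥0 (suc (p ∸ suc j))) (fromℕ-mono (ℕ.≤-trans (ℕ.≤-reflexive (sym (∸-split j<p))) (ℕ.m∸n≤m p j))) k)))) ⟩
    n ^ k + ∑[ j < p ] (b * t (suc (toℕ j)) x)
      ≡⟨ cong (n ^ k +_) (∑-*ˡ p b (λ j → t (suc (toℕ j)) x)) ⟩
    n ^ k + b * S
      ≡⟨ solve 3 (λ a b s → a :+ b :* s := a :- b :+ b :* (con 1ℚ :+ s)) refl (n ^ k) b S ⟩
    n ^ k - b + b * (1ℚ + S)
      ≡⟨ cong (λ z → n ^ k - b + b * z) (sym (E-∑ (suc p) x)) ⟩
    n ^ k - b + b * E (suc p) x ∎
    where
    open ℚ.≤-Reasoning
    x = ∑F C p
    b = fromℕ p ^ k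
    S = ∑[ j < p ] t (suc (toℕ j)) x

maxSum-1 : ∀ {k} (C : Code k) → maxSum C 1 ≡ fromℕ 2 ^ k
maxSum-1 {k} C = trans
  (solve 2 (λ a b → con 1ℚ :* con 1ℚ :* (con 1ℚ :* b) :+ ((con 0ℚ :+ a) :* con 1ℚ :* con 1ℚ :* con 1ℚ :+ con 0ℚ) := a :+ b) refl (F₊ C 0) (F₊ (C ′) 0))
  (F₊+F₊′ C 0)

-- The exponent λ and its rational counterpart

module Lambda (k₁ : ℕ) (c₀ c₁ : Fin 2) (cs : Vec (Fin 2) k₁) (p : ℕ) where

  private
    k : ℕ
    k = suc k₁
    C : Code k
    C = c₀ ∷ c₁ ∷ cs

  W : ℚ
  W = ∑[ i < k₁ ] (fromℕ (toℕ (lookup cs i)) * fromℕ (k choose (2 ℕ.+ toℕ i)))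

  W≥0 : 0ℚ ≤ W
  W≥0 = ∑≥0 k₁ (λ i → fromℕ (toℕ (lookup cs i)) * fromℕ (k choose (2 ℕ.+ toℕ i)))
    λ i → *≥0 (fromℕ≥0 (toℕ (lookup cs i))) (fromℕ≥0 (k choose (2 ℕ.+ toℕ i)))

  -- `μ` is the part of λ without the logarithm, with the partial sum of 1/i² up to p in place of
  -- π²/6. Being rational, it can be inserted into `E` directly; `μ-≤` makes the passage to π²/6.
  a b μ : ℚ
  a = fromℕ (toℕ c₀ ℕ.* p)
  b = fromℕ (toℕ c₁ ℕ.* k)
  μ = a + squares p * W

  a≥0 : 0ℚ ≤ a
  a≥0 = fromℕ≥0 (toℕ c₀ ℕ.* p)

  b≥0 : 0ℚ ≤ b
  b≥0 = fromℕ≥0 (toℕ c₁ ℕ.* k)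

  squares≥0 : 0ℚ ≤ squares p
  squares≥0 = ∑≥0 p (λ i → rec (toℕ i) * rec (toℕ i)) λ i → *≥0 (rec≥0 (toℕ i)) (rec≥0 (toℕ i))

  μ≥0 : 0ℚ ≤ μ
  μ≥0 = +≥0 a≥0 (*≥0 squares≥0 W≥0)

  -- The summands β = 0 and β = 1 are kept exactly; for β ≥ 2 each power i^(-β) is replaced by
  -- i^(-2).
  ∑F-≤ : ∑F C p ≤ b * harmonic p + μ
  ∑F-≤ = begin
    ∑F C p
      ≡⟨ 𝐇≡∑F C p ⟨
    fromℕ (toℕ c₀) * 1ℚ * ∑[ i < p ] 1ℚ + (fromℕ (toℕ c₁) * fromℕ (k choose 1) * ∑[ i < p ] (rec (toℕ i) * 1ℚ)
      + ∑[ β < k₁ ] (fromℕ (toℕ (lookup cs β)) * fromℕ (k choose (2 ℕ.+ toℕ β)) * ∑[ i < p ] (rec (toℕ i) ^ (2 ℕ.+ toℕ β))))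
      ≤⟨ ℚ.+-mono-≤ (ℚ.≤-reflexive first) (ℚ.+-mono-≤ (ℚ.≤-reflexive second)
           (∑-≤ k₁ _ (λ β → squares p * (fromℕ (toℕ (lookup cs β)) * fromℕ (k choose (2 ℕ.+ toℕ β)))) rest)) ⟩
    a + (b * harmonic p + ∑[ β < k₁ ] (squares p * (fromℕ (toℕ (lookup cs β)) * fromℕ (k choose (2 ℕ.+ toℕ β)))))
      ≡⟨ cong (λ z → a + (b * harmonic p + z)) (∑-*ˡ k₁ (squares p) (λ β → fromℕ (toℕ (lookup cs β)) * fromℕ (k choose (2 ℕ.+ toℕ β)))) ⟩
    a + (b * harmonic p + squares p * W)
      ≡⟨ solve 3 (λ a x y → a :+ (x :+ y) := x :+ (a :+ y)) refl a (b * harmonic p) (squares p * W) ⟩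
    b * harmonic p + μ ∎
    where
    open ℚ.≤-Reasoning
    first : fromℕ (toℕ c₀) * 1ℚ * ∑[ i < p ] 1ℚ ≡ a
    first = trans (cong₂ _*_ (ℚ.*-identityʳ (fromℕ (toℕ c₀))) (trans (∑-const p 1ℚ) (ℚ.*-identityʳ (fromℕ p))))
      (sym (fromℕ-* (toℕ c₀) p))
    second : fromℕ (toℕ c₁) * fromℕ (k choose 1) * ∑[ i < p ] (rec (toℕ i) * 1ℚ) ≡ b * harmonic p
    second = cong₂ _*_ (trans (cong (λ z → fromℕ (toℕ c₁) * fromℕ z) (nC1≡n k)) (sym (fromℕ-* (toℕ c₁) k)))
      (∑-cong p λ i → ℚ.*-identityʳ (rec (toℕ i)))
    power-≤ : ∀ i β → rec i ^ (2 ℕ.+ β) ≤ rec i * rec i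
    power-≤ i β = *-monoˡ (rec≥0 i) (≤-eq refl (sym (ℚ.*-identityʳ (rec i))) (*-monoˡ (rec≥0 i) (^≤1 β)))
      where
      ^≤1 : ∀ β → rec i ^ β ≤ 1ℚ
      ^≤1 zero    = ℚ.≤-refl
      ^≤1 (suc β) = *-mono (^≥0 (rec≥0 i) β) 0≤1 (rec≤1 i) (^≤1 β)
    rest : ∀ β → fromℕ (toℕ (lookup cs β)) * fromℕ (k choose (2 ℕ.+ toℕ β)) * ∑[ i < p ] (rec (toℕ i) ^ (2 ℕ.+ toℕ β))
                 ≤ squares p * (fromℕ (toℕ (lookup cs β)) * fromℕ (k choose (2 ℕ.+ toℕ β)))
    rest β = ≤-eq (ℚ.*-comm c (∑[ i < p ] (rec (toℕ i) ^ (2 ℕ.+ toℕ β)))) refl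
      (*-monoʳ (*≥0 (fromℕ≥0 (toℕ (lookup cs β))) (fromℕ≥0 (k choose (2 ℕ.+ toℕ β))))
        (∑-≤ p _ (λ i → rec (toℕ i) * rec (toℕ i)) λ i → power-≤ (toℕ i) (toℕ β)))
      where c = fromℕ (toℕ (lookup cs β)) * fromℕ (k choose (2 ℕ.+ toℕ β))

  rational : ℕ → ℚ
  rational m = a + rec 5 * seq (π ^ᴿ 2) m * W

  logarithmic : ℕ → ℚ
  logarithmic m = logApprox p m + seq γ m

  seq-Λ : ∀ m → seq (Λ (s≤s z≤n) C (suc p)) m ≡ b * logarithmic m + rational m
  seq-Λ m = solve 3 (λ a x y → (a :+ x) :+ y := x :+ (a :+ y)) refl a (b * logarithmic m) (rec 5 * seq (π ^ᴿ 2) m * W)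

  π²≥0 : NonNeg (seq (π ^ᴿ 2))
  π²≥0 m = ≤-eq refl (trans (cong (seq π m *_) (ℚ.*-identityʳ (seq π m))) refl) (square≥0 (seq π m))
    where
    square≥0 : ∀ q → 0ℚ ≤ q * q
    square≥0 q with ℚ.≤-total 0ℚ q
    ... | inj₁ 0≤q = *≥0 0≤q 0≤q
    ... | inj₂ q≤0 = ≤-eq refl (solve 1 (λ q → q :* q := (:- q) :* (:- q)) refl q) (*≥0 (ℚ.neg-antimono-≤ q≤0) (ℚ.neg-antimono-≤ q≤0))

  rational≥0 : NonNeg rational
  rational≥0 m = +≥0 a≥0 (*≥0 (*≥0 (rec≥0 5) (π²≥0 m)) W≥0)

  logarithmic≥0 : NonNeg logarithmic
  logarithmic≥0 m = +≥0 (log≥0 p m) (γ≥0 m)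

  Λ≥0 : NonNeg (seq (Λ (s≤s z≤n) C (suc p)))
  Λ≥0 m = ≤-eq refl (seq-Λ m) (+≥0 (*≥0 b≥0 (logarithmic≥0 m)) (rational≥0 m))

  μ-≤ : ∀ ε → 0ℚ < ε → ∃ λ M → ∀ {m} → M ℕ.≤ m → μ ≤ rational m + ε
  μ-≤ ε 0<ε =
    let B , W≤B = above W
        δ , 0<δ , Bδ≤ε = shrink B 0<ε
        M , le = basel p δ 0<δ
    in M , λ {m} hm → (begin
      a + squares p * W
        ≤⟨ ℚ.+-monoʳ-≤ a (*-monoʳ W≥0 (le hm)) ⟩
      a + (rec 5 * seq (π ^ᴿ 2) m + δ) * W
        ≡⟨ solve 4 (λ a x d w → a :+ (x :+ d) :* w := (a :+ x :* w) :+ w :* d) refl a (rec 5 * seq (π ^ᴿ 2) m) δ W ⟩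
      rational m + W * δ
        ≤⟨ ℚ.+-monoʳ-≤ (rational m) (ℚ.≤-trans (*-monoʳ (ℚ.<⇒≤ 0<δ) W≤B) Bδ≤ε) ⟩
      rational m + ε ∎)
    where open ℚ.≤-Reasoning

  ⊑-rational : ∀ N → E N μ ⊑ rational
  ⊑-rational N = ⊑-mono (λ _ → μ≥0) rational≥0 μ-≤ (E≥0 μ≥0 N) (⊑-E N μ≥0)

  ⊑-Λ : ∀ {c d} → 0ℚ ≤ c → 0ℚ ≤ d → c ⊑ (λ m → b * logarithmic m) → d ⊑ rational → c * d ⊑ seq (Λ (s≤s z≤n) C (suc p))
  ⊑-Λ 0≤c 0≤d hc hd = ⊑-≗ (λ m → sym (seq-Λ m)) (⊑-+ 0≤c 0≤d (λ m → *≥0 b≥0 (logarithmic≥0 m)) rational≥0 hc hd)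

-- The hypothesis 1 ≤ n (r - p) is the case k = 1.
bernoulli : ∀ {n p r} → 0ℚ ≤ p → n ≡ 1ℚ + p → 1ℚ ≤ r → p ≤ r → 1ℚ ≤ n * (r - p) → ∀ k →
            n ^ k - p ^ k ≤ n ^ k * (r ^ k - p ^ k)
bernoulli         0≤p n≡ 1≤r p≤r base zero    = ℚ.≤-refl
bernoulli {n} {p} {r} 0≤p n≡ 1≤r p≤r base (suc k) = begin
  n * a - p * b
    -- As n = 1 + p, the difference equals n^k + p (n^k - p^k). The factors 1 are written out
    -- because each is then replaced by something larger: r^k and n (r - p) in the first term, n in
    -- the second.
    ≡⟨ trans (cong (λ z → z * a - p * b) n≡) (solve 3 (λ p a b → (con 1ℚ :+ p) :* a :- p :* b := a :* (con 1ℚ :* con 1ℚ) :+ con 1ℚ :* (p :* (a :- b))) refl p a b) ⟩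
  a * (1ℚ * 1ℚ) + 1ℚ * (p * (a - b))
    ≤⟨ ℚ.+-mono-≤
         (*-monoˡ a≥0 (*-mono 0≤1 (ℚ.≤-trans 0≤1 (1≤^ 1≤r k)) (1≤^ 1≤r k) base))
         (*-mono (*≥0 0≤p (≤⇒0≤- (^-mono 0≤p p≤n k))) (ℚ.≤-trans 0≤1 1≤n) 1≤n (*-monoˡ 0≤p (bernoulli 0≤p n≡ 1≤r p≤r base k))) ⟩
  a * (c * (n * (r - p))) + n * (p * (a * (c - b)))
    ≡⟨ solve 6 (λ n p r a b c → a :* (c :* (n :* (r :- p))) :+ n :* (p :* (a :* (c :- b))) := n :* a :* (r :* c :- p :* b)) refl n p r a b c ⟩
  n * a * (r * c - p * b) ∎
  where
  open ℚ.≤-Reasoning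
  a = n ^ k
  b = p ^ k
  c = r ^ k
  1≤n : 1ℚ ≤ n
  1≤n = +-slack p 0≤p n≡
  p≤n : p ≤ n
  p≤n = +-slack 1ℚ 0≤1 (trans n≡ (ℚ.+-comm 1ℚ p))
  a≥0 : 0ℚ ≤ a
  a≥0 = ^≥0 (ℚ.≤-trans 0≤1 1≤n) k

module _ (p : ℕ) (2≤p : 2 ℕ.≤ p) where

  private
    P̂ n s r : ℚ
    P̂ = fromℕ p
    n = fromℕ (suc p)
    s = s₂ p
    r = n * (P̂ * s)

    s≥0 : 0ℚ ≤ s
    s≥0 = *≥0 (fromℕ≥0 7) (rec≥0 (3 ℕ.+ 7 ℕ.* p))

    3/7 : ℚ
    3/7 = fromℕ 3 * rec 6

    3/7≥0 : 0ℚ ≤ 3/7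
    3/7≥0 = *≥0 (fromℕ≥0 3) (rec≥0 6)

    p*s : P̂ * s ≡ 1ℚ - 4/7 * s
    p*s = trans (solve 3 (λ p s c → p :* s := s :* (p :+ c) :- c :* s) refl P̂ s 4/7) (cong (λ z → z - 4/7 * s) (s₂-inv p))

    r≡ : r ≡ P̂ + 3/7 * (P̂ * s)
    r≡ = begin
      n * (P̂ * s)                       ≡⟨ cong (_* (P̂ * s)) (fromℕ-suc p) ⟩
      (1ℚ + P̂) * (P̂ * s)                ≡⟨ solve 2 (λ p s → (con 1ℚ :+ p) :* (p :* s) := p :* (s :* (p :+ con 4/7)) :+ con 3/7 :* (p :* s)) refl P̂ s ⟩
      P̂ * (s * (P̂ + 4/7)) + 3/7 * (P̂ * s) ≡⟨ cong (λ z → P̂ * z + 3/7 * (P̂ * s)) (s₂-inv p) ⟩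
      P̂ * 1ℚ + 3/7 * (P̂ * s)            ≡⟨ cong (_+ 3/7 * (P̂ * s)) (ℚ.*-identityʳ P̂) ⟩
      P̂ + 3/7 * (P̂ * s)                 ∎
      where open ≡-Reasoning

    p≤r : P̂ ≤ r
    p≤r = +-slack (3/7 * (P̂ * s)) (*≥0 3/7≥0 (*≥0 (fromℕ≥0 p) s≥0)) r≡

    1≤r : 1ℚ ≤ r
    1≤r = ℚ.≤-trans (fromℕ-mono (ℕ.≤-trans (s≤s z≤n) 2≤p)) p≤r

    7/9≤p*s : fromℕ 7 * rec 8 ≤ P̂ * s
    7/9≤p*s = ≤-eq refl p*s (ℚ.≤-trans
      (ℚ.≤-reflexive (solve 1 (λ x → con (fromℕ 7 * rec 8) := con 1ℚ :- con 4/7 :* (con (fromℕ 7 * rec 17) :+ con 0ℚ :* x)) refl s))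
      (ℚ.+-monoʳ-≤ 1ℚ (ℚ.neg-antimono-≤ (*-monoˡ (*≥0 (fromℕ≥0 4) (rec≥0 6))
        (≤-eq refl (solve 2 (λ a b → a :+ con 0ℚ :* b := a) refl (fromℕ 7 * rec 17) s) s≤)))))
      where
      s≤ : s ≤ fromℕ 7 * rec 17
      s≤ = *-monoˡ (fromℕ≥0 7) (rec-anti (ℕ.+-monoʳ-≤ 3 (ℕ.*-monoʳ-≤ 7 2≤p)))

    base : 1ℚ ≤ n * (r - P̂)
    base = begin
      1ℚ
        ≡⟨⟩
      -- This is the value of n (r - p) at p = 2, namely 6/7 + 1/7, where p · s = 2 · 7/18 = 7/9.
      -- The inequality is sharp there.
      3/7 * fromℕ 2 + 3/7 * 3/7 * (fromℕ 7 * rec 8)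
        ≤⟨ ℚ.+-mono-≤ (*-monoˡ 3/7≥0 (fromℕ-mono 2≤p)) (*-monoˡ (*≥0 3/7≥0 3/7≥0) 7/9≤p*s) ⟩
      3/7 * P̂ + 3/7 * 3/7 * (P̂ * s)
        ≡⟨ solve 3 (λ c p x → c :* p :+ c :* c :* x := c :* (p :+ c :* x)) refl 3/7 P̂ (P̂ * s) ⟩
      3/7 * (P̂ + 3/7 * (P̂ * s))
        ≡⟨ cong (3/7 *_) (sym r≡) ⟩
      3/7 * (n * (P̂ * s))
        ≡⟨ solve 4 (λ c n x p → c :* (n :* x) := n :* ((p :+ c :* x) :- p)) refl 3/7 n (P̂ * s) P̂ ⟩
      n * ((P̂ + 3/7 * (P̂ * s)) - P̂)
        ≡⟨ cong (λ z → n * (z - P̂)) (sym r≡) ⟩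
      n * (r - P̂) ∎
      where open ℚ.≤-Reasoning

  -- The excess n^k - p^k of the first summand has to be paid for by (r^k - p^k) X, where r = n p/(p
  -- + 4/7) exceeds p. As X ≥ n^k, it is enough to do so with n^k in place of X, and that is
  -- `bernoulli`.
  combine : ∀ k {X} → n ^ k ≤ X → n ^ k - P̂ ^ k + P̂ ^ k * X ≤ r ^ k * X
  combine k {X} n≤X = begin
    n ^ k - P̂ ^ k + P̂ ^ k * X
      ≤⟨ ℚ.+-monoˡ-≤ (P̂ ^ k * X) (ℚ.≤-trans (bernoulli (fromℕ≥0 p) (fromℕ-suc p) 1≤r p≤r base k)
           (*-monoʳ (≤⇒0≤- (^-mono (fromℕ≥0 p) p≤r k)) n≤X)) ⟩
    X * (r ^ k - P̂ ^ k) + P̂ ^ k * X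
      ≡⟨ solve 3 (λ x r p → x :* (r :- p) :+ p :* x := r :* x) refl X (r ^ k) (P̂ ^ k) ⟩
    r ^ k * X ∎
    where open ℚ.≤-Reasoning

-- Abstract, because unfolding Λ (and with it the Cauchy proofs) in a comparison is prohibitive.
abstract

  RatioBound : ∀ {k} → 1 ℕ.≤ k → Code k → Code k → ℕ → Set
  RatioBound 1≤k C D n =
    fromℚ (((∑[ m ≤ n ] Omax D n (toℕ m)) ÷ (∑[ m ≤ n ] fromℕ (O C n (toℕ m)))) {{O-total-nonZero C n}}) ≤ᴿ exp (Λ 1≤k D n)

  RatioBound⇒≤ᴿ : ∀ {k} (1≤k : 1 ℕ.≤ k) (C D : Code k) n → RatioBound 1≤k C D n →
    fromℚ (((∑[ m ≤ n ] Omax D n (toℕ m)) ÷ (∑[ m ≤ n ] fromℕ (O C n (toℕ m)))) {{O-total-nonZero C n}}) ≤ᴿ exp (Λ 1≤k D n)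
  RatioBound⇒≤ᴿ 1≤k C D n bound = bound

  ⊑⇒RatioBound : ∀ {k} (1≤k : 1 ℕ.≤ k) (C D : Code k) p c → NonNeg (seq (Λ 1≤k D (suc p))) → c ⊑ seq (Λ 1≤k D (suc p)) →
                 maxSum D p ≤ c * fromℕ (suc p) ^ k → RatioBound 1≤k C D (suc p)
  ⊑⇒RatioBound 1≤k C D p c 0≤x c⊑x le =
    fromℚ-≤ {x = exp (Λ 1≤k D (suc p))} (Omax-ratio-≤ C D p {c} le) (⊑⇒≤exp (Λ 1≤k D (suc p)) 0≤x c⊑x)

-- The ratio bound for c₁ = 0, for c₁ = 1 with n = 2, and for c₁ = 1 with n ≥ 3

module _ (k₁ : ℕ) (c₀ : Fin 2) (cs : Vec (Fin 2) k₁) (p : ℕ) where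

  private
    k n : ℕ
    k = suc k₁
    n = suc p
    D : Code k
    D = c₀ ∷ zero ∷ cs
    module L = Lambda k₁ c₀ zero cs p

    ∑F≤μ : ∑F D p ≤ L.μ
    ∑F≤μ = ≤-eq refl (solve 2 (λ x m → m := con 0ℚ :* x :+ m) refl (harmonic p) L.μ) L.∑F-≤

    bound : maxSum D p ≤ 1ℚ * E n L.μ * fromℕ n ^ k
    bound = ℚ.≤-trans (maxSum-≤ D p)
      (*-monoʳ (^≥0 (fromℕ≥0 n) k) (≤-eq refl (ℚ.*-identityˡ (E n L.μ)) (E-mono (∑F≥0 D p) ∑F≤μ n)))

    one : 1ℚ ⊑ (λ m → L.b * L.logarithmic m)
    one = ⊑-exact (λ m → *≥0 L.b≥0 (L.logarithmic≥0 m)) (0 , λ _ → 1 , ℚ.≤-refl)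

  ratio-c₁≡0 : ∀ (C : Code (suc k₁)) → RatioBound (s≤s z≤n) C (c₀ ∷ zero ∷ cs) (suc p)
  ratio-c₁≡0 C = ⊑⇒RatioBound (s≤s z≤n) C (c₀ ∷ zero ∷ cs) p (1ℚ * E n L.μ) L.Λ≥0
    (L.⊑-Λ {1ℚ} {E n L.μ} 0≤1 (E≥0 L.μ≥0 n) one (L.⊑-rational n)) bound

module _ (k₁ : ℕ) (c₀ : Fin 2) (cs : Vec (Fin 2) k₁) where

  private
    k : ℕ
    k = suc k₁
    D : Code k
    D = c₀ ∷ suc zero ∷ cs

  ratio-c₁≡1-n≡2 : ∀ (C : Code (suc k₁)) → RatioBound (s≤s z≤n) C (c₀ ∷ suc zero ∷ cs) (suc (suc zero))
  ratio-c₁≡1-n≡2 C = ⊑⇒RatioBound (s≤s z≤n) C (c₀ ∷ suc zero ∷ cs) (suc zero) 1ℚ L.Λ≥0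
    (⊑-exact L.Λ≥0 (0 , λ _ → 1 , ℚ.≤-refl))
    (≤-eq (maxSum-1 D) (ℚ.*-identityˡ (fromℕ 2 ^ k)) ℚ.≤-refl)
    where module L = Lambda k₁ c₀ (suc zero) cs 1

  module _ (q : ℕ) (2≤p : 2 ℕ.≤ suc q) where

    private
      p n N : ℕ
      p = suc q
      n = suc p
      -- Long enough for two purposes: n + 1 terms for the k-th power in `E-×-≤`, and 2p + 1 terms
      -- for exp(H_p) ≥ p + 1.
      N = suc n ℕ.+ (p ℕ.* 2 ℕ.+ 1)
      module L = Lambda k₁ c₀ (suc zero) cs p
      H Y U s c : ℚ
      H = harmonic p
      Y = E N H
      U = E N L.μ
      s = s₂ p
      -- A lower bound for exp(k (log p + γ)), with p for exp(log p) and exp(H_p)/(p + 4/7),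
      -- truncated, for exp γ.
      c = (fromℕ p * (s * Y)) ^ k

      Y≥0 : 0ℚ ≤ Y
      Y≥0 = E≥0 (harmonic≥0 p) N

      s*Y≥0 : 0ℚ ≤ s * Y
      s*Y≥0 = *≥0 (*≥0 (fromℕ≥0 7) (rec≥0 (3 ℕ.+ 7 ℕ.* p))) Y≥0

      ⊑-logarithmic : fromℕ p * (s * Y) ⊑ L.logarithmic
      ⊑-logarithmic = ⊑-+ (fromℕ≥0 p) s*Y≥0 (log≥0 p) γ≥0 (⊑-log q) (⊑-exact γ≥0 (γ-≥₂ p 2≤p N))

      c⊑ : c ⊑ (λ m → L.b * L.logarithmic m)
      c⊑ = ⊑-≗ (λ m → cong (λ z → fromℕ z * L.logarithmic m) (sym (ℕ.+-identityʳ k)))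
        (⊑-× (*≥0 (fromℕ≥0 p) s*Y≥0) L.logarithmic≥0 ⊑-logarithmic k)

      n≤Y : fromℕ n ≤ Y
      n≤Y = ℚ.≤-trans (≤-eq refl (sym (ℚ.*-identityˡ (E (p ℕ.* 2 ℕ.+ 1) H))) (E-block-≥ 0 p))
        (E-monoᴺ (harmonic≥0 p) (ℕ.m≤n+m (p ℕ.* 2 ℕ.+ 1) (suc n)))

      ∑F≤ : ∑F D p ≤ fromℕ k * H + L.μ
      ∑F≤ = ≤-eq refl (cong (λ z → fromℕ z * H + L.μ) (sym (ℕ.+-identityʳ k))) L.∑F-≤

      E-∑F : E n (∑F D p) ≤ Y ^ k * U
      E-∑F = begin
        E n (∑F D p)                        ≤⟨ E-mono (∑F≥0 D p) ∑F≤ n ⟩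
        E n (fromℕ k * H + L.μ)            ≤⟨ E-+-≤ n (*≥0 (fromℕ≥0 k) (harmonic≥0 p)) L.μ≥0 ⟩
        E n (fromℕ k * H) * E n L.μ        ≤⟨ *-mono (E≥0 L.μ≥0 n) (^≥0 Y≥0 k)
                                                (ℚ.≤-trans (E-×-≤ n k (harmonic≥0 p)) (^-mono (E≥0 (harmonic≥0 p) (suc n)) (E-monoᴺ (harmonic≥0 p) (ℕ.m≤m+n (suc n) (p ℕ.* 2 ℕ.+ 1))) k))
                                                (E-monoᴺ L.μ≥0 (ℕ.≤-trans (ℕ.n≤1+n n) (ℕ.m≤m+n (suc n) (p ℕ.* 2 ℕ.+ 1)))) ⟩
        Y ^ k * U                          ∎
        where open ℚ.≤-Reasoning

      n^k≤ : fromℕ n ^ k ≤ Y ^ k * U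
      n^k≤ = ≤-eq (sym (ℚ.*-identityʳ (fromℕ n ^ k))) refl
        (*-mono 0≤1 (^≥0 Y≥0 k) (^-mono (fromℕ≥0 n) n≤Y k) (1≤E L.μ≥0 (n ℕ.+ (p ℕ.* 2 ℕ.+ 1))))

      bound : maxSum D p ≤ c * U * fromℕ n ^ k
      bound = begin
        maxSum D p
          ≤⟨ maxSum-≤′ D p ⟩
        fromℕ n ^ k - fromℕ p ^ k + fromℕ p ^ k * E n (∑F D p)
          ≤⟨ ℚ.+-monoʳ-≤ (fromℕ n ^ k - fromℕ p ^ k) (*-monoˡ (^≥0 (fromℕ≥0 p) k) E-∑F) ⟩
        fromℕ n ^ k - fromℕ p ^ k + fromℕ p ^ k * (Y ^ k * U)
          ≤⟨ combine p 2≤p k n^k≤ ⟩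
        (fromℕ n * (fromℕ p * s)) ^ k * (Y ^ k * U)
          ≡⟨ cong (_* (Y ^ k * U)) (*-^ (fromℕ n) (fromℕ p * s) k) ⟩
        fromℕ n ^ k * (fromℕ p * s) ^ k * (Y ^ k * U)
          ≡⟨ solve 4 (λ a b y u → a :* b :* (y :* u) := b :* y :* u :* a) refl (fromℕ n ^ k) ((fromℕ p * s) ^ k) (Y ^ k) U ⟩
        (fromℕ p * s) ^ k * Y ^ k * U * fromℕ n ^ k
          ≡⟨ cong (λ z → z * U * fromℕ n ^ k) (trans (sym (*-^ (fromℕ p * s) Y k)) (cong (_^ k) (ℚ.*-assoc (fromℕ p) s Y))) ⟩
        c * U * fromℕ n ^ k ∎
        where open ℚ.≤-Reasoning

    ratio-c₁≡1 : ∀ (C : Code (suc k₁)) → RatioBound (s≤s z≤n) C (c₀ ∷ suc zero ∷ cs) (suc (suc q))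
    ratio-c₁≡1 C = ⊑⇒RatioBound (s≤s z≤n) C (c₀ ∷ suc zero ∷ cs) (suc q) (c * U) L.Λ≥0
      (L.⊑-Λ {c} {U} (^≥0 (*≥0 (fromℕ≥0 p) s*Y≥0) k) (E≥0 L.μ≥0 N) c⊑ (L.⊑-rational N)) bound

ratio-≤-exp : ∀ {k} (1≤k : 1 ℕ.≤ k) (C D : Code k) q → RatioBound 1≤k C D (suc (suc q))
ratio-≤-exp {suc k₁} (s≤s z≤n) C (c₀ ∷ zero ∷ cs)     q       = ratio-c₁≡0 k₁ c₀ cs (suc q) C
ratio-≤-exp {suc k₁} (s≤s z≤n) C (c₀ ∷ suc zero ∷ cs) zero    = ratio-c₁≡1-n≡2 k₁ c₀ cs C
ratio-≤-exp {suc k₁} (s≤s z≤n) C (c₀ ∷ suc zero ∷ cs) (suc q) = ratio-c₁≡1 k₁ c₀ cs (suc q) (s≤s (s≤s z≤n)) C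

-- From n = q + 2 to the hypothesis n ≥ 2

harmonic-log : ℕ → ℝ
harmonic-log n = fromℚ (harmonic (n ∸ 1)) -ᴿ log (n ∸ 1)

harmonic-log+log : ∀ n m → seq (harmonic-log n) m + logApprox (n ∸ 1) m ≡ harmonic (n ∸ 1)
harmonic-log+log n m = solve 2 (λ h l → (h :- l) :+ l := h) refl (harmonic (n ∸ 1)) (logApprox (n ∸ 1) m)

harmonic-log≥0 : ∀ n → 2 ℕ.≤ n → NonNeg (seq (harmonic-log n))
harmonic-log≥0 (suc (suc q)) (s≤s (s≤s z≤n)) m = γ-approx≥0 q m

stirling-ratio-≤ : ∀ n → 2 ℕ.≤ n → ∀ r x → r ≡ fromℕ (n ∸ 1) * rec (n ∸ 1) → NonNeg (seq x) →
  (∀ m → seq x m + logApprox (n ∸ 1) m ≡ harmonic (n ∸ 1)) →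
  fromℚ (((∑[ m ≤ n ] stirlingMax n (toℕ m)) ÷ (∑[ m ≤ n ] fromℕ (stirling n (toℕ m)))) {{stirling-total-nonZero n}})
    ≤ᴿ fromℚ r *ᴿ exp x
stirling-ratio-≤ (suc (suc q)) (s≤s (s≤s z≤n)) r x r≡ 0≤x x+log = stirling-ratio q {r} {x} r≡ 0≤x x+log

exp-≤-exp-γ : ∀ n → 2 ℕ.≤ n → ∀ r x → r ≡ fromℕ (n ∸ 1) * rec (n ∸ 1) → NonNeg (seq x) →
  (∀ m → seq x m + logApprox (n ∸ 1) m ≡ harmonic (n ∸ 1)) → fromℚ r *ᴿ exp x ≤ᴿ exp γ
exp-≤-exp-γ (suc (suc q)) (s≤s (s≤s z≤n)) r x r≡ 0≤x x+log = exp-harmonic-log-≤ q {r} {x} r≡ 0≤x x+log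

open import Data.Integer.Base using (+_)

[n-1]/n≡ : ∀ n (2≤n : 2 ℕ.≤ n) → (+ (n ∸ 1) / n) {{ℕ.>-nonZero (ℕ.<⇒≤ 2≤n)}} ≡ fromℕ (n ∸ 1) * rec (n ∸ 1)
[n-1]/n≡ (suc (suc q)) (s≤s (s≤s z≤n)) = /≡*rec (suc q) (suc q)

O≤Omax-complement : ∀ n → 2 ℕ.≤ n → ∀ {k} (C : Code k) m → m ℕ.≤ n → fromℕ (O C n m) ≤ Omax (C ′) n (n ∸ m)
O≤Omax-complement (suc (suc q)) (s≤s (s≤s z≤n)) C m = O≤Omax-′ C (suc q) m

Omax-ratio-≤-exp : ∀ n → 2 ℕ.≤ n → ∀ {k} (1≤k : 1 ℕ.≤ k) (C D : Code k) →
  fromℚ (((∑[ m ≤ n ] Omax D n (toℕ m)) ÷ (∑[ m ≤ n ] fromℕ (O C n (toℕ m)))) {{O-total-nonZero C n}}) ≤ᴿ exp (Λ 1≤k D n)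
Omax-ratio-≤-exp (suc (suc q)) (s≤s (s≤s z≤n)) 1≤k C D = RatioBound⇒≤ᴿ 1≤k C D (suc (suc q)) (ratio-≤-exp 1≤k C D q)

theorem5p3 : (n : ℕ) (2≤n : 2 ℕ.≤ n) →
    ( (k : ℕ) (1≤k : 1 ℕ.≤ k) (C : Code k) →
    ((m : ℕ) → m ℕ.≤ n → fromℕ (O C n m) ≤ Omax (C ′) n (n ∸ m))
    × fromℚ (((∑[ m ≤ n ] Omax C n (toℕ m)) ÷ (∑[ m ≤ n ] fromℕ (O C n (toℕ m)))) {{O-total-nonZero C n}})
    ≤ᴿ exp (Λ 1≤k C n)
    × fromℚ (((∑[ m ≤ n ] Omax (C ′) n (toℕ m)) ÷ (∑[ m ≤ n ] fromℕ (O C n (toℕ m)))) {{O-total-nonZero C n}})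
    ≤ᴿ exp (Λ 1≤k (C ′) n)
    )
    × fromℚ (((∑[ m ≤ n ] stirlingMax n (toℕ m)) ÷ (∑[ m ≤ n ] fromℕ (stirling n (toℕ m)))) {{stirling-total-nonZero n}})
    ≤ᴿ fromℚ ((+ (n ∸ 1) / n) {{ℕ.>-nonZero (ℕ.<⇒≤ 2≤n)}})
    *ᴿ exp (fromℚ (harmonic (n ∸ 1)) -ᴿ log (n ∸ 1))
    × fromℚ ((+ (n ∸ 1) / n) {{ℕ.>-nonZero (ℕ.<⇒≤ 2≤n)}})
    *ᴿ exp (fromℚ (harmonic (n ∸ 1)) -ᴿ log (n ∸ 1))
    ≤ᴿ exp γ
    × exp γ ≤ᴿ fromℚ (+ 17811 / 10000)
theorem5p3 n 2≤n =
  (λ k 1≤k C → O≤Omax-complement n 2≤n C , Omax-ratio-≤-exp n 2≤n 1≤k C C , Omax-ratio-≤-exp n 2≤n 1≤k C (C ′))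
  , stirling-ratio-≤ n 2≤n ((+ (n ∸ 1) / n) {{ℕ.>-nonZero (ℕ.<⇒≤ 2≤n)}}) (fromℚ (harmonic (n ∸ 1)) -ᴿ log (n ∸ 1))
      ([n-1]/n≡ n 2≤n) (harmonic-log≥0 n 2≤n) (harmonic-log+log n)
  , exp-≤-exp-γ n 2≤n ((+ (n ∸ 1) / n) {{ℕ.>-nonZero (ℕ.<⇒≤ 2≤n)}}) (fromℚ (harmonic (n ∸ 1)) -ᴿ log (n ∸ 1))
      ([n-1]/n≡ n 2≤n) (harmonic-log≥0 n 2≤n) (harmonic-log+log n)
  , exp-γ-≤
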